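{- Let $G$ be a planar graph that contains no cycle of length $4$, no cycle of length $7$, no cycle of length $9$, and no $5$-cycle that is normally adjacent to a $3$-cycle. Then $G$ is $(\mathcal{I},\mathcal{F})$-partitionable, i.e., $V(G)$ can be partitioned into two sets $\mathcal{I}$ and $\mathcal{F}$ such that $\mathcal{I}$ is an independent set of $G$ and $G[\mathcal{F}]$ is a forest.
   Context: Graphs are finite and simple. A $k$-cycle is a cycle of length $k$. Two cycles are normally adjacent if their intersection (as subgraphs) is isomorphic to the complete graph $K_2$, i.e., they share exactly one edge and its two endpoints and nothing else. -}

module Defs where

open import Data.Nat using (ℕ; zero; suc; _+_; _*_; _≤_; _<_; _≤ᵇ_; _<ᵇ_)
open import Data.Bool using (Bool; true; false; _∧_; _∨_; not; if_then_else_; T)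
open import Data.Fin using (Fin; zero; suc; toℕ)
open import Data.Fin.Properties using (_≟_)
open import Data.List using (List; allFin; map)
open import Data.Nat.ListAction using (sum)
open import Data.Bool.ListAction using (all; any)
open import Data.Maybe using (Maybe; just; nothing; maybe)
open import Data.Product using (Σ; ∃; ∃-syntax; _×_; _,_; proj₁; proj₂)
open import Data.Sum using (_⊎_)
open import Data.Empty using (⊥)
open import Function using (id; Injective)
open import Relation.Binary.PropositionalEquality using (_≡_; _≢_)
open import Relation.Nullary using (¬_)
open import Relation.Nullary.Decidable using (⌊_⌋)

record Graph : Set where
  field
    n      : ℕ
    adj    : Fin n → Fin n → Bool
    sym    : ∀ u v → adj u v ≡ adj v u
    irrefl : ∀ u → adj u u ≡ false

-- Cycles, stated for an arbitrary vertex type with an adjacency relation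
-- (so that they also apply to induced subgraphs).

step : ∀ {k} → Fin (suc k) → Maybe (Fin (suc k))
step {zero}  zero    = nothing
step {suc k} zero    = just (suc zero)
step {suc k} (suc i) = Data.Maybe.map suc (step {k} i)

next : ∀ {k} → Fin k → Fin k
next {suc k} i = maybe id zero (step i)

record Cycle (V : Set) (adj : V → V → Bool) (k : ℕ) : Set where
  field
    len≥3 : 3 ≤ k
    vert  : Fin k → V
    inj   : Injective _≡_ _≡_ vert
    edge  : ∀ i → T (adj (vert i) (vert (next i)))

module _ {V : Set} {adj : V → V → Bool} where
  open Cycle

  OnCycle : ∀ {k} → Cycle V adj k → V → Set
  OnCycle C w = ∃[ i ] vert C i ≡ w

  CycleEdge : ∀ {k} → Cycle V adj k → V → V → Set
  CycleEdge C u v = ∃[ i ] ((vert C i ≡ u × vert C (next i) ≡ v)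
                          ⊎ (vert C i ≡ v × vert C (next i) ≡ u))

  -- C ∩ D (as subgraphs) is isomorphic to K₂: the common vertices are
  -- exactly two distinct vertices u, v, and uv is an edge of both cycles.
  NormallyAdjacent : ∀ {k l} → Cycle V adj k → Cycle V adj l → Set
  NormallyAdjacent C D =
    ∃[ u ] ∃[ v ] (u ≢ v
      × (OnCycle C u × OnCycle D u)
      × (OnCycle C v × OnCycle D v)
      × (∀ w → OnCycle C w → OnCycle D w → w ≡ u ⊎ w ≡ v)
      × CycleEdge C u v × CycleEdge D u v)

IsForest : (V : Set) → (V → V → Bool) → Set
IsForest V adj = ∀ k → ¬ Cycle V adj k

module _ (G : Graph) where
  open Graph G

  Adj : Fin n → Fin n → Set
  Adj u v = T (adj u v)

  HasCycleOfLength : ℕ → Set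
  HasCycleOfLength k = Cycle (Fin n) adj k

  InducedV : (Fin n → Bool) → Set
  InducedV S = Σ (Fin n) (λ v → T (S v))

  inducedAdj : (S : Fin n → Bool) → InducedV S → InducedV S → Bool
  inducedAdj S (u , _) (v , _) = adj u v

  IsIndependent : (Fin n → Bool) → Set
  IsIndependent S = ∀ u v → Adj u v → T (S u) → T (S v) → ⊥

  IFPartitionable : Set
  IFPartitionable = ∃[ χ ] (IsIndependent χ
                          × IsForest (InducedV (λ v → not (χ v)))
                                     (inducedAdj (λ v → not (χ v))))

  -- Planarity via combinatorial embeddings (rotation systems) and
  -- Euler's formula (genus 0).

  count : (Fin n → Bool) → ℕ
  count p = sum (map (λ i → if p i then 1 else 0) (allFin n))

  iter : ∀ {A : Set} → (A → A) → ℕ → A → A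
  iter f zero    a = a
  iter f (suc k) a = f (iter f k a)

  record RotationSystem : Set where
    field
      rot     : Fin n → Fin n → Fin n
      rot-adj : ∀ u v → Adj u v → Adj u (rot u v)
      rot-inj : ∀ u v w → Adj u v → Adj u w → rot u v ≡ rot u w → v ≡ w
      rot-cyc : ∀ u v w → Adj u v → Adj u w → ∃[ k ] iter (rot u) k v ≡ w

  module _ (R : RotationSystem) where
    open RotationSystem R

    Dart : Set
    Dart = Fin n × Fin n

    -- face-tracing permutation on darts
    φ : Dart → Dart
    φ (u , v) = (v , rot v u)

    key : Dart → ℕ
    key (u , v) = toℕ u * n + toℕ v

    isRep : Dart → Bool
    isRep d = all (λ k → key d ≤ᵇ key (iter φ (toℕ k) d)) (allFin (n * n))

    faces : ℕ
    faces = sum (map (λ u → count (λ v → adj u v ∧ isRep (u , v))) (allFin n))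

  edges : ℕ
  edges = sum (map (λ u → count (λ v → adj u v ∧ (toℕ u <ᵇ toℕ v))) (allFin n))

  reach : ℕ → Fin n → Fin n → Bool
  reach zero    u v = ⌊ u ≟ v ⌋
  reach (suc k) u v = reach k u v ∨ any (λ w → reach k u w ∧ adj w v) (allFin n)

  components : ℕ
  components = count (λ u → all (λ w → not (reach n w u) ∨ not (toℕ w <ᵇ toℕ u)) (allFin n))

  isolated : ℕ
  isolated = count (λ u → all (λ v → not (adj u v)) (allFin n))

  -- G is planar iff it has a rotation system of genus 0, i.e. one for which
  -- Euler's formula  V − E + F = 2·(#nontrivial components) + (#isolated)
  -- holds (F = number of traced faces, counted per component).
  Planar : Set
  Planar = Σ RotationSystem λ R →
             n + faces R + isolated ≡ 2 * components + edges

{-# OPTIONS --safe #-}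

-- Delete an edge from a counterexample with the fewest edges: the resulting graph, which
-- still satisfies Euler's inequality, has a partition, and every local configuration to which
-- such a partition extends is therefore absent. Vertices of degree at most 2 are excluded in
-- this way. So are two configurations around a face of length 10 all of whose vertices have
-- degree 3. Its boundary is an even cycle, to which a partition of the rest extends unless all
-- ten outer neighbours lie in I; hence no triangle on such a face has a third vertex of degree 3,
-- and a recolouring argument around a neighbouring face excludes the other configuration.
--
-- Give every vertex the charge 2 d(v) − 6 and every face d(f) − 6, with negative total. The
-- forbidden cycles force the faces next to a triangle to have length at least 10 and keep
-- hexagons away from pentagons. A vertex of degree 3 passes on 1/2 to its triangle, or 1/4 to
-- its pentagons, from each of its other faces; a vertex of degree at least 4 pays 1 to each of
-- its triangles and at most 1/2 to each of its other faces. This leaves a deficit only at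
-- 10-faces whose vertices all have degree 3, and these receive 1/4 across each edge that joins
-- two of their triangles. Then no vertex or face is left with a negative charge.
module Submission where

open import Defs
open import Data.Nat using (ℕ; zero; suc; _+_; _*_; _∸_; _≤_; _<_; _≡ᵇ_; _≤ᵇ_; _<ᵇ_; z≤n; s≤s; _≤?_; _<?_; _%_; _/_)
import Data.Nat.Properties as ℕₚ
open import Data.Nat.DivMod using (m%n<n; m≡m%n+[m/n]*n)
open import Data.Bool using (Bool; true; false; _∧_; _∨_; not; if_then_else_; T)
import Data.Bool.Properties as Boolₚ
open import Data.Fin using (Fin; zero; #_; suc; toℕ; fromℕ<; combine; remQuot)
import Data.Fin.Properties as Finₚ
open import Data.List using (List; []; _∷_; allFin; map; _++_; length)
import Data.List as List
import Data.Nat.ListAction as ListAct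
open import Data.Bool.ListAction using (all; any)
open import Data.Maybe using (just; nothing)
open import Data.Product using (∃; ∃-syntax; _×_; _,_; proj₁; proj₂; uncurry)
open import Data.Sum using (_⊎_; inj₁; inj₂; [_,_]′)
open import Data.Empty using (⊥; ⊥-elim)
open import Data.Unit using (tt)
open import Function using (id; _∘_; case_of_)
open import Relation.Binary.PropositionalEquality
open import Relation.Binary.Definitions using (DecidableEquality; tri<; tri≈; tri>)
open import Relation.Nullary using (¬_; Dec; yes; no; does)
open import Relation.Nullary.Decidable using (map′; _×-dec_; _⊎-dec_; _→-dec_; ¬?; toWitness; fromWitness)
open import Algebra.Properties.CommutativeMonoid.Sum ℕₚ.+-0-commutativeMonoid using (∑-distrib-+; ∑-comm; sum-cong-≗) renaming (sum to ∑)
open import Data.Nat.Tactic.RingSolver using (solve-∀)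
open import Relation.Binary.Construct.Closure.ReflexiveTransitive using (Star; ε; _◅_; _◅◅_; reverse)
import Data.List.Relation.Unary.All as All
open import Data.List.Relation.Unary.All using (All; []; _∷_)
import Data.List.Relation.Unary.All.Properties as Allₚ
import Data.List.Properties as Listₚ

-- Finite sums

-- A face boundary is only known as a closed walk: no connectivity is assumed, so vertices may
-- repeat, and the forbidden cycle lengths do not apply to it at once. Which vertices coincide has
-- to be settled first; this large but mechanical case analysis is left to certificates with a
-- verified checker. It shows in particular that a face of length 10 next to a triangle is a
-- chordless cycle, on which recolouring can act. Faces of length 10 and 11 are treated in the same
-- spirit, by a pruned search over cyclic words of vertex and face types. A single edge is deleted,
-- not the vertices of a configuration: the vertex set stays in place, and the vertices to be
-- coloured anew are simply erased, one end of the deleted edge among them. To follow Euler's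
-- inequality, face tracing is made a permutation of all ordered pairs of vertices; deletion
-- multiplies it by a transposition and then takes two points out of their orbits.

when : Bool → ℕ → ℕ
when b k = if b then k else 0

when-mono : ∀ {b c} {k l} → (b ≡ true → c ≡ true) → k ≤ l → when b k ≤ when c l
when-mono {false} _ _ = z≤n
when-mono {true} {c} b⇒c k≤l rewrite b⇒c refl = k≤l

T⇒≡ : ∀ {b} → T b → b ≡ true
T⇒≡ {true} _ = refl

≡⇒T : ∀ {b} → b ≡ true → T b
≡⇒T refl = tt

≡false⇒¬T : ∀ {b} → b ≡ false → ¬ T b
≡false⇒¬T refl ()

¬T⇒≡false : ∀ {b} → ¬ T b → b ≡ false
¬T⇒≡false {false} _  = refl
¬T⇒≡false {true}  ¬t = ⊥-elim (¬t tt)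

true-false : ∀ {b : Bool} {A : Set} → b ≡ true → b ≡ false → A
true-false refl ()

∧-T : ∀ {a b} → T (a ∧ b) → T a × T b
∧-T {true} t = tt , t

∧-≡ : ∀ {a b} → a ∧ b ≡ true → a ≡ true × b ≡ true
∧-≡ {true} t = refl , t

dec-true : ∀ {A : Set} (d : Dec A) → does d ≡ true → A
dec-true (yes a) _ = a

true-dec : ∀ {A : Set} (d : Dec A) → A → does d ≡ true
true-dec (yes _) _ = refl
true-dec (no ¬a) a = ⊥-elim (¬a a)

false-dec : ∀ {A : Set} (d : Dec A) → ¬ A → does d ≡ false
false-dec (no _)  _  = refl
false-dec (yes a) ¬a = ⊥-elim (¬a a)

∑-mono : ∀ {n} {f g : Fin n → ℕ} → (∀ i → f i ≤ g i) → ∑ f ≤ ∑ g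
∑-mono {zero}  _   = z≤n
∑-mono {suc n} f≤g = ℕₚ.+-mono-≤ (f≤g zero) (∑-mono (f≤g ∘ suc))

∑-zero : ∀ n → ∑ {n} (λ _ → 0) ≡ 0
∑-zero zero    = refl
∑-zero (suc n) = ∑-zero n

∑-const : ∀ n c → ∑ {n} (λ _ → c) ≡ n * c
∑-const zero    c = refl
∑-const (suc n) c = cong (c +_) (∑-const n c)

∑-δ : ∀ {n} (a : Fin n) (g : Fin n → ℕ) → ∑ (λ x → when (does (x Finₚ.≟ a)) (g x)) ≡ g a
∑-δ {suc n} zero    g = trans (cong (g zero +_) (∑-zero n)) (ℕₚ.+-identityʳ _)
∑-δ {suc n} (suc a) g = trans (sum-cong-≗ step′) (∑-δ a (g ∘ suc))
  where
  step′ : ∀ x → when (does (suc x Finₚ.≟ suc a)) (g (suc x)) ≡ when (does (x Finₚ.≟ a)) (g (suc x))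
  step′ x with x Finₚ.≟ a
  ... | yes _ = refl
  ... | no _  = refl

listSum≡∑ : ∀ {n} (f : Fin n → ℕ) → ListAct.sum (map f (allFin n)) ≡ ∑ f
listSum≡∑ f = go f id
  where
  go : ∀ {m n} (f : Fin m → ℕ) (g : Fin n → Fin m) → ListAct.sum (map f (List.tabulate g)) ≡ ∑ (f ∘ g)
  go {n = zero}  f g = refl
  go {n = suc n} f g = cong (f (g zero) +_) (go f (g ∘ suc))

all-allFin⁻ : ∀ {n} (p : Fin n → Bool) → all p (allFin n) ≡ true → ∀ i → p i ≡ true
all-allFin⁻ p = go p id
  where
  go : ∀ {m n} (p : Fin m → Bool) (g : Fin n → Fin m) → all p (List.tabulate g) ≡ true → ∀ i → p (g i) ≡ true
  go p g h zero    = proj₁ (∧-≡ h)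
  go p g h (suc i) = go p (g ∘ suc) (proj₂ (∧-≡ {p (g zero)} h)) i

all-allFin⁺ : ∀ {n} (p : Fin n → Bool) → (∀ i → p i ≡ true) → all p (allFin n) ≡ true
all-allFin⁺ p = go p id
  where
  go : ∀ {m n} (p : Fin m → Bool) (g : Fin n → Fin m) → (∀ i → p (g i) ≡ true) → all p (List.tabulate g) ≡ true
  go {n = zero}  p g h = refl
  go {n = suc n} p g h rewrite h zero = go p (g ∘ suc) (h ∘ suc)

any-allFin⁻ : ∀ {n} (p : Fin n → Bool) → any p (allFin n) ≡ true → ∃[ i ] p i ≡ true
any-allFin⁻ p = go p id
  where
  go : ∀ {m n} (p : Fin m → Bool) (g : Fin n → Fin m) → any p (List.tabulate g) ≡ true → ∃[ i ] p i ≡ true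
  go {n = zero}  p g ()
  go {n = suc n} p g h with p (g zero) in eq
  ... | true  = g zero , eq
  ... | false = go p (g ∘ suc) h

any-allFin⁺ : ∀ {n} (p : Fin n → Bool) i → p i ≡ true → any p (allFin n) ≡ true
any-allFin⁺ {n} p i h with any p (allFin n) in eq
... | true  = refl
... | false = ⊥-elim (go p id eq i h)
  where
  go : ∀ {m n} (p : Fin m → Bool) (g : Fin n → Fin m) → any p (List.tabulate g) ≡ false → ∀ i → p (g i) ≡ true → ⊥
  go p g h zero    t rewrite t = case h of λ ()
  go p g h (suc i) t with p (g zero)
  ... | false = go p (g ∘ suc) h i t
  go p g () (suc i) t | true

least : {P : ℕ → Set} → (∀ k → Dec (P k)) → ∀ k → P k → ∃[ m ] (P m × (∀ j → j < m → ¬ P j))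
least P? zero    p = 0 , p , λ _ ()
least P? (suc k) p with P? 0
... | yes p₀ = 0 , p₀ , λ _ ()
... | no ¬p₀ with least (P? ∘ suc) k p
...   | m , pm , below = suc m , pm , λ { zero _ → ¬p₀ ; (suc j) (s≤s j<m) → below j j<m }

-- The `iter` of the definitions takes the graph as an argument; a version without it can be shared
-- by a graph and its subgraphs.
pow : ∀ {A : Set} → (A → A) → ℕ → A → A
pow f zero    a = a
pow f (suc k) a = f (pow f k a)

pow-+ : ∀ {A : Set} (f : A → A) j k a → pow f (j + k) a ≡ pow f j (pow f k a)
pow-+ f zero    k a = refl
pow-+ f (suc j) k a = cong f (pow-+ f j k a)

pow-suc : ∀ {A : Set} (f : A → A) k a → pow f (suc k) a ≡ pow f k (f a)
pow-suc f zero    a = refl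
pow-suc f (suc k) a = cong f (pow-suc f k a)

pow-fix : ∀ {A : Set} (f : A → A) k {a} → f a ≡ a → pow f k a ≡ a
pow-fix f zero    h = refl
pow-fix f (suc k) h = trans (cong f (pow-fix f k h)) h

iter≡pow : ∀ G {A : Set} (f : A → A) k a → iter G f k a ≡ pow f k a
iter≡pow G f zero    a = refl
iter≡pow G f (suc k) a = cong f (iter≡pow G f k a)

-- Enumerated types and sums over them

record Enum (X : Set) : Set where
  field
    size          : ℕ
    index         : X → Fin size
    element       : Fin size → X
    element-index : ∀ x → element (index x) ≡ x
    index-element : ∀ i → index (element i) ≡ i

  index-injective : ∀ {x y} → index x ≡ index y → x ≡ y
  index-injective {x} {y} h = trans (sym (element-index x)) (trans (cong element h) (element-index y))

  infix 4 _≟_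
  -- Abstract, so that a comparison of elements does not unfold to one of indices.
  abstract
    _≟_ : DecidableEquality X
    x ≟ y = map′ index-injective (cong index) (index x Finₚ.≟ index y)

  code : X → ℕ
  code x = toℕ (index x)

  code-injective : ∀ {x y} → code x ≡ code y → x ≡ y
  code-injective h = index-injective (Finₚ.toℕ-injective h)

  all? : {P : X → Set} → (∀ x → Dec (P x)) → Dec (∀ x → P x)
  all? {P} P? = map′ (λ h x → subst P (element-index x) (h (index x))) (λ h i → h (element i))
                     (Finₚ.all? (P? ∘ element))

  any? : {P : X → Set} → (∀ x → Dec (P x)) → Dec (∃ P)
  any? {P} P? = map′ (λ (i , p) → element i , p) (λ (x , p) → index x , subst P (sym (element-index x)) p)
                     (Finₚ.any? (P? ∘ element))

  Σ∙ : (X → ℕ) → ℕ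
  Σ∙ f = ∑ (f ∘ element)

  Σ-cong : ∀ {f g} → (∀ x → f x ≡ g x) → Σ∙ f ≡ Σ∙ g
  Σ-cong h = sum-cong-≗ (h ∘ element)

  Σ-mono : ∀ {f g} → (∀ x → f x ≤ g x) → Σ∙ f ≤ Σ∙ g
  Σ-mono h = ∑-mono (h ∘ element)

  Σ-+ : ∀ f g → Σ∙ (λ x → f x + g x) ≡ Σ∙ f + Σ∙ g
  Σ-+ f g = ∑-distrib-+ (f ∘ element) (g ∘ element)

  Σ-zero : Σ∙ (λ _ → 0) ≡ 0
  Σ-zero = ∑-zero size

  Σ-∑-swap : ∀ {m} (f : X → Fin m → ℕ) → Σ∙ (λ x → ∑ (f x)) ≡ ∑ (λ i → Σ∙ (λ x → f x i))
  Σ-∑-swap f = ∑-comm (f ∘ element)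

  Σ-*ˡ : ∀ c f → Σ∙ (λ x → c * f x) ≡ c * Σ∙ f
  Σ-*ˡ zero    f = Σ-zero
  Σ-*ˡ (suc c) f = trans (Σ-+ f (λ x → c * f x)) (cong (Σ∙ f +_) (Σ-*ˡ c f))

  Σ-δ : ∀ a g → Σ∙ (λ x → when (does (x ≟ a)) (g x)) ≡ g a
  Σ-δ a g = trans (sum-cong-≗ same) (trans (∑-δ (index a) (g ∘ element)) (cong g (element-index a)))
    where
    same : ∀ i → when (does (element i ≟ a)) (g (element i)) ≡ when (does (i Finₚ.≟ index a)) (g (element i))
    same i with i Finₚ.≟ index a
    ... | yes refl = cong (λ b → when b (g (element i))) (true-dec (element i ≟ a) (element-index a))
    ... | no i≢a   = cong (λ b → when b (g (element i))) (false-dec (element i ≟ a)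
                       λ e → i≢a (trans (sym (index-element i)) (cong index e)))

  -- Where `p` holds, exactly one index of the list hits the element, so each term is a sum of
  -- Kronecker deltas over the list; the two sums are then exchanged. Sums over orbits and over
  -- neighbourhoods are made explicit in this way.
  Σ-listing : ∀ {m} (e : Fin m → X) → (∀ {i j} → e i ≡ e j → i ≡ j) → (p : X → Bool) →
              (∀ i → p (e i) ≡ true) → (∀ x → p x ≡ true → ∃[ i ] e i ≡ x) →
              ∀ g → Σ∙ (λ x → when (p x) (g x)) ≡ ∑ (g ∘ e)
  Σ-listing {m} e e-inj p p-e e-p g = trans (Σ-cong split) (trans (Σ-∑-swap {m} (λ x i → when (does (x ≟ e i)) (g x))) (sum-cong-≗ λ i → Σ-δ (e i) g))
    where
    split : ∀ x → when (p x) (g x) ≡ ∑ (λ i → when (does (x ≟ e i)) (g x))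
    split x with p x in px
    ... | false = sym (trans (sum-cong-≗ (λ i → cong (λ b → when b (g x)) (false-dec (x ≟ e i) λ { refl → true-false (p-e i) px }))) (∑-zero m))
    ... | true with e-p x px
    ...   | i , refl = sym (trans (sum-cong-≗ same) (∑-δ i (λ _ → g (e i))))
      where
      same : ∀ j → when (does (e i ≟ e j)) (g (e i)) ≡ when (does (j Finₚ.≟ i)) (g (e i))
      same j with j Finₚ.≟ i
      ... | yes refl = cong (λ b → when b (g (e i))) (true-dec (e i ≟ e i) refl)
      ... | no j≢i   = cong (λ b → when b (g (e i))) (false-dec (e i ≟ e j) (j≢i ∘ sym ∘ e-inj))

Σ-swap : ∀ {X Y} (E : Enum X) (F : Enum Y) (f : X → Y → ℕ) →
         Enum.Σ∙ E (λ x → Enum.Σ∙ F (f x)) ≡ Enum.Σ∙ F (λ y → Enum.Σ∙ E (λ x → f x y))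
Σ-swap E F f = Enum.Σ-∑-swap E (λ x i → f x (Enum.element F i))

finEnum : ∀ n → Enum (Fin n)
finEnum n = record { size = n ; index = id ; element = id ; element-index = λ _ → refl ; index-element = λ _ → refl }

pairEnum : ∀ n → Enum (Fin n × Fin n)
pairEnum n = record
  { size = n * n
  ; index = λ (u , v) → combine u v
  ; element = remQuot n
  ; element-index = λ (u , v) → Finₚ.remQuot-combine u v
  ; index-element = Finₚ.combine-remQuot {n} n
  }

module _ {X : Set} (E : Enum X) where
  open Enum E

  tally : (X → Bool) → ℕ
  tally p = Σ∙ (λ x → when (p x) 1)

  tally-mono : ∀ {p q} → (∀ x → p x ≡ true → q x ≡ true) → tally p ≤ tally q
  tally-mono p⇒q = Σ-mono λ x → when-mono (p⇒q x) ℕₚ.≤-refl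

  private
    tally-suc : ∀ p m → Σ∙ (λ x → when (does (x ≟ m)) 1 + when (p x) 1) ≡ suc (tally p)
    tally-suc p m = trans (Σ-+ (λ x → when (does (x ≟ m)) 1) (λ x → when (p x) 1)) (cong (_+ tally p) (Σ-δ m (λ _ → 1)))

  tally-strict : ∀ {p q} → (∀ x → p x ≡ true → q x ≡ true) → ∀ m → p m ≡ false → q m ≡ true → suc (tally p) ≤ tally q
  tally-strict {p} {q} p⇒q m ¬pm qm = ℕₚ.≤-trans (ℕₚ.≤-reflexive (sym (tally-suc p m))) (Σ-mono bound)
    where
    bound : ∀ x → when (does (x ≟ m)) 1 + when (p x) 1 ≤ when (q x) 1
    bound x with x ≟ m
    ... | yes refl rewrite ¬pm | qm = ℕₚ.≤-refl
    ... | no _ = when-mono (p⇒q x) ℕₚ.≤-refl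

  tally-extra : ∀ {p q} m → (∀ x → p x ≡ true → q x ≡ true ⊎ x ≡ m) → tally p ≤ suc (tally q)
  tally-extra {p} {q} m p⇒q = ℕₚ.≤-trans (Σ-mono bound) (ℕₚ.≤-reflexive (tally-suc q m))
    where
    bound : ∀ x → when (p x) 1 ≤ when (does (x ≟ m)) 1 + when (q x) 1
    bound x with p x in px
    ... | false = z≤n
    ... | true with p⇒q x px
    ...   | inj₁ qx rewrite qx = ℕₚ.m≤n+m 1 _
    ...   | inj₂ x≡m rewrite true-dec (x ≟ m) x≡m = s≤s z≤n

-- Counting the classes of an equivalence relation

record DecEquiv (X : Set) : Set₁ where
  infix 4 _~_
  field
    _~_     : X → X → Set
    _~?_    : ∀ x y → Dec (x ~ y)
    ~-refl  : ∀ {x} → x ~ x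
    ~-sym   : ∀ {x y} → x ~ y → y ~ x
    ~-trans : ∀ {x y z} → x ~ y → y ~ z → x ~ z

module Classes {X : Set} (E : Enum X) (Q : DecEquiv X) where
  open Enum E
  open DecEquiv Q

  -- A class is counted through its element of least code, which is also how `faces` and
  -- `components` count.
  IsMin : X → Set
  IsMin x = ∀ y → x ~ y → code x ≤ code y

  abstract
    isMin? : ∀ x → Dec (IsMin x)
    isMin? x = all? λ y → (x ~? y) →-dec (code x ≤? code y)

  classes : ℕ
  classes = tally E (λ x → does (isMin? x))

  representative : ∀ a → ∃[ r ] (r ~ a × IsMin r)
  representative a
    with least (λ k → any? λ x → (code x ℕₚ.≟ k) ×-dec (x ~? a)) (code a) (a , refl , ~-refl)
  ... | _ , (r , refl , r~a) , below =
    r , r~a , λ y r~y → ℕₚ.≮⇒≥ λ y<r → below (code y) y<r (y , refl , ~-trans (~-sym r~y) r~a)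

  min-unique : ∀ {r s} → IsMin r → IsMin s → r ~ s → r ≡ s
  min-unique rm sm r~s = code-injective (ℕₚ.≤-antisym (rm _ r~s) (sm _ (~-sym r~s)))

module _ {X : Set} (E : Enum X) (Q₁ Q₂ : DecEquiv X) where
  open Enum E
  private
    open module Q₁ = DecEquiv Q₁ using () renaming (_~_ to _~₁_)
    open module Q₂ = DecEquiv Q₂ using () renaming (_~_ to _~₂_)
    module C₁ = Classes E Q₁
    module C₂ = Classes E Q₂

  -- A minimum for the coarser relation is a minimum for the finer one.
  classes-antitone : (∀ {x y} → x ~₁ y → x ~₂ y) → C₂.classes ≤ C₁.classes
  classes-antitone 1⊆2 = tally-mono E λ x m →
    true-dec (C₁.isMin? x) λ y x~y → dec-true (C₂.isMin? x) m y (1⊆2 x~y)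

  -- The coarser relation joins the classes of `a` and `b`, and the larger of their two minima stops
  -- being minimal.
  classes-split : ∀ {a b} → (∀ {x y} → x ~₁ y → x ~₂ y) → a ~₂ b → ¬ a ~₁ b → suc C₂.classes ≤ C₁.classes
  classes-split {a} {b} 1⊆2 a~b a≁b = let m₀ , m₁ , ¬m₂ = larger in
    tally-strict E (λ x m → true-dec (C₁.isMin? x) λ y x~y → dec-true (C₂.isMin? x) m y (1⊆2 x~y)) m₀
      (false-dec (C₂.isMin? m₀) ¬m₂) (true-dec (C₁.isMin? m₀) m₁)
    where
    ra = C₁.representative a
    rb = C₁.representative b
    r~ : proj₁ ra ~₂ proj₁ rb
    r~ = Q₂.~-trans (1⊆2 (proj₁ (proj₂ ra))) (Q₂.~-trans a~b (Q₂.~-sym (1⊆2 (proj₁ (proj₂ rb)))))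
    r≢ : proj₁ ra ≢ proj₁ rb
    r≢ eq = a≁b (Q₁.~-trans (Q₁.~-sym (proj₁ (proj₂ ra))) (subst (_~₁ b) (sym eq) (proj₁ (proj₂ rb))))
    larger : ∃[ m ] (C₁.IsMin m × ¬ C₂.IsMin m)
    larger with ℕₚ.<-cmp (code (proj₁ ra)) (code (proj₁ rb))
    ... | tri< lt _ _ = proj₁ rb , proj₂ (proj₂ rb) , λ m → ℕₚ.<⇒≱ lt (m _ (Q₂.~-sym r~))
    ... | tri≈ _ eq _ = ⊥-elim (r≢ (code-injective eq))
    ... | tri> _ _ gt = proj₁ ra , proj₂ (proj₂ ra) , λ m → ℕₚ.<⇒≱ gt (m _ r~)
  -- The second relation merges at most the classes of `a` and `b`; only the larger of their minima,
  -- `m₀`, can stop being minimal.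
  classes-join : ∀ {a b} → (∀ {x y} → x ~₂ y → x ~₁ y ⊎ (x ~₁ a × y ~₁ b) ⊎ (x ~₁ b × y ~₁ a)) →
                 C₁.classes ≤ suc C₂.classes
  classes-join {a} {b} 2⊆1 = tally-extra E m₀ λ x m₁ → case C₂.isMin? x of λ
    { (yes m) → inj₁ (true-dec (C₂.isMin? x) m) ; (no ¬m) → inj₂ (min₁⇒ x (dec-true (C₁.isMin? x) m₁) ¬m) }
    where
    ra = C₁.representative a
    rb = C₁.representative b
    m₀ : X
    m₀ with code (proj₁ ra) ≤? code (proj₁ rb)
    ... | yes _ = proj₁ rb
    ... | no _  = proj₁ ra
    m₀-spec : ∀ {x y c d} → (rc : ∃[ r ] (r ~₁ c × C₁.IsMin r)) → (rd : ∃[ r ] (r ~₁ d × C₁.IsMin r)) →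
              C₁.IsMin x → x ~₁ c → y ~₁ d → code y < code x → x ≡ proj₁ rc × code (proj₁ rd) < code (proj₁ rc)
    m₀-spec (r , r~c , rm) (s , s~d , sm) xm x~c y~d y<x
      with C₁.min-unique xm rm (Q₁.~-trans x~c (Q₁.~-sym r~c))
    ... | refl = refl , ℕₚ.≤-<-trans (sm _ (Q₁.~-trans s~d (Q₁.~-sym y~d))) y<x
    min₁⇒ : ∀ x → C₁.IsMin x → ¬ C₂.IsMin x → x ≡ m₀
    min₁⇒ x xm ¬xm with any? (λ y → (x Q₂.~? y) ×-dec (code y <? code x))
    ... | no none = ⊥-elim (¬xm λ y x~y → ℕₚ.≮⇒≥ λ lt → none (y , x~y , lt))
    ... | yes (y , x~y , y<x) with 2⊆1 x~y
    ...   | inj₁ x~₁y = ⊥-elim (ℕₚ.<⇒≱ y<x (xm y x~₁y))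
    ...   | inj₂ (inj₁ (x~a , y~b)) with m₀-spec ra rb xm x~a y~b y<x
    ...     | x≡ , lt with code (proj₁ ra) ≤? code (proj₁ rb)
    ...       | yes le = ⊥-elim (ℕₚ.<⇒≱ lt le)
    ...       | no _ = x≡
    min₁⇒ x xm ¬xm | yes (y , x~y , y<x) | inj₂ (inj₂ (x~b , y~a)) with m₀-spec rb ra xm x~b y~a y<x
    ...     | x≡ , lt with code (proj₁ ra) ≤? code (proj₁ rb)
    ...       | yes _ = x≡
    ...       | no ≰ = ⊥-elim (≰ (ℕₚ.<⇒≤ lt))

-- Orbits of a permutation and of its product with a transposition

transpose : ∀ {X : Set} → DecidableEquality X → X → X → X → X
transpose _≟_ a b x = if does (x ≟ a) then b else if does (x ≟ b) then a else x

module Permutation {X : Set} (E : Enum X) (σ : X → X) (σ-inj : ∀ {x y} → σ x ≡ σ y → x ≡ y) where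
  open Enum E

  pow-injective : ∀ k {x y} → pow σ k x ≡ pow σ k y → x ≡ y
  pow-injective zero    h = h
  pow-injective (suc k) h = pow-injective k (σ-inj h)

  abstract
    -- Pigeonhole on the first `size + 1` iterates; injectivity cancels the common initial part. The
    -- bound by `size` later matches the bounded test in `isRep`.
    someReturn : ∀ x → ∃[ k ] (0 < k × pow σ k x ≡ x × k ≤ size)
    someReturn x with Finₚ.pigeonhole (ℕₚ.n<1+n size) (λ i → index (pow σ (toℕ i) x))
    ... | i , j , i<j , eq = toℕ j ∸ toℕ i , ℕₚ.m<n⇒0<n∸m i<j
      , sym (pow-injective (toℕ i) (trans (index-injective eq)
          (trans (cong (λ k → pow σ k x) (sym (ℕₚ.m+[n∸m]≡n (ℕₚ.<⇒≤ i<j)))) (pow-+ σ (toℕ i) (toℕ j ∸ toℕ i) x))))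
      , ℕₚ.≤-trans (ℕₚ.m∸n≤m (toℕ j) (toℕ i)) (ℕₚ.≤-pred (Finₚ.toℕ<n j))

    leastReturn : ∀ x → ∃[ k ] ((0 < k × pow σ k x ≡ x) × (∀ j → j < k → ¬ (0 < j × pow σ j x ≡ x)))
    leastReturn x = let k , 0<k , eq , _ = someReturn x in least (λ k → (0 <? k) ×-dec (pow σ k x ≟ x)) k (0<k , eq)

  period : X → ℕ
  period x = proj₁ (leastReturn x)

  period>0 : ∀ x → 0 < period x
  period>0 x = proj₁ (proj₁ (proj₂ (leastReturn x)))

  pow-period : ∀ x → pow σ (period x) x ≡ x
  pow-period x = proj₂ (proj₁ (proj₂ (leastReturn x)))

  period-least : ∀ x {j} → 0 < j → j < period x → pow σ j x ≢ x
  period-least x 0<j j<p eq = proj₂ (proj₂ (leastReturn x)) _ j<p (0<j , eq)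

  period≤ : ∀ x {j} → 0 < j → pow σ j x ≡ x → period x ≤ j
  period≤ x 0<j eq = ℕₚ.≮⇒≥ λ lt → period-least x 0<j lt eq

  period≤size : ∀ x → period x ≤ size
  period≤size x = let k , 0<k , eq , k≤size = someReturn x in ℕₚ.≤-trans (period≤ x 0<k eq) k≤size

  pow-distinct : ∀ x {i j} → i < j → j < period x → pow σ i x ≢ pow σ j x
  pow-distinct x {i} {j} i<j j<p eq = period-least x (ℕₚ.m<n⇒0<n∸m i<j) (ℕₚ.≤-<-trans (ℕₚ.m∸n≤m j i) j<p)
    (sym (pow-injective i (trans eq (trans (cong (λ k → pow σ k x) (sym (ℕₚ.m+[n∸m]≡n (ℕₚ.<⇒≤ i<j)))) (pow-+ σ i (j ∸ i) x)))))

  reduce : ∀ x k → ∃[ j ] (j < period x × pow σ k x ≡ pow σ j x)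
  reduce x zero = 0 , period>0 x , refl
  reduce x (suc k) with reduce x k
  ... | j , j<p , eq with ℕₚ.m≤n⇒m<n∨m≡n j<p
  ...   | inj₁ sj<p = suc j , sj<p , cong σ eq
  ...   | inj₂ sj≡p = 0 , period>0 x , trans (cong σ eq) (trans (cong (λ k → pow σ k x) sj≡p) (pow-period x))

  SameOrbit : X → X → Set
  SameOrbit x y = ∃[ k ] pow σ k x ≡ y

  orbit-sym : ∀ {x y} → SameOrbit x y → SameOrbit y x
  orbit-sym {x} (k , refl) with reduce x k
  ... | j , j<p , eq = period x ∸ j , trans (cong (pow σ (period x ∸ j)) eq)
    (trans (sym (pow-+ σ (period x ∸ j) j x)) (trans (cong (λ k → pow σ k x) (ℕₚ.m∸n+n≡m (ℕₚ.<⇒≤ j<p))) (pow-period x)))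

  orbit-trans : ∀ {x y z} → SameOrbit x y → SameOrbit y z → SameOrbit x z
  orbit-trans {x} (j , refl) (k , refl) = k + j , pow-+ σ k j x

  orbits : DecEquiv X
  orbits = record
    { _~_ = SameOrbit
    ; _~?_ = λ x y → map′ (λ (i , h) → toℕ i , h)
        (λ { (k , refl) → let j , j<p , eq = reduce x k in
                          fromℕ< j<p , trans (cong (λ m → pow σ m x) (Finₚ.toℕ-fromℕ< j<p)) (sym eq) })
        (Finₚ.any? {n = period x} (λ i → pow σ (toℕ i) x ≟ y))
    ; ~-refl = 0 , refl
    ; ~-sym = orbit-sym
    ; ~-trans = orbit-trans
    }

  open Classes E orbits public

  orbitList : ∀ x → Fin (period x) → X
  orbitList x i = pow σ (toℕ i) x

  orbitList-injective : ∀ x {i j} → orbitList x i ≡ orbitList x j → i ≡ j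
  orbitList-injective x {i} {j} eq with ℕₚ.<-cmp (toℕ i) (toℕ j)
  ... | tri< lt _ _ = ⊥-elim (pow-distinct x lt (Finₚ.toℕ<n j) eq)
  ... | tri≈ _ e _  = Finₚ.toℕ-injective e
  ... | tri> _ _ gt = ⊥-elim (pow-distinct x gt (Finₚ.toℕ<n i) (sym eq))

  orbitList-surjective : ∀ x {y} → SameOrbit x y → ∃[ i ] orbitList x i ≡ y
  orbitList-surjective x (k , refl) with reduce x k
  ... | j , j<p , eq = fromℕ< j<p , trans (cong (λ m → pow σ m x) (Finₚ.toℕ-fromℕ< j<p)) (sym eq)

  orbitSum : (X → ℕ) → X → ℕ
  orbitSum w x = ∑ (w ∘ orbitList x)

  -- Every element lies in the orbit of exactly one minimum; the double sum over elements and minima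
  -- is taken in the other order. For darts this is a sum taken face by face.
  Σ-by-orbits : ∀ w → Σ∙ w ≡ Σ∙ (λ r → when (does (isMin? r)) (orbitSum w r))
  Σ-by-orbits w = begin
    Σ∙ w                                                                    ≡⟨ Σ-cong (λ d → sym (oneRep d)) ⟩
    Σ∙ (λ d → Σ∙ (λ r → when (repOf r d) (w d)))                            ≡⟨ Σ-swap E E (λ d r → when (repOf r d) (w d)) ⟩
    Σ∙ (λ r → Σ∙ (λ d → when (repOf r d) (w d)))                            ≡⟨ Σ-cong inner ⟩
    Σ∙ (λ r → when (does (isMin? r)) (orbitSum w r))                        ∎
    where
    open ≡-Reasoning
    open DecEquiv orbits using (_~?_)
    repOf : X → X → Bool
    repOf r d = does (isMin? r) ∧ does (r ~? d)
    oneRep : ∀ d → Σ∙ (λ r → when (repOf r d) (w d)) ≡ w d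
    oneRep d with representative d
    ... | r , r~d , rm = trans (Σ-listing {1} (λ _ → r) (λ { {zero} {zero} _ → refl }) (λ r → repOf r d)
          (λ _ → cong₂ _∧_ (true-dec (isMin? r) rm) (true-dec (r ~? d) r~d))
          (λ s h → zero , let sm , s~d = ∧-≡ h in min-unique rm (dec-true (isMin? s) sm)
                             (orbit-trans r~d (orbit-sym (dec-true (s ~? d) s~d))))
          (λ _ → w d))
          (ℕₚ.+-identityʳ (w d))
    inner : ∀ r → Σ∙ (λ d → when (repOf r d) (w d)) ≡ when (does (isMin? r)) (orbitSum w r)
    inner r with does (isMin? r)
    ... | false = Σ-zero
    ... | true  = Σ-listing (orbitList r) (orbitList-injective r) (λ d → does (r ~? d))
          (λ i → true-dec (r ~? _) (toℕ i , refl)) (λ d h → orbitList-surjective r (dec-true (r ~? d) h)) w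

module Transposed {X : Set} (E : Enum X) (σ : X → X) (σ-inj : ∀ {x y} → σ x ≡ σ y → x ≡ y) (a b : X) where
  open Enum E

  tr : X → X
  tr = transpose _≟_ a b

  τ : X → X
  τ x = σ (tr x)

  tr-cases : ∀ x → (x ≡ a × tr x ≡ b) ⊎ (x ≢ a × x ≡ b × tr x ≡ a) ⊎ (x ≢ a × x ≢ b × tr x ≡ x)
  tr-cases x with x ≟ a
  ... | yes x≡a = inj₁ (x≡a , refl)
  ... | no x≢a with x ≟ b
  ...   | yes x≡b = inj₂ (inj₁ (x≢a , x≡b , refl))
  ...   | no x≢b = inj₂ (inj₂ (x≢a , x≢b , refl))

  tr-involutive : ∀ x → tr (tr x) ≡ x
  tr-involutive x with tr-cases x
  ... | inj₁ (refl , eq) rewrite eq with tr-cases b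
  ...   | inj₁ (b≡a , eq′) = trans eq′ b≡a
  ...   | inj₂ (inj₁ (_ , _ , eq′)) = eq′
  ...   | inj₂ (inj₂ (_ , b≢b , _)) = ⊥-elim (b≢b refl)
  tr-involutive x | inj₂ (inj₁ (_ , refl , eq)) rewrite eq with tr-cases a
  ...   | inj₁ (_ , eq′) = eq′
  ...   | inj₂ (inj₁ (a≢a , _)) = ⊥-elim (a≢a refl)
  ...   | inj₂ (inj₂ (a≢a , _)) = ⊥-elim (a≢a refl)
  tr-involutive x | inj₂ (inj₂ (_ , _ , eq)) rewrite eq = eq

  τ-inj : ∀ {x y} → τ x ≡ τ y → x ≡ y
  τ-inj {x} {y} h = trans (sym (tr-involutive x)) (trans (cong tr (σ-inj h)) (tr-involutive y))

  module Pσ = Permutation E σ σ-inj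
  module Pτ = Permutation E τ τ-inj

  private
    σ~ : ∀ {x y} → Pσ.SameOrbit x y → Pσ.SameOrbit (σ x) y
    σ~ s = Pσ.orbit-trans (Pσ.orbit-sym (1 , refl)) s

    ~σ : ∀ {x y} → Pσ.SameOrbit x y → Pσ.SameOrbit x (σ y)
    ~σ (k , h) = suc k , cong σ h

  -- A step of `τ` stays in an orbit of `σ`, except that it may change from the orbit of `a` to that
  -- of `b` or back.
  classes≤ : Pσ.classes ≤ suc Pτ.classes
  classes≤ = classes-join E Pσ.orbits Pτ.orbits {a} {b} (λ (k , h) → joined k h)
    where
    _~_ = Pσ.SameOrbit
    joined : ∀ {x y} k → pow τ k x ≡ y → x ~ y ⊎ (x ~ a × y ~ b) ⊎ (x ~ b × y ~ a)
    joined zero refl = inj₁ (0 , refl)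
    joined {x} (suc k) refl with joined {x} k refl | tr-cases (pow τ k x)
    ... | inj₁ s                | inj₁ (y≡a , eq) rewrite eq = inj₂ (inj₁ (subst (x ~_) y≡a s , σ~ (0 , refl)))
    ... | inj₁ s                | inj₂ (inj₁ (_ , y≡b , eq)) rewrite eq = inj₂ (inj₂ (subst (x ~_) y≡b s , σ~ (0 , refl)))
    ... | inj₁ s                | inj₂ (inj₂ (_ , _ , eq)) rewrite eq = inj₁ (~σ s)
    ... | inj₂ (inj₁ (xa , _))  | inj₁ (_ , eq) rewrite eq = inj₂ (inj₁ (xa , σ~ (0 , refl)))
    ... | inj₂ (inj₁ (xa , _))  | inj₂ (inj₁ (_ , _ , eq)) rewrite eq = inj₁ (~σ xa)
    ... | inj₂ (inj₁ (xa , yb)) | inj₂ (inj₂ (_ , _ , eq)) rewrite eq = inj₂ (inj₁ (xa , σ~ yb))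
    ... | inj₂ (inj₂ (xb , _))  | inj₁ (_ , eq) rewrite eq = inj₁ (~σ xb)
    ... | inj₂ (inj₂ (xb , _))  | inj₂ (inj₁ (_ , _ , eq)) rewrite eq = inj₂ (inj₂ (xb , σ~ (0 , refl)))
    ... | inj₂ (inj₂ (xb , ya)) | inj₂ (inj₂ (_ , _ , eq)) rewrite eq = inj₂ (inj₂ (xb , σ~ ya))

  -- If j is least with σʲ a = b, the set {σ a , … , σʲ a} is closed under τ and avoids a.
  suc-classes≤ : a ≢ b → Pσ.SameOrbit a b → suc Pσ.classes ≤ Pτ.classes
  suc-classes≤ a≢b (k , h) with least (λ k → pow σ k a ≟ b) k h
  ... | zero , a≡b , _ = ⊥-elim (a≢b a≡b)
  ... | suc j , σʲa≡b , below =
    classes-split E Pτ.orbits Pσ.orbits {a} {b} (λ (k , h) → coarser k h) (k , h) λ a~b →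
      let m , e = Pτ.orbit-sym a~b ; i , i≤j , eq = stays m in a∉K i i≤j (trans eq e)
    where
    a∉K : ∀ i → i ≤ j → pow σ (suc i) a ≢ a
    a∉K i i≤j eq = below (j ∸ i) (s≤s (ℕₚ.m∸n≤m j i))
      (trans (cong (pow σ (j ∸ i)) (sym eq)) (trans (sym (pow-+ σ (j ∸ i) (suc i) a))
        (trans (cong (λ m → pow σ m a) (trans (ℕₚ.+-suc (j ∸ i) i) (cong suc (ℕₚ.m∸n+n≡m i≤j)))) σʲa≡b)))
    stays : ∀ m → ∃[ i ] (i ≤ j × pow σ (suc i) a ≡ pow τ m b)
    stays zero = j , ℕₚ.≤-refl , σʲa≡b
    stays (suc m) with stays m
    ... | i , i≤j , eq with tr-cases (pow τ m b)
    ...   | inj₁ (y≡a , _) = ⊥-elim (a∉K i i≤j (trans eq y≡a))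
    ...   | inj₂ (inj₁ (_ , _ , tr≡)) = 0 , z≤n , cong σ (sym tr≡)
    ...   | inj₂ (inj₂ (_ , y≢b , tr≡)) with ℕₚ.m≤n⇒m<n∨m≡n i≤j
    ...     | inj₁ i<j = suc i , i<j , cong σ (trans eq (sym tr≡))
    ...     | inj₂ refl = ⊥-elim (y≢b (trans (sym eq) σʲa≡b))
    tr~ : ∀ y → Pσ.SameOrbit y (tr y)
    tr~ y with tr-cases y
    ... | inj₁ (refl , eq) rewrite eq = k , h
    ... | inj₂ (inj₁ (_ , refl , eq)) rewrite eq = Pσ.orbit-sym (k , h)
    ... | inj₂ (inj₂ (_ , _ , eq)) = 0 , sym eq
    coarser : ∀ {x y} m → pow τ m x ≡ y → Pσ.SameOrbit x y
    coarser zero refl = 0 , refl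
    coarser {x} (suc m) refl = ~σ (Pσ.orbit-trans (coarser {x} m refl) (tr~ _))

-- Embeddings and Euler's formula

∑-split : ∀ m {k} (f : Fin (m + k) → ℕ) → ∑ f ≡ ∑ (λ i → f (i Data.Fin.↑ˡ k)) + ∑ (λ j → f (m Data.Fin.↑ʳ j))
∑-split zero    f = refl
∑-split (suc m) f = trans (cong (f zero +_) (∑-split m (f ∘ suc))) (sym (ℕₚ.+-assoc (f zero) _ _))

∑-pairs : ∀ m {n} (f : Fin m × Fin n → ℕ) → ∑ (λ i → f (remQuot {m} n i)) ≡ ∑ (λ u → ∑ (λ v → f (u , v)))
∑-pairs zero f = refl
∑-pairs (suc m) {n} f = trans (∑-split n (λ i → f (remQuot {suc m} n i))) (cong₂ _+_
  (sum-cong-≗ {n} λ v → cong f (Finₚ.remQuot-combine {suc m} {n} zero v))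
  (trans (sum-cong-≗ {m * n} (λ i → cong f (remQuot-suc i))) (∑-pairs m (λ (u , v) → f (suc u , v)))))
  where
  remQuot-suc : ∀ i → remQuot {suc m} n (n Data.Fin.↑ʳ i) ≡ (suc (proj₁ (remQuot {m} n i)) , proj₂ (remQuot {m} n i))
  remQuot-suc i = trans (cong (λ j → remQuot {suc m} n (n Data.Fin.↑ʳ j)) (sym (Finₚ.combine-remQuot {m} n i)))
                        (Finₚ.remQuot-combine {suc m} (suc (proj₁ (remQuot {m} n i))) (proj₂ (remQuot {m} n i)))

Σ-pairs : ∀ {n} (f : Fin n × Fin n → ℕ) → Enum.Σ∙ (pairEnum n) f ≡ ∑ (λ u → ∑ (λ v → f (u , v)))
Σ-pairs {n} = ∑-pairs n

listSum²≡tally : ∀ {n} (p : Fin n → Fin n → Bool) →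
  ListAct.sum (map (λ u → ListAct.sum (map (λ v → when (p u v) 1) (allFin n))) (allFin n)) ≡ tally (pairEnum n) (uncurry p)
listSum²≡tally {n} p = begin
  ListAct.sum (map (λ u → ListAct.sum (map (λ v → when (p u v) 1) (allFin n))) (allFin n))
    ≡⟨ listSum≡∑ (λ u → ListAct.sum (map (λ v → when (p u v) 1) (allFin n))) ⟩
  ∑ {n} (λ u → ListAct.sum (map (λ v → when (p u v) 1) (allFin n)))
    ≡⟨ sum-cong-≗ {n} (λ u → listSum≡∑ (λ v → when (p u v) 1)) ⟩
  ∑ {n} (λ u → ∑ {n} (λ v → when (p u v) 1))
    ≡⟨ Σ-pairs (λ (u , v) → when (p u v) 1) ⟨
  tally (pairEnum n) (uncurry p) ∎
  where open ≡-Reasoning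

-- Reachability and components

module Connectivity (G : Graph) where
  open Graph G hiding (sym)
  private E = finEnum n

  Linked : Fin n → Fin n → Set
  Linked = Star (Adj G)

  adj-sym : ∀ {u v} → Adj G u v → Adj G v u
  adj-sym {u} {v} = subst T (Graph.sym G u v)

  adj≢ : ∀ {u v} → Adj G u v → u ≢ v
  adj≢ {u} uv refl = subst T (irrefl u) uv

  reach-refl : ∀ k u → reach G k u u ≡ true
  reach-refl zero    u = T⇒≡ (fromWitness {a? = u Finₚ.≟ u} refl)
  reach-refl (suc k) u rewrite reach-refl k u = refl

  reach-mono : ∀ k {u v} → reach G k u v ≡ true → reach G (suc k) u v ≡ true
  reach-mono k h rewrite h = refl

  reach-mono≤ : ∀ {j k u v} → j ≤ k → reach G j u v ≡ true → reach G k u v ≡ true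
  reach-mono≤ {j} {k} {u} {v} j≤k h = subst (λ m → reach G m u v ≡ true) (ℕₚ.m∸n+n≡m j≤k) (go (k ∸ j))
    where
    go : ∀ i → reach G (i + j) u v ≡ true
    go zero    = h
    go (suc i) = reach-mono (i + j) (go i)

  reach-step : ∀ k {u w v} → reach G k u w ≡ true → Adj G w v → reach G (suc k) u v ≡ true
  reach-step k {u} {w} {v} r wv with reach G k u v
  ... | true  = refl
  ... | false = any-allFin⁺ (λ w → reach G k u w ∧ adj w v) w (cong₂ _∧_ r (T⇒≡ wv))

  reach-sound : ∀ k {u v} → reach G k u v ≡ true → Linked u v
  reach-sound zero {u} {v} h with toWitness {a? = u Finₚ.≟ v} (≡⇒T h)
  ... | refl = ε
  reach-sound (suc k) {u} {v} h with reach G k u v in eq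
  ... | true = reach-sound k eq
  ... | false = let w , h′ = any-allFin⁻ (λ w → reach G k u w ∧ adj w v) h
                    r , wv = ∧-≡ h′
                in reach-sound k r ◅◅ (≡⇒T wv ◅ ε)

  module _ (u : Fin n) where
    private
      ClosedAt : ℕ → Set
      ClosedAt k = ∀ v → reach G (suc k) u v ≡ true → reach G k u v ≡ true

      -- The sets reached within `k` steps grow strictly until one of them is closed; having at most
      -- `n` elements, one is closed for some `j ≤ n`.
      closedOrLarge : ∀ k → (∃[ j ] (j ≤ k × ClosedAt j)) ⊎ suc k ≤ tally E (reach G k u)
      closedOrLarge zero = inj₂ (subst (λ s → suc s ≤ tally E (reach G 0 u)) (Enum.Σ-zero E)
        (tally-strict E {p = λ _ → false} (λ _ ()) u refl (reach-refl 0 u)))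
      closedOrLarge (suc k) with closedOrLarge k
      ... | inj₁ (j , j≤k , c) = inj₁ (j , ℕₚ.m≤n⇒m≤1+n j≤k , c)
      ... | inj₂ large with Finₚ.all? (λ v → (reach G (suc k) u v Boolₚ.≟ true) →-dec (reach G k u v Boolₚ.≟ true))
      ...   | yes c = inj₁ (k , ℕₚ.n≤1+n k , c)
      ...   | no ¬c = inj₂ (ℕₚ.≤-trans (s≤s large)
              (let v , ¬h = Finₚ.¬∀⟶∃¬ n _ (λ v → (reach G (suc k) u v Boolₚ.≟ true) →-dec (reach G k u v Boolₚ.≟ true)) ¬c
               in tally-strict E (λ v → reach-mono k {u} {v}) v
                    (Boolₚ.¬-not (λ r → ¬h λ _ → r))
                    (Boolₚ.¬-not {y = false} (λ r → ¬h λ r′ → true-false r′ r))))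

      tally≤n : ∀ p → tally E p ≤ n
      tally≤n p = ℕₚ.≤-trans (Enum.Σ-mono E {g = λ _ → 1} (λ x → when1≤1 (p x))) (ℕₚ.≤-reflexive (trans (∑-const n 1) (ℕₚ.*-identityʳ n)))
        where
        when1≤1 : ∀ b → when b 1 ≤ 1
        when1≤1 true  = ℕₚ.≤-refl
        when1≤1 false = z≤n

    reach-complete : ∀ {v} → Linked u v → reach G n u v ≡ true
    reach-complete l with closedOrLarge n
    ... | inj₂ large = ⊥-elim (ℕₚ.<⇒≱ large (tally≤n (reach G n u)))
    ... | inj₁ (j , j≤n , c) = reach-mono≤ j≤n (go l (reach-refl j u))
      where
      go : ∀ {w v} → Linked w v → reach G j u w ≡ true → reach G j u v ≡ true
      go ε        r = r
      go (a ◅ l) r = go l (c _ (reach-step j r a))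

  linked : DecEquiv (Fin n)
  linked = record
    { _~_ = Linked
    ; _~?_ = λ u v → map′ (reach-sound n) (reach-complete u) (reach G n u v Boolₚ.≟ true)
    ; ~-refl = ε
    ; ~-sym = reverse adj-sym
    ; ~-trans = _◅◅_
    }

  open Classes E linked

  isolated? : Fin n → Bool
  isolated? u = all (λ v → not (adj u v)) (allFin n)

  isolated?⁻ : ∀ {u} → isolated? u ≡ true → ∀ v → ¬ Adj G u v
  isolated?⁻ {u} h v uv with all-allFin⁻ (λ v → not (adj u v)) h v
  ... | h′ rewrite T⇒≡ uv = case h′ of λ ()

  isolated?⁺ : ∀ {u} → (∀ v → ¬ Adj G u v) → isolated? u ≡ true
  isolated?⁺ {u} h = all-allFin⁺ _ λ v → cong not (¬T⇒≡false (h v))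

  isolated≡ : isolated G ≡ tally E isolated?
  isolated≡ = listSum≡∑ (λ u → when (isolated? u) 1)

  components≡ : components G ≡ classes
  components≡ = trans (listSum≡∑ (λ u → when (leads u) 1)) (sum-cong-≗ λ u → cong (λ b → when b 1) (agree u))
    where
    leads : Fin n → Bool
    leads u = all (λ w → not (reach G n w u) ∨ not (toℕ w <ᵇ toℕ u)) (allFin n)
    leads⁻ : ∀ u → leads u ≡ true → IsMin u
    leads⁻ u h v l with all-allFin⁻ (λ w → not (reach G n w u) ∨ not (toℕ w <ᵇ toℕ u)) h v
    ... | h′ rewrite reach-complete v (reverse adj-sym l) =
      ℕₚ.≮⇒≥ λ lt → case subst (λ b → not b ≡ true) (T⇒≡ (ℕₚ.<⇒<ᵇ lt)) h′ of λ ()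
    leads⁺ : ∀ u → IsMin u → leads u ≡ true
    leads⁺ u m = all-allFin⁺ _ check
      where
      check : ∀ w → not (reach G n w u) ∨ not (toℕ w <ᵇ toℕ u) ≡ true
      check w with reach G n w u in eq
      ... | false = refl
      ... | true = cong not (¬T⇒≡false λ t →
              ℕₚ.<⇒≱ (ℕₚ.<ᵇ⇒< _ _ t) (m w (reverse adj-sym (reach-sound n eq))))
    agree : ∀ u → leads u ≡ does (isMin? u)
    agree u with isMin? u
    ... | yes m = leads⁺ u m
    ... | no ¬m = ¬T⇒≡false λ t → ¬m (leads⁻ u (T⇒≡ t))

  -- Each isolated vertex is the minimum of its own component, while the component of the edge `ab`
  -- has a minimum that is not isolated. This strict inequality is what Euler's inequality is
  -- finally played against.
  isolated<components : ∀ {a b} → Adj G a b → suc (isolated G) ≤ components G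
  isolated<components {a} {b} ab rewrite isolated≡ | components≡ with representative a
  ... | r , r~a , rm = tally-strict E (λ u h → true-dec (isMin? u) λ v → λ
        { ε → ℕₚ.≤-refl ; (uw ◅ _) → ⊥-elim (isolated?⁻ h _ uw) }) r
        (¬T⇒≡false λ t → nonisolated r~a (isolated?⁻ (T⇒≡ t))) (true-dec (isMin? r) rm)
    where
    nonisolated : ∀ {r} → Linked r a → ¬ (∀ v → ¬ Adj G r v)
    nonisolated ε         h = h b ab
    nonisolated (ru ◅ _) h = h _ ru

-- Faces as orbits of a permutation

module Embedding (G : Graph) (R : RotationSystem G) where
  open Graph G hiding (sym)
  open RotationSystem R
  open Connectivity G public
  private D = Fin n × Fin n
  E = pairEnum n
  open Enum E using (_≟_; code; size)

  rot-pow : ∀ {u v w} → Adj G u v → Adj G u w → ∃[ k ] pow (rot u) k v ≡ w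
  rot-pow {u} {v} {w} uv uw = let k , h = rot-cyc u v w uv uw in k , trans (sym (iter≡pow G (rot u) k v)) h

  isDart : D → Bool
  isDart (u , v) = adj u v

  opaque
    -- Face tracing, extended by fixed points to all ordered pairs, so that the permutations before
    -- and after a deletion act on the same set.
    φ̂ : D → D
    φ̂ (u , v) = if adj u v then (v , rot v u) else (u , v)

    φ̂-dart : ∀ {u v} → Adj G u v → φ̂ (u , v) ≡ (v , rot v u)
    φ̂-dart uv rewrite T⇒≡ uv = refl

    φ̂-nondart : ∀ {d} → ¬ T (isDart d) → φ̂ d ≡ d
    φ̂-nondart ¬d rewrite ¬T⇒≡false ¬d = refl

    φ̂-isDart : ∀ {d} → T (isDart d) → T (isDart (φ̂ d))
    φ̂-isDart {u , v} uv rewrite T⇒≡ uv = rot-adj v u (adj-sym uv)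

    φ̂-isDart⁻ : ∀ {d} → T (isDart (φ̂ d)) → T (isDart d)
    φ̂-isDart⁻ {d} t with isDart d in eq
    ... | true = tt
    ... | false = subst T eq t

  φ̂-injective : ∀ {d e} → φ̂ d ≡ φ̂ e → d ≡ e
  φ̂-injective {d@(u , v)} {e@(u′ , v′)} h with Boolₚ.T? (adj u v) | Boolₚ.T? (adj u′ v′)
  ... | yes uv | yes uv′ with trans (sym (φ̂-dart uv)) (trans h (φ̂-dart uv′))
  ...   | eq with cong proj₁ eq
  ...     | refl with rot-inj v u u′ (adj-sym uv) (adj-sym uv′) (cong proj₂ eq)
  ...       | refl = refl
  φ̂-injective {d} {e} h | yes uv | no ¬uv′ =
    ⊥-elim (¬uv′ (φ̂-isDart⁻ {e} (subst (T ∘ isDart) h (φ̂-isDart {d} uv))))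
  φ̂-injective {d} {e} h | no ¬uv | yes uv′ =
    ⊥-elim (¬uv (φ̂-isDart⁻ {d} (subst (T ∘ isDart) (sym h) (φ̂-isDart {e} uv′))))
  φ̂-injective {d} {e} h | no ¬uv | no ¬uv′ = trans (sym (φ̂-nondart {d} ¬uv)) (trans h (φ̂-nondart {e} ¬uv′))

  open Permutation E φ̂ φ̂-injective public

  pow-isDart : ∀ k {d} → T (isDart d) → T (isDart (pow φ̂ k d))
  pow-isDart zero    t = t
  pow-isDart (suc k) {d} t = φ̂-isDart {pow φ̂ k d} (pow-isDart k t)

  pow-isDart⁻ : ∀ k {d} → T (isDart (pow φ̂ k d)) → T (isDart d)
  pow-isDart⁻ zero    t = t
  pow-isDart⁻ (suc k) {d} t = pow-isDart⁻ k (φ̂-isDart⁻ {pow φ̂ k d} t)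

  φ-pow : ∀ k {d} → T (isDart d) → iter G (φ G R) k d ≡ pow φ̂ k d
  φ-pow zero    t = refl
  φ-pow (suc k) {d} t = trans (cong (φ G R) (φ-pow k t)) (sym (φ̂-dart (pow-isDart k t)))

  -- `isRep` compares with the first `n * n` iterates; no period exceeds `n * n`, so these cover the
  -- whole orbit.
  isRep⁻ : ∀ {d} → T (isDart d) → isRep G R d ≡ true → IsMin d
  isRep⁻ {d} t h _ (k , refl) with reduce d k
  ... | j , j<p , eq with all-allFin⁻ _ h (fromℕ< (ℕₚ.≤-trans j<p (period≤size d)))
  ...   | h′ rewrite Finₚ.toℕ-fromℕ< (ℕₚ.≤-trans j<p (period≤size d)) =
    subst₂ _≤_ (code≡ d) (trans (cong (key G R) (φ-pow j t)) (trans (code≡ _) (cong code (sym eq)))) (ℕₚ.≤ᵇ⇒≤ _ _ (≡⇒T h′))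
    where
    code≡ : ∀ d → key G R d ≡ code d
    code≡ (u , v) = trans (cong (_+ toℕ v) (ℕₚ.*-comm (toℕ u) n)) (sym (Finₚ.toℕ-combine u v))

  isRep⁺ : ∀ {d} → T (isDart d) → IsMin d → isRep G R d ≡ true
  isRep⁺ {d} t m = all-allFin⁺ {n * n} (λ k → key G R d ≤ᵇ key G R (iter G (φ G R) (toℕ k) d)) λ k → T⇒≡ (ℕₚ.≤⇒≤ᵇ (subst₂ _≤_ (sym (code≡ d))
      (sym (trans (cong (key G R) (φ-pow (toℕ k) t)) (code≡ _))) (m _ (toℕ k , refl))))
    where
    code≡ : ∀ d → key G R d ≡ code d
    code≡ (u , v) = trans (cong (_+ toℕ v) (ℕₚ.*-comm (toℕ u) n)) (sym (Finₚ.toℕ-combine u v))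

  isFace : D → Bool
  isFace d = isDart d ∧ does (isMin? d)

  faces≡ : faces G R ≡ tally E isFace
  faces≡ = trans (listSum²≡tally (λ u v → adj u v ∧ isRep G R (u , v)))
                 (Enum.Σ-cong E (λ (u , v) → cong (λ b → when b 1) (agree u v)))
    where
    agree : ∀ u v → adj u v ∧ isRep G R (u , v) ≡ isFace (u , v)
    agree u v with adj u v in eq
    ... | false = refl
    ... | true with isMin? (u , v)
    ...   | yes m = isRep⁺ (≡⇒T eq) m
    ...   | no ¬m = ¬T⇒≡false λ t → ¬m (isRep⁻ (≡⇒T eq) (T⇒≡ t))

  -- A pair that is not a dart is fixed by `φ̂` and forms an orbit of its own.
  classes≡ : classes ≡ faces G R + tally E (not ∘ isDart)
  classes≡ = trans (Enum.Σ-cong E split) (trans (Enum.Σ-+ E (λ d → when (isFace d) 1) (λ d → when (not (isDart d)) 1))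
                                                (cong (_+ tally E (not ∘ isDart)) (sym faces≡)))
    where
    split : ∀ d → when (does (isMin? d)) 1 ≡ when (isFace d) 1 + when (not (isDart d)) 1
    split d with isDart d in eq
    ... | true = sym (ℕₚ.+-identityʳ _)
    ... | false = cong (λ b → when b 1) (true-dec (isMin? d) λ { _ (k , refl) →
            ℕₚ.≤-reflexive (cong code (sym (pow-fix φ̂ k (φ̂-nondart {d} (≡false⇒¬T eq))))) })

edges≡ : ∀ G → edges G ≡ tally (pairEnum (Graph.n G)) (λ (u , v) → Graph.adj G u v ∧ (toℕ u <ᵇ toℕ v))
edges≡ G = listSum²≡tally (λ u v → Graph.adj G u v ∧ (toℕ u <ᵇ toℕ v))

-- Deletion of an edge

module Isolate {X : Set} (E : Enum X) (σ : X → X) (σ-inj : ∀ {x y} → σ x ≡ σ y → x ≡ y) (x : X) where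
  open Enum E
  private
    module S = Permutation E σ σ-inj

    preimage : ∃[ p ] σ p ≡ x
    preimage with S.period x | S.period>0 x | S.pow-period x
    ... | suc m | _ | eq = pow σ m x , eq

    p = proj₁ preimage
    σp≡x = proj₂ preimage
    module TP = Transposed E σ σ-inj x p

  abstract
    -- The product with the transposition of `x` and its preimage takes `x` out of its orbit: `x`
    -- becomes fixed, and its predecessor is sent to its successor.
    σ′ : X → X
    σ′ = TP.τ

    σ′-inj : ∀ {y z} → σ′ y ≡ σ′ z → y ≡ z
    σ′-inj = TP.τ-inj

    fixes : σ′ x ≡ x
    fixes with TP.tr-cases x
    ... | inj₁ (_ , eq) rewrite eq = σp≡x
    ... | inj₂ (inj₁ (x≢x , _)) = ⊥-elim (x≢x refl)
    ... | inj₂ (inj₂ (x≢x , _)) = ⊥-elim (x≢x refl)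

    bypasses : ∀ {y} → y ≢ x → σ y ≡ x → σ′ y ≡ σ x
    bypasses {y} y≢x σy≡x with TP.tr-cases y
    ... | inj₁ (y≡x , _) = ⊥-elim (y≢x y≡x)
    ... | inj₂ (inj₁ (_ , _ , eq)) rewrite eq = refl
    ... | inj₂ (inj₂ (_ , y≢p , _)) = ⊥-elim (y≢p (σ-inj (trans σy≡x (sym σp≡x))))

    keeps : ∀ {y} → y ≢ x → σ y ≢ x → σ′ y ≡ σ y
    keeps {y} y≢x σy≢x with TP.tr-cases y
    ... | inj₁ (y≡x , _) = ⊥-elim (y≢x y≡x)
    ... | inj₂ (inj₁ (_ , y≡p , _)) = ⊥-elim (σy≢x (trans (cong σ y≡p) σp≡x))
    ... | inj₂ (inj₂ (_ , _ , eq)) rewrite eq = refl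

    isolate-moved : σ x ≢ x → suc S.classes ≤ Permutation.classes E σ′ σ′-inj
    isolate-moved σx≢x = TP.suc-classes≤ (λ x≡p → σx≢x (trans (cong σ x≡p) σp≡x)) (S.orbit-sym (1 , σp≡x))

  private module S′ = Permutation E σ′ σ′-inj

  -- Taking `x` out creates the orbit of `x` alone, unless `x` was fixed already; the last summand
  -- records that case.
  isolate-classes : suc S.classes ≤ S′.classes + when (does (σ x ≟ x)) 1
  isolate-classes with σ x ≟ x
  ... | no σx≢x = ℕₚ.≤-trans (isolate-moved σx≢x) (ℕₚ.m≤m+n _ 0)
  ... | yes σx≡x = ℕₚ.≤-trans (s≤s (classes-antitone E S′.orbits S.orbits λ (k , h) → k , trans (sym (powers k)) h))
                     (ℕₚ.≤-reflexive (ℕₚ.+-comm 1 _))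
    where
    same : ∀ y → σ′ y ≡ σ y
    same y with y ≟ x
    ... | yes refl = trans fixes (sym σx≡x)
    ... | no y≢x = keeps y≢x λ σy≡x → y≢x (σ-inj (trans σy≡x (sym σx≡x)))
    powers : ∀ k {y} → pow σ′ k y ≡ pow σ k y
    powers zero = refl
    powers (suc k) {y} = trans (cong σ′ (powers k)) (same (pow σ k y))

permutation-cong : ∀ {X : Set} (E : Enum X) (σ τ : X → X)
                   (σ-inj : ∀ {x y} → σ x ≡ σ y → x ≡ y) (τ-inj : ∀ {x y} → τ x ≡ τ y → x ≡ y) → (∀ x → σ x ≡ τ x) →
                   Permutation.classes E σ σ-inj ≤ Permutation.classes E τ τ-inj
permutation-cong E σ τ σ-inj τ-inj σ≗τ =
  classes-antitone E (Permutation.orbits E τ τ-inj) (Permutation.orbits E σ σ-inj) λ (k , h) → k , trans (powers k) h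
  where
  powers : ∀ k {y} → pow σ k y ≡ pow τ k y
  powers zero = refl
  powers (suc k) {y} = trans (cong σ (powers k)) (σ≗τ (pow τ k y))

-- The half of Euler's formula that bounds the genus by 0. It survives the deletion of an edge, and
-- it is what the charges contradict.
Genus≤0 : (G : Graph) → RotationSystem G → Set
Genus≤0 G R = 2 * components G + edges G ≤ Graph.n G + faces G R + isolated G

module EdgeDeletion (G : Graph) (R : RotationSystem G) (a b : Fin (Graph.n G)) (ab : Adj G a b) where
  open Graph G hiding (sym)
  open RotationSystem R
  open Embedding G R
  open Enum E using (_≟_)

  private
    D = Fin n × Fin n
    d d̄ : D
    d = a , b
    d̄ = b , a
    ba : Adj G b a
    ba = adj-sym ab
    a≢b : a ≢ b
    a≢b = adj≢ ab
    d≢d̄ : d ≢ d̄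
    d≢d̄ eq = a≢b (cong proj₁ eq)

  removed : D → Bool
  removed e = does (e ≟ d) ∨ does (e ≟ d̄)

  removed-no : ∀ {e} → e ≢ d → e ≢ d̄ → removed e ≡ false
  removed-no {e} ≢d ≢d̄ rewrite false-dec (e ≟ d) ≢d | false-dec (e ≟ d̄) ≢d̄ = refl

  removed-swap : ∀ u v → removed (u , v) ≡ removed (v , u)
  removed-swap u v with (u , v) ≟ d | (u , v) ≟ d̄
  ... | yes refl | _ rewrite true-dec ((b , a) ≟ d̄) refl = sym (Boolₚ.∨-zeroʳ _)
  ... | no _ | yes refl rewrite true-dec ((a , b) ≟ d) refl = refl
  ... | no ≢d | no ≢d̄ = sym (removed-no (λ { refl → ≢d̄ refl }) (λ { refl → ≢d refl }))

  G′ : Graph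
  G′ = record
    { n = n
    ; adj = λ u v → adj u v ∧ not (removed (u , v))
    ; sym = λ u v → cong₂ (λ x y → x ∧ not y) (Graph.sym G u v) (removed-swap u v)
    ; irrefl = λ u → cong (λ x → x ∧ not (removed (u , u))) (irrefl u)
    }

  adj′⁻ : ∀ {u v} → Adj G′ u v → Adj G u v × (u , v) ≢ d × (u , v) ≢ d̄
  adj′⁻ {u} {v} h with ∧-T {adj u v} h
  ... | uv , nr = uv , (λ eq → kill eq (cong (_∨ does ((u , v) ≟ d̄)) (true-dec ((u , v) ≟ d) eq)))
                     , (λ eq → kill eq (trans (cong (does ((u , v) ≟ d) ∨_) (true-dec ((u , v) ≟ d̄) eq)) (Boolₚ.∨-zeroʳ _)))
    where
    kill : ∀ {A : Set} {x : A} {y} → x ≡ y → removed (u , v) ≡ true → ⊥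
    kill _ r = subst (T ∘ not) r nr

  adj′⁺ : ∀ {u v} → Adj G u v → (u , v) ≢ d → (u , v) ≢ d̄ → Adj G′ u v
  adj′⁺ uv ≢d ≢d̄ rewrite T⇒≡ uv | removed-no ≢d ≢d̄ = tt

  rot′ : Fin n → Fin n → Fin n
  rot′ u v = if does ((u , rot u v) ≟ d) then rot a b else if does ((u , rot u v) ≟ d̄) then rot b a else rot u v

  data Rot′ (u v : Fin n) : Set where
    at-a    : u ≡ a → rot a v ≡ b → rot′ u v ≡ rot a b → Rot′ u v
    at-b    : u ≡ b → rot b v ≡ a → rot′ u v ≡ rot b a → Rot′ u v
    regular : (u , rot u v) ≢ d → (u , rot u v) ≢ d̄ → rot′ u v ≡ rot u v → Rot′ u v

  rot′-cases : ∀ u v → Rot′ u v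
  rot′-cases u v with (u , rot u v) ≟ d in eq₁
  ... | yes eq = at-a (cong proj₁ eq) (trans (cong (λ w → rot w v) (sym (cong proj₁ eq))) (cong proj₂ eq))
                   (cong (λ z → if does z then rot a b else (if does ((u , rot u v) ≟ d̄) then rot b a else rot u v)) eq₁)
  ... | no ≢d with (u , rot u v) ≟ d̄ in eq₂
  ...   | yes eq = at-b (cong proj₁ eq) (trans (cong (λ w → rot w v) (sym (cong proj₁ eq))) (cong proj₂ eq))
                   (cong₂ (λ z z′ → if does z then rot a b else (if does z′ then rot b a else rot u v)) eq₁ eq₂)
  ...   | no ≢d̄ = regular ≢d ≢d̄
                   (cong₂ (λ z z′ → if does z then rot a b else (if does z′ then rot b a else rot u v)) eq₁ eq₂)

  private
    rot-adj′ : ∀ u v → Adj G′ u v → Adj G′ u (rot′ u v)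
    rot-adj′ u v h with adj′⁻ h | rot′-cases u v
    ... | uv , ≢d , ≢d̄ | at-a refl rv≡b eq rewrite eq =
      adj′⁺ (rot-adj a b ab) (λ e → ≢d (cong (a ,_) (rot-inj a v b uv ab (trans rv≡b (sym (cong proj₂ e))))))
            (λ e → a≢b (cong proj₁ e))
    ... | uv , ≢d , ≢d̄ | at-b refl rv≡a eq rewrite eq =
      adj′⁺ (rot-adj b a ba) (λ e → a≢b (sym (cong proj₁ e)))
            (λ e → ≢d̄ (cong (b ,_) (rot-inj b v a uv ba (trans rv≡a (sym (cong proj₂ e))))))
    ... | uv , _ | regular ≢d ≢d̄ eq rewrite eq = adj′⁺ (rot-adj u v uv) ≢d ≢d̄

    rot-inj′ : ∀ u v w → Adj G′ u v → Adj G′ u w → rot′ u v ≡ rot′ u w → v ≡ w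
    rot-inj′ u v w hv hw eq with adj′⁻ hv | adj′⁻ hw | rot′-cases u v | rot′-cases u w
    ... | uv , _ | uw , _ | at-a refl e₁ _ | at-a _ e₂ _ = rot-inj a v w uv uw (trans e₁ (sym e₂))
    ... | uv , _ | uw , _ | at-b refl e₁ _ | at-b _ e₂ _ = rot-inj b v w uv uw (trans e₁ (sym e₂))
    ... | _ | _ | at-a refl _ _ | at-b a≡b _ _ = ⊥-elim (a≢b a≡b)
    ... | _ | _ | at-b refl _ _ | at-a b≡a _ _ = ⊥-elim (a≢b (sym b≡a))
    ... | _ | uw , ≢d , _ | at-a refl _ e₁ | regular _ _ e₂ =
      ⊥-elim (≢d (cong (a ,_) (sym (rot-inj a b w ab uw (trans (sym e₁) (trans eq e₂))))))
    ... | _ | uw , _ , ≢d̄ | at-b refl _ e₁ | regular _ _ e₂ =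
      ⊥-elim (≢d̄ (cong (b ,_) (sym (rot-inj b a w ba uw (trans (sym e₁) (trans eq e₂))))))
    ... | uv , ≢d , _ | _ | regular _ _ e₁ | at-a refl _ e₂ =
      ⊥-elim (≢d (cong (a ,_) (rot-inj a v b uv ab (trans (sym e₁) (trans eq e₂)))))
    ... | uv , _ , ≢d̄ | _ | regular _ _ e₁ | at-b refl _ e₂ =
      ⊥-elim (≢d̄ (cong (b ,_) (rot-inj b v a uv ba (trans (sym e₁) (trans eq e₂)))))
    ... | uv , _ | uw , _ | regular _ _ e₁ | regular _ _ e₂ = rot-inj u v w uv uw (trans (sym e₁) (trans eq e₂))

    Reaches : Fin n → Fin n → Fin n → Set
    Reaches u v w = ∃[ k ] pow (rot′ u) k v ≡ w

    later : ∀ {u v w} → Reaches u (rot′ u v) w → Reaches u v w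
    later {u} {v} (k , h) = suc k , trans (pow-suc (rot′ u) k v) h

    -- Two steps of rot may be covered by one step of rot′, hence the recursion on a bound m ≥ k.
    cyc : ∀ m k {u v w} → k ≤ m → Adj G′ u v → Adj G′ u w → pow (rot u) k v ≡ w → Reaches u v w
    cyc m zero _ _ _ h = 0 , h
    cyc (suc m) (suc k) {u} {v} {w} (s≤s k≤m) hv hw h with rot′-cases u v
    ... | regular _ _ eq = later (cyc m k k≤m (rot-adj′ u v hv) hw
            (trans (cong (pow (rot u) k) eq) (trans (sym (pow-suc (rot u) k v)) h)))
    ... | at-a refl rv≡b eq with k
    ...   | zero = ⊥-elim (proj₁ (proj₂ (adj′⁻ hw)) (cong (a ,_) (trans (sym h) rv≡b)))
    ...   | suc k′ = later (cyc m k′ (ℕₚ.≤-trans (ℕₚ.n≤1+n k′) k≤m) (rot-adj′ a v hv) hw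
            (trans (cong (pow (rot a) k′) (trans eq (cong (rot a) (sym rv≡b))))
              (trans (sym (trans (cong (rot a) (pow-suc (rot a) k′ v)) (pow-suc (rot a) k′ (rot a v)))) h)))
    cyc (suc m) (suc k) {u} {v} {w} (s≤s k≤m) hv hw h | at-b refl rv≡a eq with k
    ...   | zero = ⊥-elim (proj₂ (proj₂ (adj′⁻ hw)) (cong (b ,_) (trans (sym h) rv≡a)))
    ...   | suc k′ = later (cyc m k′ (ℕₚ.≤-trans (ℕₚ.n≤1+n k′) k≤m) (rot-adj′ b v hv) hw
            (trans (cong (pow (rot b) k′) (trans eq (cong (rot b) (sym rv≡a))))
              (trans (sym (trans (cong (rot b) (pow-suc (rot b) k′ v)) (pow-suc (rot b) k′ (rot b v)))) h)))

  R′ : RotationSystem G′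
  R′ = record
    { rot = rot′
    ; rot-adj = rot-adj′
    ; rot-inj = rot-inj′
    ; rot-cyc = λ u v w hv hw → let k , h = rot-pow (proj₁ (adj′⁻ hv)) (proj₁ (adj′⁻ hw))
                                    k′ , h′ = cyc k k ℕₚ.≤-refl hv hw h
                                in k′ , trans (iter≡pow G′ (rot′ u) k′ v) h′
    }

  private
    module E′ = Embedding G′ R′
    -- Exchanging the images of `d` and `d̄` splits their face or joins their two faces along the
    -- edge; afterwards both darts are taken out of their orbits. The result `σ₃` is face tracing in
    -- `G′`.
    module T₁ = Transposed E φ̂ φ̂-injective d d̄
    σ₁ = T₁.τ
    module I₂ = Isolate E σ₁ T₁.τ-inj d
    σ₂ = I₂.σ′
    module I₃ = Isolate E σ₂ I₂.σ′-inj d̄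
    σ₃ = I₃.σ′

    φ̂d : φ̂ d ≡ (b , rot b a)
    φ̂d = φ̂-dart ab
    φ̂d̄ : φ̂ d̄ ≡ (a , rot a b)
    φ̂d̄ = φ̂-dart ba

    σ₁d : σ₁ d ≡ (a , rot a b)
    σ₁d with T₁.tr-cases d
    ... | inj₁ (_ , eq) rewrite eq = φ̂d̄
    ... | inj₂ (inj₁ (d≢d , _)) = ⊥-elim (d≢d refl)
    ... | inj₂ (inj₂ (d≢d , _)) = ⊥-elim (d≢d refl)

    σ₁d̄ : σ₁ d̄ ≡ (b , rot b a)
    σ₁d̄ with T₁.tr-cases d̄
    ... | inj₁ (d̄≡d , _) = ⊥-elim (d≢d̄ (sym d̄≡d))
    ... | inj₂ (inj₁ (_ , _ , eq)) rewrite eq = φ̂d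
    ... | inj₂ (inj₂ (_ , d̄≢d̄ , _)) = ⊥-elim (d̄≢d̄ refl)

    σ₁-other : ∀ {e} → e ≢ d → e ≢ d̄ → σ₁ e ≡ φ̂ e
    σ₁-other {e} ≢d ≢d̄ with T₁.tr-cases e
    ... | inj₁ (e≡d , _) = ⊥-elim (≢d e≡d)
    ... | inj₂ (inj₁ (_ , e≡d̄ , _)) = ⊥-elim (≢d̄ e≡d̄)
    ... | inj₂ (inj₂ (_ , _ , eq)) rewrite eq = refl

    σ₂d̄ : σ₂ d̄ ≡ (b , rot b a)
    σ₂d̄ = trans (I₂.keeps (d≢d̄ ∘ sym) λ e → a≢b (sym (cong proj₁ (trans (sym σ₁d̄) e)))) σ₁d̄

    φ̂′-fix : ∀ {e} → ¬ T (E′.isDart e) → E′.φ̂ e ≡ e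
    φ̂′-fix = E′.φ̂-nondart

    σ₃-at : ∀ u v → Dec ((u , v) ≡ d) → Dec ((u , v) ≡ d̄) → Dec (Adj G u v) → σ₃ (u , v) ≡ E′.φ̂ (u , v)
    σ₃-at u v (yes refl) _ _ = trans (trans (I₃.keeps d≢d̄ (λ h → d≢d̄ (trans (sym I₂.fixes) h))) I₂.fixes)
                                  (sym (φ̂′-fix {d} λ t → proj₁ (proj₂ (adj′⁻ t)) refl))
    σ₃-at u v (no _) (yes refl) _ = trans I₃.fixes (sym (φ̂′-fix {d̄} λ t → proj₂ (proj₂ (adj′⁻ t)) refl))
    σ₃-at u v (no e≢d) (no e≢d̄) (no ¬uv) = trans (trans (I₃.keeps e≢d̄ (λ h → e≢d̄ (trans (sym σ₂e) h))) σ₂e)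
                                              (sym (φ̂′-fix {u , v} λ t → ¬uv (proj₁ (adj′⁻ t))))
      where
      σ₁e : σ₁ (u , v) ≡ (u , v)
      σ₁e = trans (σ₁-other e≢d e≢d̄) (φ̂-nondart {u , v} ¬uv)
      σ₂e : σ₂ (u , v) ≡ (u , v)
      σ₂e = trans (I₂.keeps e≢d (λ h → e≢d (trans (sym σ₁e) h))) σ₁e
    σ₃-at u v (no e≢d) (no e≢d̄) (yes uv) = trans (main (rot′-cases v u)) (sym (E′.φ̂-dart (adj′⁺ uv e≢d e≢d̄)))
      where
      σ₁e : σ₁ (u , v) ≡ (v , rot v u)
      σ₁e = trans (σ₁-other e≢d e≢d̄) (φ̂-dart uv)
      main : Rot′ v u → σ₃ (u , v) ≡ (v , rot′ v u)
      main (at-a refl ru≡b eq) = trans (trans (I₃.keeps e≢d̄ (λ h → a≢b (cong proj₁ (trans (sym σ₂e) h)))) σ₂e) (cong (a ,_) (sym eq))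
        where
        σ₂e : σ₂ (u , v) ≡ (a , rot a b)
        σ₂e = trans (I₂.bypasses e≢d (trans σ₁e (cong (a ,_) ru≡b))) σ₁d
      main (at-b refl ru≡a eq) = trans (I₃.bypasses e≢d̄ (trans σ₂e (cong (b ,_) ru≡a))) (trans σ₂d̄ (cong (b ,_) (sym eq)))
        where
        σ₂e : σ₂ (u , v) ≡ (b , rot b u)
        σ₂e = trans (I₂.keeps e≢d (λ h → a≢b (sym (cong proj₁ (trans (sym σ₁e) h))))) σ₁e
      main (regular ≢d ≢d̄ eq) = trans (trans (I₃.keeps e≢d̄ (λ h → ≢d̄ (trans (sym σ₂e) h))) σ₂e) (cong (v ,_) (sym eq))
        where
        σ₂e : σ₂ (u , v) ≡ (v , rot v u)
        σ₂e = trans (I₂.keeps e≢d (λ h → ≢d (trans (sym σ₁e) h))) σ₁e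

    σ₃≗φ̂′ : ∀ e → σ₃ e ≡ E′.φ̂ e
    σ₃≗φ̂′ (u , v) = σ₃-at u v ((u , v) ≟ d) ((u , v) ≟ d̄) (Boolₚ.T? (adj u v))

    -- `α` is 1 when `b` is the only neighbour of `a`. Then `d` is fixed already after the
    -- transposition and yields no new orbit, but `a` becomes isolated in `G′`. `β` does the same
    -- for `b`, and both effects cancel in `faces+isolated`.
    α β : ℕ
    α = when (does (σ₁ d ≟ d)) 1
    β = when (does (σ₂ d̄ ≟ d̄)) 1

    module P₁ = Permutation E σ₁ T₁.τ-inj
    module P₂ = Permutation E σ₂ I₂.σ′-inj
    module P₃ = Permutation E σ₃ I₃.σ′-inj

    classes′ : 2 + P₁.classes ≤ E′.classes + α + β
    classes′ = begin
      2 + P₁.classes                   ≤⟨ s≤s I₂.isolate-classes ⟩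
      suc P₂.classes + α               ≤⟨ ℕₚ.+-monoˡ-≤ α I₃.isolate-classes ⟩
      P₃.classes + β + α               ≤⟨ ℕₚ.+-monoˡ-≤ α (ℕₚ.+-monoˡ-≤ β (permutation-cong E σ₃ E′.φ̂ I₃.σ′-inj E′.φ̂-injective σ₃≗φ̂′)) ⟩
      E′.classes + β + α               ≡⟨ swap-last E′.classes β α ⟩
      E′.classes + α + β               ∎
      where
      open ℕₚ.≤-Reasoning
      swap-last : ∀ x y z → x + y + z ≡ x + z + y
      swap-last = solve-∀

    leaf-isolated : ∀ {u v} → Adj G u v → rot u v ≡ v → ∀ w → Adj G u w → w ≡ v
    leaf-isolated {u} {v} uv fix w uw = let k , h = rot-pow uv uw in trans (sym h) (pow-fix (rot u) k fix)

    isolated′ : isolated G + α + β ≤ isolated G′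
    isolated′ = subst₂ (λ x y → x + α + β ≤ y) (sym isolated≡) (sym E′.isolated≡) (begin
      tally (finEnum n) isolated? + α + β
        ≡⟨ cong₂ (λ x y → tally (finEnum n) isolated? + x + y) (sym (Enum.Σ-δ (finEnum n) a (λ _ → α))) (sym (Enum.Σ-δ (finEnum n) b (λ _ → β))) ⟩
      tally (finEnum n) isolated? + V.Σ∙ (λ x → when (does (x V.≟ a)) α) + V.Σ∙ (λ x → when (does (x V.≟ b)) β)
        ≡⟨ cong (_+ V.Σ∙ (λ x → when (does (x V.≟ b)) β)) (V.Σ-+ (λ x → when (isolated? x) 1) (λ x → when (does (x V.≟ a)) α)) ⟨
      V.Σ∙ (λ x → when (isolated? x) 1 + when (does (x V.≟ a)) α) + V.Σ∙ (λ x → when (does (x V.≟ b)) β)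
        ≡⟨ V.Σ-+ (λ x → when (isolated? x) 1 + when (does (x V.≟ a)) α) (λ x → when (does (x V.≟ b)) β) ⟨
      V.Σ∙ (λ x → when (isolated? x) 1 + when (does (x V.≟ a)) α + when (does (x V.≟ b)) β)
        ≤⟨ V.Σ-mono pointwise ⟩
      tally (finEnum n) E′.isolated? ∎)
      where
      open ℕₚ.≤-Reasoning
      module V = Enum (finEnum n)
      notIsolated : ∀ {u v} → Adj G u v → isolated? u ≡ false
      notIsolated uv = ¬T⇒≡false λ t → isolated?⁻ (T⇒≡ t) _ uv
      pointwise : ∀ x → when (isolated? x) 1 + when (does (x V.≟ a)) α + when (does (x V.≟ b)) β ≤ when (E′.isolated? x) 1
      pointwise x with x V.≟ a | x V.≟ b
      ... | yes refl | yes a≡b = ⊥-elim (a≢b a≡b)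
      ... | yes refl | no _ rewrite notIsolated ab with σ₁ d ≟ d
      ...   | no _ = z≤n
      ...   | yes fix rewrite E′.isolated?⁺ {a} (λ w aw → let aw′ , ≢d , _ = adj′⁻ aw in
                ≢d (cong (a ,_) (leaf-isolated ab (cong proj₂ (trans (sym σ₁d) fix)) w aw′))) = ℕₚ.≤-refl
      pointwise x | no _ | yes refl rewrite notIsolated ba with σ₂ d̄ ≟ d̄
      ...   | no _ = z≤n
      ...   | yes fix rewrite E′.isolated?⁺ {b} (λ w bw → let bw′ , _ , ≢d̄ = adj′⁻ bw in
                ≢d̄ (cong (b ,_) (leaf-isolated ba (cong proj₂ (trans (sym σ₂d̄) fix)) w bw′))) = ℕₚ.≤-refl
      pointwise x | no _ | no _ = ℕₚ.≤-trans (ℕₚ.≤-reflexive (trans (ℕₚ.+-identityʳ _) (ℕₚ.+-identityʳ _)))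
        (when-mono (λ i → E′.isolated?⁺ λ w xw → isolated?⁻ i w (proj₁ (adj′⁻ xw))) ℕₚ.≤-refl)

    nd nd′ : ℕ
    nd = tally E (not ∘ isDart)
    nd′ = tally E (not ∘ E′.isDart)

    nondarts′ : nd′ ≤ 2 + nd
    nondarts′ = ℕₚ.≤-trans
      (tally-extra E {q = λ e → not (isDart e) ∨ does (e ≟ d)} d̄ (λ e h → step₁ e h))
      (s≤s (tally-extra E d λ e h → step₂ e h))
      where
      step₁ : ∀ e → not (E′.isDart e) ≡ true → not (isDart e) ∨ does (e ≟ d) ≡ true ⊎ e ≡ d̄
      step₁ e h with isDart e | e ≟ d | e ≟ d̄
      ... | false | _     | _     = inj₁ refl
      ... | true  | yes _ | _     = inj₁ refl
      ... | true  | no _  | yes p = inj₂ p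
      step₁ e () | true | no _ | no _
      step₂ : ∀ e → not (isDart e) ∨ does (e ≟ d) ≡ true → not (isDart e) ≡ true ⊎ e ≡ d
      step₂ e h with isDart e | e ≟ d
      ... | false | _     = inj₁ refl
      ... | true  | yes p = inj₂ p
      step₂ e () | true | no _

    edges′ : suc (edges G′) ≤ edges G
    edges′ = subst₂ (λ x y → suc x ≤ y) (sym (edges≡ G′)) (sym (edges≡ G)) smaller
      where
      mono : ∀ (e : D) → E′.isDart e ∧ (toℕ (proj₁ e) <ᵇ toℕ (proj₂ e)) ≡ true → isDart e ∧ (toℕ (proj₁ e) <ᵇ toℕ (proj₂ e)) ≡ true
      mono e h = let h₁ , h₂ = ∧-≡ {E′.isDart e} h in cong₂ _∧_ (T⇒≡ (proj₁ (adj′⁻ (≡⇒T h₁)))) h₂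
      gone : ∀ {e} → e ≡ d ⊎ e ≡ d̄ → E′.isDart e ∧ (toℕ (proj₁ e) <ᵇ toℕ (proj₂ e)) ≡ false
      gone {e} eq = ¬T⇒≡false λ t → let t′ = proj₁ (∧-T {E′.isDart e} t) ; _ , ≢d , ≢d̄ = adj′⁻ t′ in [ ≢d , ≢d̄ ]′ eq
      smaller : suc (tally E (λ e → E′.isDart e ∧ (toℕ (proj₁ e) <ᵇ toℕ (proj₂ e)))) ≤ tally E (λ e → isDart e ∧ (toℕ (proj₁ e) <ᵇ toℕ (proj₂ e)))
      smaller with ℕₚ.<-cmp (toℕ a) (toℕ b)
      ... | tri< lt _ _ = tally-strict E mono d (gone (inj₁ refl)) (cong₂ _∧_ (T⇒≡ ab) (T⇒≡ (ℕₚ.<⇒<ᵇ lt)))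
      ... | tri≈ _ eq _ = ⊥-elim (a≢b (Finₚ.toℕ-injective eq))
      ... | tri> _ _ gt = tally-strict E mono d̄ (gone (inj₂ refl)) (cong₂ _∧_ (T⇒≡ ba) (T⇒≡ (ℕₚ.<⇒<ᵇ gt)))

    -- Balances the orbit counts of the three steps against the newly isolated vertices and the two
    -- pairs that cease to be darts. The case `k = 2` serves when the transposition splits a face,
    -- `k = 0` when it may join two.
    faces+isolated : ∀ k → k + classes ≤ 1 + P₁.classes → k + (faces G R + isolated G) ≤ 1 + (faces G′ R′ + isolated G′)
    faces+isolated k h = ℕₚ.+-cancelʳ-≤ (nd′ + nd + P₁.classes + 3 + α + β) _ _ (begin
      k + (faces G R + isolated G) + (nd′ + nd + P₁.classes + 3 + α + β)
        ≡⟨ arrange₁ k (faces G R) (isolated G) nd′ nd P₁.classes α β ⟩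
      (k + (faces G R + nd)) + (2 + P₁.classes) + (isolated G + α + β) + nd′ + 1
        ≡⟨ cong (λ c → (k + c) + (2 + P₁.classes) + (isolated G + α + β) + nd′ + 1) classes≡ ⟨
      (k + classes) + (2 + P₁.classes) + (isolated G + α + β) + nd′ + 1
        ≤⟨ ℕₚ.+-monoˡ-≤ 1 (ℕₚ.+-mono-≤ (ℕₚ.+-mono-≤ (ℕₚ.+-mono-≤ h classes′) isolated′) nondarts′) ⟩
      (1 + P₁.classes) + (E′.classes + α + β) + isolated G′ + (2 + nd) + 1
        ≡⟨ cong (λ c → (1 + P₁.classes) + (c + α + β) + isolated G′ + (2 + nd) + 1) E′.classes≡ ⟩
      (1 + P₁.classes) + (faces G′ R′ + nd′ + α + β) + isolated G′ + (2 + nd) + 1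
        ≡⟨ arrange₂ P₁.classes (faces G′ R′) nd′ α β (isolated G′) nd ⟩
      1 + (faces G′ R′ + isolated G′) + (nd′ + nd + P₁.classes + 3 + α + β) ∎)
      where
      open ℕₚ.≤-Reasoning
      arrange₁ : ∀ k f i m n c α β → k + (f + i) + (m + n + c + 3 + α + β) ≡ (k + (f + n)) + (2 + c) + (i + α + β) + m + 1
      arrange₁ = solve-∀
      arrange₂ : ∀ c f m α β i n → (1 + c) + (f + m + α + β) + i + (2 + n) + 1 ≡ 1 + (f + i) + (m + n + c + 3 + α + β)
      arrange₂ = solve-∀

    Linked′ = E′.Linked

    linked⁻ : ∀ {x y} → Linked x y → Linked′ x y ⊎ (Linked′ x a × Linked′ y b) ⊎ (Linked′ x b × Linked′ y a)
    linked⁻ ε = inj₁ ε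
    linked⁻ {x} (_◅_ {j = w} xw l) with linked⁻ l | (x , w) ≟ d | (x , w) ≟ d̄
    ... | inj₁ m              | yes refl | _ = inj₂ (inj₁ (ε , reverse E′.adj-sym m))
    ... | inj₂ (inj₁ (p , q)) | yes refl | _ = inj₂ (inj₁ (ε , q))
    ... | inj₂ (inj₂ (p , q)) | yes refl | _ = inj₁ (reverse E′.adj-sym q)
    ... | inj₁ m              | no _ | yes refl = inj₂ (inj₂ (ε , reverse E′.adj-sym m))
    ... | inj₂ (inj₁ (p , q)) | no _ | yes refl = inj₁ (reverse E′.adj-sym q)
    ... | inj₂ (inj₂ (p , q)) | no _ | yes refl = inj₂ (inj₂ (ε , q))
    ... | inj₁ m              | no ≢d | no ≢d̄ = inj₁ (adj′⁺ xw ≢d ≢d̄ ◅ m)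
    ... | inj₂ (inj₁ (p , q)) | no ≢d | no ≢d̄ = inj₂ (inj₁ (adj′⁺ xw ≢d ≢d̄ ◅ p , q))
    ... | inj₂ (inj₂ (p , q)) | no ≢d | no ≢d̄ = inj₂ (inj₂ (adj′⁺ xw ≢d ≢d̄ ◅ p , q))

    module _ (different : ¬ SameOrbit d d̄) where
      -- The face of d leads from b back to a without using the deleted edge.
      around : ∀ k → suc k ≤ period d → Linked′ b (proj₁ (pow φ̂ (suc k) d))
      around zero _ rewrite φ̂d = ε
      around (suc k) sk<p with pow φ̂ (suc k) d in eq | around k (ℕₚ.<⇒≤ sk<p) | pow-isDart (suc k) {d} ab
      ... | (u , v) | l | uv rewrite φ̂-dart uv =
        l ◅◅ (adj′⁺ uv (λ e → period-least d (s≤s z≤n) sk<p (trans eq e))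
                       (λ e → different (suc k , trans eq e)) ◅ ε)

      still-linked : Linked′ a b
      still-linked with period d | period>0 d | pow-period d | around
      ... | suc k | _ | eq | f = reverse E′.adj-sym (subst (λ e → Linked′ b (proj₁ e)) eq (f k ℕₚ.≤-refl))

      linked⊆ : ∀ {x y} → Linked x y → Linked′ x y
      linked⊆ l with linked⁻ l
      ... | inj₁ m = m
      ... | inj₂ (inj₁ (p , q)) = p ◅◅ still-linked ◅◅ reverse E′.adj-sym q
      ... | inj₂ (inj₂ (p , q)) = p ◅◅ reverse E′.adj-sym still-linked ◅◅ reverse E′.adj-sym q

  fewer-edges : suc (edges G′) ≤ edges G
  fewer-edges = edges′

  -- If both darts lie on one face, that orbit splits: faces and isolated vertices together gain at
  -- least one, which along with the lost edge pays for a possible new component. Otherwise at most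
  -- one is lost, the lost edge pays for it, and the components stay, because the rest of the face
  -- of `d` still links `a` and `b`.
  genus≤0 : Genus≤0 G R → Genus≤0 G′ R′
  genus≤0 g with DecEquiv._~?_ orbits d d̄
  ... | yes same = ℕₚ.+-cancelʳ-≤ 2 _ _ (begin
    2 * components G′ + edges G′ + 2      ≡⟨ assoc₁ (components G′) (edges G′) ⟩
    2 * components G′ + suc (edges G′) + 1 ≤⟨ ℕₚ.+-monoˡ-≤ 1 (ℕₚ.+-mono-≤ (ℕₚ.*-monoʳ-≤ 2 comps) edges′) ⟩
    2 * suc (components G) + edges G + 1  ≡⟨ assoc₂ (components G) (edges G) ⟩
    2 * components G + edges G + 3        ≤⟨ ℕₚ.+-monoˡ-≤ 3 g ⟩
    n + faces G R + isolated G + 3        ≡⟨ assoc₃ n (faces G R) (isolated G) ⟩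
    n + (2 + (faces G R + isolated G)) + 1 ≤⟨ ℕₚ.+-monoˡ-≤ 1 (ℕₚ.+-monoʳ-≤ n (faces+isolated 2 (s≤s (T₁.suc-classes≤ d≢d̄ same)))) ⟩
    n + (1 + (faces G′ R′ + isolated G′)) + 1 ≡⟨ assoc₄ n (faces G′ R′) (isolated G′) ⟩
    n + faces G′ R′ + isolated G′ + 2     ∎)
    where
    open ℕₚ.≤-Reasoning
    comps : components G′ ≤ suc (components G)
    comps rewrite components≡ | E′.components≡ = classes-join (finEnum n) E′.linked linked {a} {b} linked⁻
    assoc₁ : ∀ c e → 2 * c + e + 2 ≡ 2 * c + suc e + 1
    assoc₁ = solve-∀
    assoc₂ : ∀ c e → 2 * suc c + e + 1 ≡ 2 * c + e + 3
    assoc₂ = solve-∀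
    assoc₃ : ∀ n f i → n + f + i + 3 ≡ n + (2 + (f + i)) + 1
    assoc₃ = solve-∀
    assoc₄ : ∀ n f i → n + (1 + (f + i)) + 1 ≡ n + f + i + 2
    assoc₄ = solve-∀
  ... | no different = ℕₚ.+-cancelʳ-≤ 1 _ _ (begin
    2 * components G′ + edges G′ + 1      ≡⟨ assoc₁ (components G′) (edges G′) ⟩
    2 * components G′ + suc (edges G′)    ≤⟨ ℕₚ.+-mono-≤ (ℕₚ.*-monoʳ-≤ 2 comps) edges′ ⟩
    2 * components G + edges G            ≤⟨ g ⟩
    n + faces G R + isolated G            ≡⟨ ℕₚ.+-assoc n _ _ ⟩
    n + (faces G R + isolated G)          ≤⟨ ℕₚ.+-monoʳ-≤ n (faces+isolated 0 T₁.classes≤) ⟩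
    n + (1 + (faces G′ R′ + isolated G′)) ≡⟨ assoc₄ n (faces G′ R′) (isolated G′) ⟩
    n + faces G′ R′ + isolated G′ + 1     ∎)
    where
    open ℕₚ.≤-Reasoning
    comps : components G′ ≤ components G
    comps rewrite components≡ | E′.components≡ = classes-antitone (finEnum n) linked E′.linked (linked⊆ different)
    assoc₁ : ∀ c e → 2 * c + e + 1 ≡ 2 * c + suc e
    assoc₁ = solve-∀
    assoc₄ : ∀ n f i → n + (1 + (f + i)) ≡ n + f + i + 1
    assoc₄ = solve-∀

-- Partial colourings

-- `𝕌` marks uncoloured vertices. They count in neither condition of `Valid`, so a colouring can be
-- changed one vertex at a time.
data Colour : Set where
  𝕀 𝔽 𝕌 : Colour

is𝔽 : Colour → Bool
is𝔽 𝔽 = true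
is𝔽 _ = false

is𝔽⁻ : ∀ {x} → T (is𝔽 x) → x ≡ 𝔽
is𝔽⁻ {𝔽} _ = refl

_≟ᶜ_ : DecidableEquality Colour
𝕀 ≟ᶜ 𝕀 = yes refl
𝕀 ≟ᶜ 𝔽 = no λ ()
𝕀 ≟ᶜ 𝕌 = no λ ()
𝔽 ≟ᶜ 𝕀 = no λ ()
𝔽 ≟ᶜ 𝔽 = yes refl
𝔽 ≟ᶜ 𝕌 = no λ ()
𝕌 ≟ᶜ 𝕀 = no λ ()
𝕌 ≟ᶜ 𝔽 = no λ ()
𝕌 ≟ᶜ 𝕌 = yes refl

step-spec : ∀ {k} (i : Fin (suc k)) → (∃[ j ] (step i ≡ just j × toℕ j ≡ suc (toℕ i))) ⊎ (step i ≡ nothing × toℕ i ≡ k)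
step-spec {zero}  zero = inj₂ (refl , refl)
step-spec {suc k} zero = inj₁ (suc zero , refl , refl)
step-spec {suc k} (suc i) with step-spec i
... | inj₁ (j , eq , eq′) = inj₁ (suc j , cong (Data.Maybe.map suc) eq , cong suc eq′)
... | inj₂ (eq , eq′)     = inj₂ (cong (Data.Maybe.map suc) eq , cong suc eq′)

next-spec : ∀ {k} (i : Fin k) → toℕ (next i) ≡ suc (toℕ i) ⊎ (toℕ (next i) ≡ 0 × suc (toℕ i) ≡ k)
next-spec {suc k} i with step-spec i
... | inj₁ (j , eq , eq′) rewrite eq = inj₁ eq′
... | inj₂ (eq , eq′)     rewrite eq = inj₂ (refl , cong suc eq′)

next-surjective : ∀ {k} (i : Fin k) → ∃[ j ] next j ≡ i
next-surjective {suc k} zero with next-spec (Data.Fin.fromℕ k)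
... | inj₁ eq = ⊥-elim (ℕₚ.<⇒≢ (Finₚ.toℕ<n (next (Data.Fin.fromℕ k))) (trans eq (cong suc (Finₚ.toℕ-fromℕ k))))
... | inj₂ (eq , _) = Data.Fin.fromℕ k , Finₚ.toℕ-injective eq
next-surjective {suc k} (suc i) with next-spec (Data.Fin.inject₁ i)
... | inj₁ eq = Data.Fin.inject₁ i , Finₚ.toℕ-injective (trans eq (cong suc (Finₚ.toℕ-inject₁ i)))
... | inj₂ (_ , eq) = ⊥-elim (ℕₚ.<⇒≢ (s≤s (Finₚ.toℕ<n i)) (trans (cong suc (sym (Finₚ.toℕ-inject₁ i))) eq))

next-next≢ : ∀ {k} → 3 ≤ k → (j : Fin k) → next (next j) ≢ j
next-next≢ {k} 3≤k j eq with next-spec j | next-spec (next j)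
... | inj₁ e₁ | inj₁ e₂ = ℕₚ.<⇒≢ (ℕₚ.m≤n⇒m≤1+n ℕₚ.≤-refl) (trans (sym (cong toℕ eq)) (trans e₂ (cong suc e₁)))
... | inj₁ e₁ | inj₂ (e₂ , e₃) =
  ℕₚ.<⇒≱ 3≤k (ℕₚ.≤-reflexive (trans (sym e₃) (cong suc (trans e₁ (cong suc (trans (sym (cong toℕ eq)) e₂))))))
... | inj₂ (e₁ , e₃) | inj₁ e₂ =
  ℕₚ.<⇒≱ 3≤k (ℕₚ.≤-reflexive (trans (sym e₃) (cong suc (trans (sym (cong toℕ eq)) (trans e₂ (cong suc e₁))))))
... | inj₂ (e₁ , e₃) | inj₂ (e₂ , e₃′) =
  ℕₚ.<⇒≱ 3≤k (ℕₚ.≤-trans (ℕₚ.≤-reflexive (trans (sym e₃′) (cong suc e₁))) (s≤s z≤n))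

module Colouring (G : Graph) where
  open Graph G hiding (sym)
  open Connectivity G using (adj-sym; adj≢)
  private
    V = Fin n
    open module E = Enum (finEnum n) using (_≟_)

  Colours : Set
  Colours = V → Colour

  forestAdj : Colours → V → V → Bool
  forestAdj c u v = adj u v ∧ (is𝔽 (c u) ∧ is𝔽 (c v))

  record Valid (c : Colours) : Set where
    field
      independent : ∀ {u v} → Adj G u v → c u ≡ 𝕀 → c v ≢ 𝕀
      acyclic     : ∀ k → ¬ Cycle V (forestAdj c) k
  open Valid

  forestAdj⁻ : ∀ c {u v} → T (forestAdj c u v) → Adj G u v × c u ≡ 𝔽 × c v ≡ 𝔽
  forestAdj⁻ c {u} {v} t with ∧-T {adj u v} t
  ... | uv , t′ with ∧-T {is𝔽 (c u)} t′
  ...   | cu , cv = uv , is𝔽⁻ cu , is𝔽⁻ cv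

  forestAdj⁺ : ∀ c {u v} → Adj G u v → c u ≡ 𝔽 → c v ≡ 𝔽 → T (forestAdj c u v)
  forestAdj⁺ c uv cu cv rewrite T⇒≡ uv | cu | cv = tt

  recast : ∀ {W : Set} {f g : W → W → Bool} {k} (C : Cycle W f k) →
           (∀ i → T (g (Cycle.vert C i) (Cycle.vert C (next i)))) → Cycle W g k
  recast C e = record { len≥3 = Cycle.len≥3 C ; vert = Cycle.vert C ; inj = Cycle.inj C ; edge = e }

  update : Colours → V → Colour → Colours
  update c v x w = if does (w ≟ v) then x else c w

  update-same : ∀ c v x → update c v x v ≡ x
  update-same c v x rewrite true-dec (v ≟ v) refl = refl

  update-other : ∀ c v x {w} → w ≢ v → update c v x w ≡ c w
  update-other c v x {w} w≢v rewrite false-dec (w ≟ v) w≢v = refl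

  update-cases : ∀ c v x w → (w ≡ v × update c v x w ≡ x) ⊎ (w ≢ v × update c v x w ≡ c w)
  update-cases c v x w with w ≟ v
  ... | yes eq = inj₁ (eq , refl)
  ... | no ≢ = inj₂ (≢ , refl)

  private
    shrink : ∀ {c c′} → Valid c → (∀ w → c′ w ≡ 𝔽 → c w ≡ 𝔽) → ∀ k → ¬ Cycle V (forestAdj c′) k
    shrink {c} {c′} val ⊆ k C = acyclic val k (recast C λ i → let uv , cu , cv = forestAdj⁻ c′ (Cycle.edge C i) in
                         forestAdj⁺ c uv (⊆ _ cu) (⊆ _ cv))

  valid-𝕌 : ∀ {c} v → Valid c → Valid (update c v 𝕌)
  valid-𝕌 {c} v val = record
    { independent = λ {u} {w} uw cu cw → case (update-cases c v 𝕌 u , update-cases c v 𝕌 w) of λ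
        { (inj₁ (_ , e) , _) → case trans (sym e) cu of λ ()
        ; (_ , inj₁ (_ , e)) → case trans (sym e) cw of λ ()
        ; (inj₂ (_ , e) , inj₂ (_ , e′)) → independent val uw (trans (sym e) cu) (trans (sym e′) cw) }
    ; acyclic = shrink val λ w h → case update-cases c v 𝕌 w of λ
        { (inj₁ (_ , e)) → case trans (sym e) h of λ () ; (inj₂ (_ , e)) → trans (sym e) h } }

  valid-𝕀 : ∀ {c} v → Valid c → (∀ w → Adj G v w → c w ≢ 𝕀) → Valid (update c v 𝕀)
  valid-𝕀 {c} v val no𝕀 = record
    { independent = λ {u} {w} uw cu cw → case (update-cases c v 𝕀 u , update-cases c v 𝕀 w) of λ
        { (inj₁ (refl , _) , inj₁ (refl , _)) → adj≢ uw refl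
        ; (inj₁ (refl , _) , inj₂ (_ , e)) → no𝕀 w uw (trans (sym e) cw)
        ; (inj₂ (_ , e) , inj₁ (refl , _)) → no𝕀 u (adj-sym uw) (trans (sym e) cu)
        ; (inj₂ (_ , e) , inj₂ (_ , e′)) → independent val uw (trans (sym e) cu) (trans (sym e′) cw) }
    ; acyclic = shrink val λ w h → case update-cases c v 𝕀 w of λ
        { (inj₁ (_ , e)) → case trans (sym e) h of λ () ; (inj₂ (_ , e)) → trans (sym e) h } }

  -- With at most one neighbour in `𝔽`, the vertex is a leaf of the forest: on a cycle, its
  -- predecessor and its successor would be different neighbours in `𝔽`.
  valid-𝔽 : ∀ {c} v → Valid c → (∀ {u w} → Adj G v u → Adj G v w → c u ≡ 𝔽 → c w ≡ 𝔽 → u ≡ w) →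
            Valid (update c v 𝔽)
  valid-𝔽 {c} v val one = record
    { independent = λ {u} {w} uw cu cw → case (update-cases c v 𝔽 u , update-cases c v 𝔽 w) of λ
        { (inj₁ (_ , e) , _) → case trans (sym e) cu of λ ()
        ; (_ , inj₁ (_ , e)) → case trans (sym e) cw of λ ()
        ; (inj₂ (_ , e) , inj₂ (_ , e′)) → independent val uw (trans (sym e) cu) (trans (sym e′) cw) }
    ; acyclic = noCycle }
    where
    old : ∀ {w} → w ≢ v → update c v 𝔽 w ≡ 𝔽 → c w ≡ 𝔽
    old w≢v h = trans (sym (update-other c v 𝔽 w≢v)) h
    noCycle : ∀ k → ¬ Cycle V (forestAdj (update c v 𝔽)) k
    noCycle k C with Finₚ.any? (λ i → vert i ≟ v)
      where open Cycle C
    ... | no avoids = acyclic val k (recast C λ i → let uv , cu , cv = forestAdj⁻ (update c v 𝔽) (Cycle.edge C i) in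
                        forestAdj⁺ c uv (old (λ e → avoids (_ , e)) cu) (old (λ e → avoids (_ , e)) cv))
    ... | yes (i , vᵢ) with next-surjective i
    ...   | j , refl with forestAdj⁻ (update c v 𝔽) (Cycle.edge C j) | forestAdj⁻ (update c v 𝔽) (Cycle.edge C (next j))
    ...     | jv , cj , _ | vn , _ , cn = next-next≢ (Cycle.len≥3 C) j (sym (Cycle.inj C
              (one vj vn′ (old (adj≢ vj ∘ sym) cj) (old (adj≢ vn′ ∘ sym) cn))))
      where
      vj = adj-sym (subst (Adj G _) vᵢ jv)
      vn′ = subst (λ x → Adj G x _) vᵢ vn

  -- Without a neighbour in `𝕀` the vertex takes `𝕀`. Otherwise at most one of its two coloured
  -- neighbours is in `𝔽`, and it becomes a leaf.
  greedy : ∀ {c} v {p q} → Valid c → (∀ w → Adj G v w → c w ≢ 𝕌 → w ≡ p ⊎ w ≡ q) →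
           ∃[ x ] (x ≢ 𝕌 × Valid (update c v x))
  greedy {c} v {p} {q} val among with E.any? (λ w → Boolₚ.T? (adj v w) ×-dec (c w ≟ᶜ 𝕀))
  ... | no none = 𝕀 , (λ ()) , valid-𝕀 v val λ w vw cw → none (w , vw , cw)
  ... | yes (w , vw , cw) = 𝔽 , (λ ()) , valid-𝔽 v val unique
    where
    coloured : ∀ {u x} → c u ≡ x → x ≢ 𝕌 → c u ≢ 𝕌
    coloured refl h = h
    unique : ∀ {u u′} → Adj G v u → Adj G v u′ → c u ≡ 𝔽 → c u′ ≡ 𝔽 → u ≡ u′
    unique {u} {u′} vu vu′ cu cu′
      with among w vw (coloured cw λ ()) | among u vu (coloured cu λ ()) | among u′ vu′ (coloured cu′ λ ())
    ... | _ | inj₁ refl | inj₁ refl = refl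
    ... | _ | inj₂ refl | inj₂ refl = refl
    ... | inj₁ refl | inj₁ refl | inj₂ _ = case trans (sym cw) cu of λ ()
    ... | inj₂ refl | inj₁ refl | inj₂ refl = case trans (sym cw) cu′ of λ ()
    ... | inj₁ refl | inj₂ refl | inj₁ refl = case trans (sym cw) cu′ of λ ()
    ... | inj₂ refl | inj₂ refl | inj₁ _ = case trans (sym cw) cu of λ ()

  partition : ∀ {c} → Valid c → (∀ v → c v ≢ 𝕌) → IFPartitionable G
  partition {c} val total = χ , (λ u v uv χu χv → independent val uv (χ⁻ χu) (χ⁻ χv)) , forest
    where
    χ : V → Bool
    χ v = does (c v ≟ᶜ 𝕀)
    χ⁻ : ∀ {v} → T (χ v) → c v ≡ 𝕀
    χ⁻ {v} t = dec-true (c v ≟ᶜ 𝕀) (T⇒≡ t)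
    ¬χ⁻ : ∀ {v} → T (not (χ v)) → c v ≡ 𝔽
    ¬χ⁻ {v} t with c v in eq
    ... | 𝔽 = refl
    ... | 𝕌 = ⊥-elim (total v eq)
    forest : IsForest (InducedV G (λ v → not (χ v))) (inducedAdj G (λ v → not (χ v)))
    forest k C = acyclic val k (record
      { len≥3 = len≥3
      ; vert = proj₁ ∘ vert
      ; inj = λ {i} {j} eq → inj (same (vert i) (vert j) eq)
      ; edge = λ i → forestAdj⁺ c (edge i) (¬χ⁻ (proj₂ (vert i))) (¬χ⁻ (proj₂ (vert (next i)))) })
      where
      open Cycle C
      same : ∀ (x y : InducedV G (λ v → not (χ v))) → proj₁ x ≡ proj₁ y → x ≡ y
      same (x , t) (.x , t′) refl = cong (x ,_) (Boolₚ.T-irrelevant t t′)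

  -- Extending a colouring over a cycle of ten vertices of degree 3

  record LowCycle : Set where
    field
      -- Indices run through all of `ℕ` with period 10, so that the starting point can be moved by a
      -- plain shift.
      v o        : ℕ → V
      v-periodic : ∀ i → v (10 + i) ≡ v i
      o-periodic : ∀ i → o (10 + i) ≡ o i
      neighbours : ∀ i w → Adj G (v (suc i)) w → w ≡ v i ⊎ w ≡ v (2 + i) ⊎ w ≡ o (suc i)
      distinct   : ∀ {i j} → i < j → j < 10 + i → v i ≢ v j
      o-off      : ∀ i j → o i ≢ v j

    Blank Filled : Colours → Set
    Blank c = ∀ i → c (v i) ≡ 𝕌
    Filled c = ∀ w → c w ≡ 𝕌 → ∃[ i ] w ≡ v i

    v-period* : ∀ q r → v (q * 10 + r) ≡ v r
    v-period* zero    r = refl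
    v-period* (suc q) r = trans (v-periodic (q * 10 + r)) (v-period* q r)

    o-period* : ∀ q r → o (q * 10 + r) ≡ o r
    o-period* zero    r = refl
    o-period* (suc q) r = trans (o-periodic (q * 10 + r)) (o-period* q r)

    v-mod : ∀ i → v i ≡ v (i % 10)
    v-mod i = trans (cong v (trans (m≡m%n+[m/n]*n i 10) (ℕₚ.+-comm (i % 10) _))) (v-period* (i / 10) (i % 10))

    distinct< : ∀ {i j} → i < 10 → j < 10 → i ≢ j → v i ≢ v j
    distinct< {i} {j} i<10 j<10 i≢j with ℕₚ.<-cmp i j
    ... | tri< lt _ _ = distinct lt (ℕₚ.≤-trans j<10 (ℕₚ.m≤m+n 10 i))
    ... | tri≈ _ eq _ = ⊥-elim (i≢j eq)
    ... | tri> _ _ gt = distinct gt (ℕₚ.≤-trans i<10 (ℕₚ.m≤m+n 10 j)) ∘ sym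

    -- The colouring goes once around from `v 0`, which is put in `𝕀` so that the closing vertex
    -- `v 9` has a neighbour in `𝕀` and can take `𝔽`.
    record Stage (c : Colours) (j : ℕ) (c′ : Colours) : Set where
      field
        valid  : Valid c′
        start  : c′ (v 0) ≡ 𝕀
        done   : ∀ i → i ≤ j → c′ (v i) ≢ 𝕌
        todo   : ∀ i → j < i → i < 10 → c′ (v i) ≡ 𝕌
        off    : ∀ {w} → (∀ i → w ≢ v i) → c′ w ≡ c w

    module _ {c : Colours} (filled : Filled c) where
      stage₀ : Valid c → Blank c → c (o 0) ≡ 𝔽 → Stage c 0 (update c (v 0) 𝕀)
      stage₀ val blank o₀ = record
        { valid = valid-𝕀 (v 0) val λ w vw cw → case neighbours 9 w (subst (λ x → Adj G x w) (sym (v-periodic 0)) vw) of λ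
            { (inj₁ refl) → case trans (sym (blank 9)) cw of λ ()
            ; (inj₂ (inj₁ refl)) → case trans (sym (blank 11)) cw of λ ()
            ; (inj₂ (inj₂ refl)) → case trans (sym o₀) (trans (cong c (sym (o-periodic 0))) cw) of λ () }
        ; start = update-same c (v 0) 𝕀
        ; done = λ { zero _ h → case trans (sym (update-same c (v 0) 𝕀)) h of λ () }
        ; todo = λ i 0<i i<10 → trans (update-other c (v 0) 𝕀 (distinct< i<10 (s≤s z≤n) (ℕₚ.<⇒≢ 0<i ∘ sym))) (blank i)
        ; off = λ h → update-other c (v 0) 𝕀 (h 0)
        }

      advance : ∀ {j c′} x → suc j < 10 → Stage c j c′ → x ≢ 𝕌 → Valid (update c′ (v (suc j)) x) → Stage c (suc j) (update c′ (v (suc j)) x)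
      advance {j} {c′} x sj<10 st x≢𝕌 val = record
        { valid = val
        ; start = trans (update-other c′ (v (suc j)) x (distinct< (s≤s z≤n) sj<10 λ ())) start
        ; done = λ i i≤sj h → case update-cases c′ (v (suc j)) x (v i) of λ
            { (inj₁ (_ , e)) → x≢𝕌 (trans (sym e) h)
            ; (inj₂ (≢ , e)) → case ℕₚ.m≤n⇒m<n∨m≡n i≤sj of λ
                { (inj₁ (s≤s i≤j)) → done i i≤j (trans (sym e) h) ; (inj₂ refl) → ≢ refl } }
        ; todo = λ i sj<i i<10 → trans (update-other c′ (v (suc j)) x (distinct< i<10 sj<10 (ℕₚ.<⇒≢ sj<i ∘ sym)))
                                       (todo i (ℕₚ.<⇒≤ sj<i) i<10)
        ; off = λ h → trans (update-other c′ (v (suc j)) x (h (suc j))) (off h)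
        }
        where open Stage st

      finished : ∀ {c′} → Blank c → Stage c 9 c′ → IFPartitionable G
      finished {c′} blank st = partition valid total
        where
        open Stage st
        total : ∀ w → c′ w ≢ 𝕌
        total w c′w with c w ≟ᶜ 𝕌
        ... | yes cw = let i , w≡ = filled w cw in
              done (i % 10) (ℕₚ.≤-pred (m%n<n i 10)) (trans (cong c′ (sym (trans w≡ (v-mod i)))) c′w)
        ... | no cw≢ = cw≢ (trans (sym (off λ { i refl → cw≢ (blank i) })) c′w)

      -- As `v 10 = v 0` is in `𝕀`, only `v 8` and `o 9` could be two neighbours of `v 9` in `𝔽`;
      -- `safe` rules this out.
      closing : ∀ {c′} → Blank c → Stage c 8 c′ → (c (o 9) ≡ 𝔽 → c′ (v 8) ≢ 𝔽) → IFPartitionable G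
      closing {c′} blank st safe = finished blank (advance 𝔽 ℕₚ.≤-refl st (λ ()) (valid-𝔽 (v 9) valid one))
        where
        open Stage st
        c′o : ∀ {x} → c′ (o 9) ≡ x → c (o 9) ≡ x
        c′o h = trans (sym (off (o-off 9))) h
        start′ : c′ (v 10) ≡ 𝕀
        start′ = trans (cong c′ (v-periodic 0)) start
        one : ∀ {u w} → Adj G (v 9) u → Adj G (v 9) w → c′ u ≡ 𝔽 → c′ w ≡ 𝔽 → u ≡ w
        one {u} {w} vu vw cu cw with neighbours 8 u vu | neighbours 8 w vw
        ... | inj₁ refl | inj₁ refl = refl
        ... | inj₂ (inj₁ refl) | _ = case trans (sym start′) cu of λ ()
        ... | _ | inj₂ (inj₁ refl) = case trans (sym start′) cw of λ ()
        ... | inj₂ (inj₂ refl) | inj₂ (inj₂ refl) = refl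
        ... | inj₁ refl | inj₂ (inj₂ refl) = ⊥-elim (safe (c′o cw) cu)
        ... | inj₂ (inj₂ refl) | inj₁ refl = ⊥-elim (safe (c′o cu) cw)

      -- `o 0` in `𝔽` lets `v 0` take `𝕀`; each of `v 1`, ..., `v 8` sees only its predecessor and
      -- its outer neighbour coloured; and `o 9` in `𝕀` makes `𝔽` safe for `v 9`.
      extend-mixed : Valid c → Blank c → c (o 0) ≡ 𝔽 → c (o 9) ≡ 𝕀 → IFPartitionable G
      extend-mixed val blank o₀ o₉ = closing blank (proj₂ (stages 8 ℕₚ.≤-refl)) λ o₉′ _ → case trans (sym o₉) o₉′ of λ ()
        where
        stages : ∀ j → j ≤ 8 → ∃ (Stage c j)
        stages zero _ = _ , stage₀ val blank o₀
        stages (suc j) sj≤8 with stages j (ℕₚ.<⇒≤ sj≤8)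
        ... | c′ , st with greedy (v (suc j)) {v j} {o (suc j)} (Stage.valid st) (λ w vw cw → case neighbours j w vw of λ
              { (inj₁ e) → inj₁ e ; (inj₂ (inj₂ e)) → inj₂ e
              ; (inj₂ (inj₁ refl)) → ⊥-elim (cw (Stage.todo st (2 + j) (ℕₚ.m≤n⇒m≤1+n ℕₚ.≤-refl) (s≤s (s≤s sj≤8)))) })
        ...   | x , x≢𝕌 , val′ = _ , advance x (s≤s (ℕₚ.m≤n⇒m≤1+n sj≤8)) st x≢𝕌 val′

      parity : ℕ → Colour
      parity zero = 𝕀
      parity (suc zero) = 𝔽
      parity (suc (suc i)) = parity i

      parity≢𝕌 : ∀ i → parity i ≢ 𝕌
      parity≢𝕌 zero ()
      parity≢𝕌 (suc zero) ()
      parity≢𝕌 (suc (suc i)) = parity≢𝕌 i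

      -- Even positions take `𝕀`, odd ones `𝔽`, so a vertex in `𝔽` has only its outer neighbour in
      -- `𝔽`. The evenness of 10 enters at the end: `v 8` and `v 10` are both in `𝕀`.
      extend-alternating : Valid c → Blank c → (∀ i → c (o i) ≡ 𝔽) → IFPartitionable G
      extend-alternating val blank allF = let c′ , st , par = stages 8 ℕₚ.≤-refl in
        closing blank st λ _ h → case trans (sym par) h of λ ()
        where
        stages : ∀ j → j ≤ 8 → ∃[ c′ ] (Stage c j c′ × c′ (v j) ≡ parity j)
        stages zero _ = _ , stage₀ val blank (allF 0) , update-same c (v 0) 𝕀
        stages (suc j) sj≤8 with stages j (ℕₚ.<⇒≤ sj≤8)
        ... | c′ , st , par = update c′ (v (suc j)) (parity (suc j))
                            , advance _ (s≤s (ℕₚ.m≤n⇒m≤1+n sj≤8)) st (parity≢𝕌 (suc j)) (ok (parityCases j))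
                            , update-same c′ (v (suc j)) _
          where
          open Stage st
          parityCases : ∀ j → (parity j ≡ 𝕀 × parity (suc j) ≡ 𝔽) ⊎ (parity j ≡ 𝔽 × parity (suc j) ≡ 𝕀)
          parityCases zero = inj₁ (refl , refl)
          parityCases (suc zero) = inj₂ (refl , refl)
          parityCases (suc (suc j)) = parityCases j
          ahead : c′ (v (2 + j)) ≡ 𝕌
          ahead = todo (2 + j) (ℕₚ.m≤n⇒m≤1+n ℕₚ.≤-refl) (s≤s (s≤s sj≤8))
          out : c′ (o (suc j)) ≡ 𝔽
          out = trans (off (o-off (suc j))) (allF (suc j))
          ok : (parity j ≡ 𝕀 × parity (suc j) ≡ 𝔽) ⊎ (parity j ≡ 𝔽 × parity (suc j) ≡ 𝕀) →
               Valid (update c′ (v (suc j)) (parity (suc j)))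
          ok (inj₁ (p , p′)) rewrite p′ = valid-𝔽 (v (suc j)) valid λ {u} {w} vu vw cu cw → trans (isOut u vu cu) (sym (isOut w vw cw))
            where
            isOut : ∀ w → Adj G (v (suc j)) w → c′ w ≡ 𝔽 → w ≡ o (suc j)
            isOut w vw cw with neighbours j w vw
            ... | inj₁ refl = case trans (sym cw) (trans par p) of λ ()
            ... | inj₂ (inj₁ refl) = case trans (sym cw) ahead of λ ()
            ... | inj₂ (inj₂ e) = e
          ok (inj₂ (p , p′)) rewrite p′ = valid-𝕀 (v (suc j)) valid λ w vw cw → case neighbours j w vw of λ
            { (inj₁ refl) → case trans (sym cw) (trans par p) of λ ()
            ; (inj₂ (inj₁ refl)) → case trans (sym cw) ahead of λ ()
            ; (inj₂ (inj₂ refl)) → case trans (sym cw) out of λ () }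

  shiftBy : ℕ → LowCycle → LowCycle
  shiftBy s L = record
    { v = λ i → v (i + s)
    ; o = λ i → o (i + s)
    ; v-periodic = λ i → v-periodic (i + s)
    ; o-periodic = λ i → o-periodic (i + s)
    ; neighbours = λ i → neighbours (i + s)
    ; distinct = λ i<j j<10+i → distinct (ℕₚ.+-monoˡ-< s i<j) (ℕₚ.+-monoˡ-< s j<10+i)
    ; o-off = λ i j → o-off (i + s) (j + s)
    }
    where open LowCycle L

  module _ (L : LowCycle) where
    open LowCycle L

    filled-shift : ∀ s {c} → Filled c → LowCycle.Filled (shiftBy s L) c
    filled-shift s filled w cw = let i , w≡ = filled w cw in
      -- Modulo 10, moving back by `s` is moving on by `s * 9`.
      i + s * 9 , trans w≡ (trans (sym (v-period* s i)) (cong v (wrap i s)))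
      where
      wrap : ∀ i s → s * 10 + i ≡ i + s * 9 + s
      wrap = solve-∀

    -- Start at an outer neighbour in F that follows one in I and colour greedily around; if all
    -- outer neighbours are in F, alternate along the cycle.
    extend-cycle : ∀ {c} → Valid c → Blank c → Filled c → ∀ i → c (o i) ≢ 𝕀 → IFPartitionable G
    extend-cycle {c} val blank filled i oi with c (o i) in eq
    ... | 𝕀 = ⊥-elim (oi refl)
    ... | 𝕌 = let j , o≡v = filled _ eq in ⊥-elim (o-off i j o≡v)
    ... | 𝔽 with Finₚ.any? {n = 10} (λ k → c (o (toℕ k)) ≟ᶜ 𝕀)
    ...   | no none = extend-alternating filled val blank allF
      where
      allF : ∀ j → c (o j) ≡ 𝔽
      allF j with c (o j) in eqj
      ... | 𝔽 = refl
      ... | 𝕌 = let k , o≡v = filled _ eqj in ⊥-elim (o-off j k o≡v)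
      ... | 𝕀 = ⊥-elim (none (fromℕ< (m%n<n j 10) , trans (cong (c ∘ o) (Finₚ.toℕ-fromℕ< (m%n<n j 10)))
                  (trans (cong c (sym (trans (cong o (trans (m≡m%n+[m/n]*n j 10) (ℕₚ.+-comm (j % 10) _))) (o-period* (j / 10) (j % 10))))) eqj)))
    ...   | yes (k , ok) = fromSwitch (switch (10 + i ∸ toℕ k) (trans (cong (c ∘ o) (ℕₚ.m∸n+n≡m k≤)) (trans (cong c (o-periodic i)) eq)))
      where
      k≤ : toℕ k ≤ 10 + i
      k≤ = ℕₚ.≤-trans (ℕₚ.<⇒≤ (Finₚ.toℕ<n k)) (ℕₚ.m≤m+n 10 i)
      -- On the way from an outer neighbour in `𝕀` to one in `𝔽`, some `𝕀` is followed by `𝔽`. The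
      -- target is taken as `10 + i`, so that it lies beyond `k`.
      switch : ∀ d → c (o (d + toℕ k)) ≡ 𝔽 → ∃[ j ] (c (o j) ≡ 𝕀 × c (o (suc j)) ≡ 𝔽)
      switch zero h = case trans (sym ok) h of λ ()
      switch (suc d) h with c (o (d + toℕ k)) in e
      ... | 𝕀 = d + toℕ k , e , h
      ... | 𝔽 = switch d e
      ... | 𝕌 = let m , o≡v = filled _ e in ⊥-elim (o-off _ m o≡v)
      fromSwitch : ∃[ j ] (c (o j) ≡ 𝕀 × c (o (suc j)) ≡ 𝔽) → IFPartitionable G
      fromSwitch (j , oj , osj) = LowCycle.extend-mixed (shiftBy (suc j) L) (filled-shift (suc j) filled) val
        (λ i → blank (i + suc j)) osj
        (trans (cong (c ∘ o) (ℕₚ.+-suc 9 j)) (trans (cong c (o-periodic j)) oj))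

    -- Extension can only fail if all outer neighbours are in `𝕀`. But `t` has two erased neighbours
    -- on the cycle, so at most `t′` is a neighbour in `𝔽`, and `t` may move to `𝔽`.
    bad-triangle : ∀ {c} i t t′ → Valid c → Blank c → Filled c → o i ≡ t →
                   (∀ w → Adj G t w → w ≡ v i ⊎ w ≡ v (suc i) ⊎ w ≡ t′) → IFPartitionable G
    bad-triangle {c} i t t′ val blank filled refl nbrs with c t ≟ᶜ 𝕀
    ... | no ≢𝕀 = extend-cycle val blank filled i ≢𝕀
    ... | yes ct = extend-cycle (valid-𝔽 t val λ tu tw cu cw → trans (only tu cu) (sym (only tw cw)))
        (λ j → trans (update-other c t 𝔽 (o-off i j ∘ sym)) (blank j))
        (λ w h → case update-cases c t 𝔽 w of λ { (inj₁ (_ , e)) → case trans (sym e) h of λ () ; (inj₂ (_ , e)) → filled w (trans (sym e) h) })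
        i (λ h → case trans (sym (update-same c t 𝔽)) h of λ ())
      where
      only : ∀ {w} → Adj G t w → c w ≡ 𝔽 → w ≡ t′
      only {w} tw cw with nbrs w tw
      ... | inj₁ refl = case trans (sym (blank i)) cw of λ ()
      ... | inj₂ (inj₁ refl) = case trans (sym (blank (suc i))) cw of λ ()
      ... | inj₂ (inj₂ e) = e

    -- The 4-vertex x = o i hangs on the cycle by one triangle and lies in another triangle x q q̂.
    record Hanging (i : ℕ) (q q̂ a : V) : Set where
      field
        x-nbrs : ∀ w → Adj G (o i) w → w ≡ v i ⊎ w ≡ v (suc i) ⊎ w ≡ q ⊎ w ≡ q̂
        q-nbrs : ∀ w → Adj G q w → w ≡ o i ⊎ w ≡ q̂ ⊎ w ≡ a
        xq     : Adj G (o i) q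
        xq̂     : Adj G (o i) q̂
        q-off  : ∀ j → q ≢ v j

    module _ {i q q̂ a} (H : Hanging i q q̂ a) {c} (val : Valid c) (blank : Blank c) (filled : Filled c) (cx : c (o i) ≡ 𝕀) where
      open Hanging H
      private x = o i

      -- Once `q` is in `𝕀`, only `q̂` can be a neighbour of `x` in `𝔽`; so `x` leaves `𝕀`, and the
      -- cycle can be coloured.
      release : ∀ {c′} → Valid c′ → (∀ w → w ≢ x → c w ≢ 𝕌 → c′ w ≢ 𝕌) → Blank c′ → c′ q ≡ 𝕀 → IFPartitionable G
      release {c′} val′ keep blank′ cq = extend-cycle (valid-𝔽 x val′ λ xu xw cu cw → trans (only xu cu) (sym (only xw cw)))
          (λ j → trans (update-other c′ x 𝔽 (o-off i j ∘ sym)) (blank′ j))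
          (λ w h → case update-cases c′ x 𝔽 w of λ
            { (inj₁ (_ , e)) → case trans (sym e) h of λ ()
            ; (inj₂ (w≢x , e)) → case c w ≟ᶜ 𝕌 of λ { (yes cw) → filled w cw ; (no ≢𝕌) → ⊥-elim (keep w w≢x ≢𝕌 (trans (sym e) h)) } })
          i (λ h → case trans (sym (update-same c′ x 𝔽)) h of λ ())
        where
        only : ∀ {w} → Adj G x w → c′ w ≡ 𝔽 → w ≡ q̂
        only {w} xw cw with x-nbrs w xw
        ... | inj₁ refl = case trans (sym (blank′ i)) cw of λ ()
        ... | inj₂ (inj₁ refl) = case trans (sym (blank′ (suc i))) cw of λ ()
        ... | inj₂ (inj₂ (inj₁ refl)) = case trans (sym cq) cw of λ ()
        ... | inj₂ (inj₂ (inj₂ e)) = e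

      q̂≢𝕀 : c q̂ ≢ 𝕀
      q̂≢𝕀 = Valid.independent val xq̂ cx

      -- `x` in `𝕀` keeps `q̂` out of `𝕀`. After `x` is erased, `a` is the only vertex that could
      -- bar `q` from `𝕀`.
      outer-𝕀 : c a ≢ 𝕀 → IFPartitionable G
      outer-𝕀 ca = release val₂ keep blank₂ (update-same c₁ q 𝕀)
        where
        c₁ = update c x 𝕌
        val₁ = valid-𝕌 x val
        c₁≢𝕀 : ∀ {w} → c w ≢ 𝕀 → c₁ w ≢ 𝕀
        c₁≢𝕀 {w} h e with update-cases c x 𝕌 w
        ... | inj₁ (_ , e′) = case trans (sym e′) e of λ ()
        ... | inj₂ (_ , e′) = h (trans (sym e′) e)
        val₂ : Valid (update c₁ q 𝕀)
        val₂ = valid-𝕀 q val₁ λ w qw cw → case q-nbrs w qw of λ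
          { (inj₁ refl) → case trans (sym (update-same c x 𝕌)) cw of λ ()
          ; (inj₂ (inj₁ refl)) → c₁≢𝕀 q̂≢𝕀 cw
          ; (inj₂ (inj₂ refl)) → c₁≢𝕀 ca cw }
        keep : ∀ w → w ≢ x → c w ≢ 𝕌 → update c₁ q 𝕀 w ≢ 𝕌
        keep w w≢x cw e with update-cases c₁ q 𝕀 w
        ... | inj₁ (_ , e′) = case trans (sym e′) e of λ ()
        ... | inj₂ (_ , e′) = cw (trans (sym (trans e′ (update-other c x 𝕌 w≢x))) e)
        blank₂ : Blank (update c₁ q 𝕀)
        blank₂ j = trans (update-other c₁ q 𝕀 (q-off j ∘ sym)) (trans (update-other c x 𝕌 (o-off i j ∘ sym)) (blank j))

      -- The colour 𝕀 of a moves on to b, which frees q and then x.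
      relay : ∀ {b t e} → c a ≡ 𝕀 → c e ≢ 𝕀 →
              (∀ w → Adj G a w → w ≡ q ⊎ w ≡ b ⊎ w ≡ t) → (∀ w → Adj G b w → w ≡ a ⊎ w ≡ t ⊎ w ≡ e) → Adj G a t → Adj G a q →
              t ≢ q → b ≢ q → e ≢ q → b ≢ x → IFPartitionable G
      relay {b} {t} {e} ca ce a-nbrs b-nbrs at aq t≢q b≢q e≢q b≢x = byCase (c b ≟ᶜ 𝕌)
        where
        a≢q : a ≢ q
        a≢q = adj≢ aq
        a-off : ∀ j → a ≢ v j
        a-off j refl = case trans (sym (blank j)) ca of λ ()
        c₁ = update c x 𝕌
        c₂ = update c₁ a 𝕌
        c₃ = update c₂ q 𝕀
        c₂≢𝕀 : ∀ {w} → c w ≢ 𝕀 → c₂ w ≢ 𝕀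
        c₂≢𝕀 {w} h h′ with update-cases c₁ a 𝕌 w | update-cases c x 𝕌 w
        ... | inj₁ (_ , e′) | _ = case trans (sym e′) h′ of λ ()
        ... | inj₂ (_ , e′) | inj₁ (_ , e″) = case trans (sym (trans e′ e″)) h′ of λ ()
        ... | inj₂ (_ , e′) | inj₂ (_ , e″) = h (trans (sym (trans e′ e″)) h′)
        c₂x : c₂ x ≢ 𝕀
        c₂x h with update-cases c₁ a 𝕌 x
        ... | inj₁ (_ , e′) = case trans (sym e′) h of λ ()
        ... | inj₂ (_ , e′) = case trans (sym (trans e′ (update-same c x 𝕌))) h of λ ()
        val₃ : Valid c₃
        val₃ = valid-𝕀 q (valid-𝕌 a (valid-𝕌 x val)) λ w qw cw → case q-nbrs w qw of λ
          { (inj₁ refl) → c₂x cw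
          ; (inj₂ (inj₁ refl)) → c₂≢𝕀 q̂≢𝕀 cw
          ; (inj₂ (inj₂ refl)) → case trans (sym (update-same c₁ a 𝕌)) cw of λ () }
        c₃≢𝕀 : ∀ {w} → w ≢ q → c w ≢ 𝕀 → c₃ w ≢ 𝕀
        c₃≢𝕀 w≢q h h′ = c₂≢𝕀 h (trans (sym (update-other c₂ q 𝕀 w≢q)) h′)
        keep₃ : ∀ w → w ≢ x → w ≢ a → c w ≢ 𝕌 → c₃ w ≢ 𝕌
        keep₃ w w≢x w≢a cw h with update-cases c₂ q 𝕀 w
        ... | inj₁ (_ , e′) = case trans (sym e′) h of λ ()
        ... | inj₂ (_ , e′) = cw (trans (sym (trans e′ (trans (update-other c₁ a 𝕌 w≢a) (update-other c x 𝕌 w≢x)))) h)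
        blank₃ : Blank c₃
        blank₃ j = trans (update-other c₂ q 𝕀 (q-off j ∘ sym))
                     (trans (update-other c₁ a 𝕌 (a-off j ∘ sym)) (trans (update-other c x 𝕌 (o-off i j ∘ sym)) (blank j)))
        conclude : ∀ {c′} → Valid c′ → Blank c′ → c′ q ≡ 𝕀 → c′ b ≢ 𝔽 → (∀ w → w ≢ x → w ≢ a → c w ≢ 𝕌 → c′ w ≢ 𝕌) → IFPartitionable G
        conclude {c′} val′ blank′ cq cb keep′ = release
            (valid-𝔽 a val′ λ au aw cu cw → trans (only au cu) (sym (only aw cw)))
            (λ w w≢x cw h → case update-cases c′ a 𝔽 w of λ
              { (inj₁ (_ , e′)) → case trans (sym e′) h of λ () ; (inj₂ (w≢a , e′)) → keep′ w w≢x w≢a cw (trans (sym e′) h) })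
            (λ j → trans (update-other c′ a 𝔽 (a-off j ∘ sym)) (blank′ j))
            (trans (update-other c′ a 𝔽 (a≢q ∘ sym)) cq)
          where
          only : ∀ {w} → Adj G a w → c′ w ≡ 𝔽 → w ≡ t
          only {w} aw cw with a-nbrs w aw
          ... | inj₁ refl = case trans (sym cq) cw of λ ()
          ... | inj₂ (inj₁ refl) = ⊥-elim (cb cw)
          ... | inj₂ (inj₂ refl) = refl
        byCase : Dec (c b ≡ 𝕌) → IFPartitionable G
        -- `b` may lie on the erased cycle. It then stays uncoloured, which also keeps it from being
        -- a neighbour of `a` in `𝔽`.
        byCase (yes cb) = conclude val₃ blank₃ (update-same c₂ q 𝕀) c₃b keep₃
          where
          c₃b : c₃ b ≢ 𝔽
          c₃b h = case trans (sym h) (trans (update-other c₂ q 𝕀 b≢q) (blanked (update-cases c₁ a 𝕌 b))) of λ ()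
            where
            blanked : (b ≡ a × c₂ b ≡ 𝕌) ⊎ (b ≢ a × c₂ b ≡ c₁ b) → c₂ b ≡ 𝕌
            blanked (inj₁ (_ , e′)) = e′
            blanked (inj₂ (_ , e′)) = trans e′ (trans (update-other c x 𝕌 b≢x) cb)
        byCase (no cb) = conclude val₄
            (λ j → trans (update-other c₃ b 𝕀 (λ { refl → cb (blank j) })) (blank₃ j))
            (trans (update-other c₃ b 𝕀 (b≢q ∘ sym)) (update-same c₂ q 𝕀))
            (λ h → case trans (sym (update-same c₃ b 𝕀)) h of λ ())
            (λ w w≢x w≢a cw h → case update-cases c₃ b 𝕀 w of λ
              { (inj₁ (_ , e′)) → case trans (sym e′) h of λ () ; (inj₂ (_ , e′)) → keep₃ w w≢x w≢a cw (trans (sym e′) h) })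
          where
          val₄ : Valid (update c₃ b 𝕀)
          val₄ = valid-𝕀 b val₃ λ w bw cw → case b-nbrs w bw of λ
            { (inj₁ refl) → case trans (sym (trans (update-other c₂ q 𝕀 a≢q) (update-same c₁ a 𝕌))) cw of λ ()
            ; (inj₂ (inj₁ refl)) → c₃≢𝕀 t≢q (Valid.independent val at ca) cw
            ; (inj₂ (inj₂ refl)) → c₃≢𝕀 e≢q ce cw }

module _ (G : Graph) (R : RotationSystem G) {a b : Fin (Graph.n G)} (ab : Adj G a b) where
  open Colouring G
  open EdgeDeletion G R a b ab

  -- The end `a` of the deleted edge is erased, so edges between coloured vertices all belong to
  -- `G′`.
  restrict : IFPartitionable G′ → (inC : Fin (Graph.n G) → Bool) → inC a ≡ true →
             ∃[ c ] (Valid c × (∀ w → inC w ≡ true → c w ≡ 𝕌) × (∀ w → c w ≡ 𝕌 → inC w ≡ true))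
  restrict (χ , indep , forest) inC a∈C = c , record { independent = independent ; acyclic = acyclic } , c-in , c-𝕌
    where
    c : Colours
    c w = if inC w then 𝕌 else if χ w then 𝕀 else 𝔽
    c-in : ∀ w → inC w ≡ true → c w ≡ 𝕌
    c-in w h rewrite h = refl
    c-𝕌 : ∀ w → c w ≡ 𝕌 → inC w ≡ true
    c-𝕌 w h with inC w | χ w
    ... | true | _ = refl
    c-𝕌 w () | false | true
    c-𝕌 w () | false | false
    c-𝕀 : ∀ {w} → c w ≡ 𝕀 → inC w ≡ false × T (χ w)
    c-𝕀 {w} h with inC w | χ w
    ... | false | true = refl , tt
    c-𝕀 () | false | false
    c-𝕀 () | true | _
    c-𝔽 : ∀ {w} → c w ≡ 𝔽 → inC w ≡ false × T (not (χ w))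
    c-𝔽 {w} h with inC w | χ w
    ... | false | false = refl , tt
    c-𝔽 () | false | true
    c-𝔽 () | true | _
    survives : ∀ {u w} → Adj G u w → inC u ≡ false → inC w ≡ false → Adj G′ u w
    survives uw u∉ w∉ = adj′⁺ uw (λ e → true-false (trans (cong inC (cong proj₁ e)) a∈C) u∉)
                                 (λ e → true-false (trans (cong inC (cong proj₂ e)) a∈C) w∉)
    independent : ∀ {u w} → Adj G u w → c u ≡ 𝕀 → c w ≢ 𝕀
    independent {u} {w} uw cu cw = let u∉ , χu = c-𝕀 {u} cu ; w∉ , χw = c-𝕀 {w} cw in indep u w (survives uw u∉ w∉) χu χw
    acyclic : ∀ k → ¬ Cycle (Fin (Graph.n G)) (forestAdj c) k
    acyclic k C = forest k (record
      { len≥3 = Cycle.len≥3 C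
      ; vert = λ i → Cycle.vert C i , proj₂ (c-𝔽 (proj₁ (proj₂ (forestAdj⁻ c (Cycle.edge C i)))))
      ; inj = λ eq → Cycle.inj C (cong proj₁ eq)
      ; edge = λ i → let uw , cu , cw = forestAdj⁻ c (Cycle.edge C i) in survives uw (proj₁ (c-𝔽 cu)) (proj₁ (c-𝔽 cw)) })

  low-degree : IFPartitionable G′ → ∀ p q → (∀ w → Adj G a w → w ≡ p ⊎ w ≡ q) → IFPartitionable G
  low-degree if p q nbrs =
    let c , val , c-in , c-𝕌 = restrict if (λ w → does (w Finₚ.≟ a)) (true-dec (a Finₚ.≟ a) refl)
        x , x≢𝕌 , val′ = greedy a {p} {q} val (λ w aw _ → nbrs w aw)
    in partition val′ λ w h → case update-cases c a x w of λ
         { (inj₁ (_ , e)) → x≢𝕌 (trans (sym e) h)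
         ; (inj₂ (w≢a , e)) → w≢a (dec-true (w Finₚ.≟ a) (c-𝕌 w (trans (sym e) h))) }

-- Certified case distinctions on closed walks

record Sparse (G : Graph) : Set where
  field
    no4  : ¬ HasCycleOfLength G 4
    no7  : ¬ HasCycleOfLength G 7
    no9  : ¬ HasCycleOfLength G 9
    no53 : ∀ (C : HasCycleOfLength G 5) (D : HasCycleOfLength G 3) → ¬ NormallyAdjacent C D

Pair : Set
Pair = ℕ × ℕ

-- Knowledge about vertices named by numbers: pairs that are adjacent, and
-- lists of pairs whose two members do not all coincide.
record Facts : Set where
  constructor facts
  field
    adjacent : List Pair
    clauses  : List (List Pair)
open Facts

-- A refutation of some facts: a forbidden cycle, a 5-cycle with a triangle on
-- its first edge, or a case distinction on whether two names coincide.
data Cert : Set where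
  absurd : Cert
  cycle  : List ℕ → Cert
  house  : ℕ → ℕ → ℕ → ℕ → ℕ → ℕ → Cert
  split  : ℕ → ℕ → Cert → Cert → Cert

rename : ℕ → ℕ → ℕ → ℕ
rename i j x = if x ≡ᵇ j then i else x

renamePair : ℕ → ℕ → Pair → Pair
renamePair i j (x , y) = rename i j x , rename i j y

merge : ℕ → ℕ → Facts → Facts
merge i j (facts E C) = facts (map (renamePair i j) E) (map (map (renamePair i j)) C)

separate : ℕ → ℕ → Facts → Facts
separate i j (facts E C) = facts E (((i , j) ∷ []) ∷ C)

hasEdge : Facts → ℕ → ℕ → Bool
hasEdge F i j = any (λ (x , y) → ((x ≡ᵇ i) ∧ (y ≡ᵇ j)) ∨ ((x ≡ᵇ j) ∧ (y ≡ᵇ i))) (adjacent F)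

-- Unit propagation: a clause whose pairs are all trivial or equal to `i`, `j` says that `i` and `j`
-- name different vertices.
apart : ℕ → ℕ → List Pair → Bool
apart i j = all λ (x , y) → (x ≡ᵇ y) ∨ (((x ≡ᵇ i) ∧ (y ≡ᵇ j)) ∨ ((x ≡ᵇ j) ∧ (y ≡ᵇ i)))

distinct? : Facts → ℕ → ℕ → Bool
distinct? F i j = hasEdge F i j ∨ any (apart i j) (clauses F)

allDistinct? : Facts → List ℕ → Bool
allDistinct? F []       = true
allDistinct? F (x ∷ xs) = all (distinct? F x) xs ∧ allDistinct? F xs

closed? : Facts → List ℕ → Bool
closed? F xs = all (λ i → hasEdge F (List.lookup xs i) (List.lookup xs (next i))) (allFin (length xs))

isCycle? : Facts → List ℕ → Bool
isCycle? F xs = allDistinct? F xs ∧ closed? F xs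

contradictory? : Facts → Bool
contradictory? (facts E C) = any (uncurry _≡ᵇ_) E ∨ any (all (uncurry _≡ᵇ_)) C

forbiddenLength : ℕ → Bool
forbiddenLength k = (k ≡ᵇ 4) ∨ (k ≡ᵇ 7) ∨ (k ≡ᵇ 9)

-- Opaque, so that certificates are evaluated only where `check` is unfolded on purpose.
opaque
  check : Facts → Cert → Bool
  check F absurd = contradictory? F
  check F (cycle xs) = forbiddenLength (length xs) ∧ isCycle? F xs
  check F (house a b c d e z) = isCycle? F (a ∷ b ∷ c ∷ d ∷ e ∷ []) ∧ isCycle? F (a ∷ b ∷ z ∷ []) ∧
                                all (distinct? F z) (a ∷ b ∷ c ∷ d ∷ e ∷ [])
  check F (split i j p q) = check (merge i j F) p ∧ check (separate i j F) q

addEdge : ℕ → ℕ → Facts → Facts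
addEdge i j (facts E C) = facts ((i , j) ∷ E) C

opaque
  -- Each separation established is available to the later certificates, so their order matters. An
  -- entry whose certificate fails is skipped, which keeps the result sound.
  saturate : Facts → List (ℕ × ℕ × Cert) → Facts
  saturate F [] = F
  saturate F ((i , j , p) ∷ ps) = saturate (if check (merge i j F) p then separate i j F else F) ps

any⁻ : ∀ {A : Set} (p : A → Bool) {P : A → Set} xs → All P xs → any p xs ≡ true → ∃[ x ] (p x ≡ true × P x)
any⁻ p (x ∷ xs) (px ∷ pxs) h with p x in eq
... | true  = x , eq , px
... | false = any⁻ p xs pxs h

all⁻ : ∀ {A : Set} (p : A → Bool) xs → all p xs ≡ true → ∀ i → p (List.lookup xs i) ≡ true
all⁻ p (x ∷ xs) h zero    = proj₁ (∧-≡ h)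
all⁻ p (x ∷ xs) h (suc i) = all⁻ p xs (proj₂ (∧-≡ {p x} h)) i

∨-≡ : ∀ {a b} → a ∨ b ≡ true → a ≡ true ⊎ b ≡ true
∨-≡ {true}  _ = inj₁ refl
∨-≡ {false} h = inj₂ h

≡ᵇ⇒≡ : ∀ {i j} → (i ≡ᵇ j) ≡ true → i ≡ j
≡ᵇ⇒≡ {i} {j} h = ℕₚ.≡ᵇ⇒≡ i j (≡⇒T h)

module Soundness (G : Graph) (S : Sparse G) where
  open Graph G hiding (sym)
  open Sparse S
  open Connectivity G using (adj-sym; adj≢)

  module _ (ρ : ℕ → Fin n) where
    Coincide : Pair → Set
    Coincide (x , y) = ρ x ≡ ρ y

    Joined : Pair → Set
    Joined (x , y) = Adj G (ρ x) (ρ y)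

    Refuted : List Pair → Set
    Refuted c = ¬ All Coincide c

    record Holds (F : Facts) : Set where
      constructor holds
      field
        joined  : All Joined (adjacent F)
        refuted : All Refuted (clauses F)
    open Holds

    same-pair : ∀ {x y i j} → ((x ≡ᵇ i) ∧ (y ≡ᵇ j)) ∨ ((x ≡ᵇ j) ∧ (y ≡ᵇ i)) ≡ true → (x ≡ i × y ≡ j) ⊎ (x ≡ j × y ≡ i)
    same-pair {x} {y} {i} {j} h with ∨-≡ h
    ... | inj₁ h′ = let p , q = ∧-≡ {x ≡ᵇ i} h′ in inj₁ (≡ᵇ⇒≡ p , ≡ᵇ⇒≡ q)
    ... | inj₂ h′ = let p , q = ∧-≡ {x ≡ᵇ j} h′ in inj₂ (≡ᵇ⇒≡ p , ≡ᵇ⇒≡ q)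

    hasEdge⁻ : ∀ {F i j} → Holds F → hasEdge F i j ≡ true → Adj G (ρ i) (ρ j)
    hasEdge⁻ {F} {i} {j} H h with any⁻ _ (adjacent F) (joined H) h
    ... | (x , y) , eq , xy with same-pair {x} {y} {i} {j} eq
    ...   | inj₁ (refl , refl) = xy
    ...   | inj₂ (refl , refl) = adj-sym xy

    distinct?⁻ : ∀ {F i j} → Holds F → distinct? F i j ≡ true → ρ i ≢ ρ j
    distinct?⁻ {F} {i} {j} H h with ∨-≡ {hasEdge F i j} h
    ... | inj₁ e = adj≢ (hasEdge⁻ {F} H e)
    ... | inj₂ c with any⁻ (apart i j) (clauses F) (refuted H) c
    ...   | ps , eq , ¬c = λ e → ¬c (coincide e ps eq)
      where
      coincide : ρ i ≡ ρ j → ∀ ps → apart i j ps ≡ true → All Coincide ps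
      coincide e [] _ = []
      coincide e ((x , y) ∷ ps) h with ∧-≡ h
      ... | h₁ , h₂ with ∨-≡ {x ≡ᵇ y} h₁
      ...   | inj₁ x≡y = cong ρ (≡ᵇ⇒≡ x≡y) ∷ coincide e ps h₂
      ...   | inj₂ h₃ with same-pair {x} {y} {i} {j} h₃
      ...     | inj₁ (refl , refl) = e ∷ coincide e ps h₂
      ...     | inj₂ (refl , refl) = sym e ∷ coincide e ps h₂

    allDistinct?⁻ : ∀ {F} xs → Holds F → allDistinct? F xs ≡ true → ∀ {i j} → ρ (List.lookup xs i) ≡ ρ (List.lookup xs j) → i ≡ j
    allDistinct?⁻ (x ∷ xs) H h {zero}  {zero}  e = refl
    allDistinct?⁻ {F} (x ∷ xs) H h {zero}  {suc j} e = ⊥-elim (distinct?⁻ {F} H (all⁻ (distinct? F x) xs (proj₁ (∧-≡ h)) j) e)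
    allDistinct?⁻ {F} (x ∷ xs) H h {suc i} {zero}  e = ⊥-elim (distinct?⁻ {F} H (all⁻ (distinct? F x) xs (proj₁ (∧-≡ h)) i) (sym e))
    allDistinct?⁻ {F} (x ∷ xs) H h {suc i} {suc j} e = cong suc (allDistinct?⁻ xs H (proj₂ (∧-≡ {all (distinct? F x) xs} h)) e)

    buildCycle : ∀ {F} xs → 3 ≤ length xs → Holds F → isCycle? F xs ≡ true → HasCycleOfLength G (length xs)
    buildCycle {F} xs 3≤ H h = record
      { len≥3 = 3≤
      ; vert = λ i → ρ (List.lookup xs i)
      ; inj = λ {i} {j} → allDistinct?⁻ xs H (proj₁ (∧-≡ h)) {i} {j}
      ; edge = λ i → hasEdge⁻ {F} H (all-allFin⁻ (λ i → hasEdge F (List.lookup xs i) (List.lookup xs (next i)))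
                                       (proj₂ (∧-≡ {allDistinct? F xs} h)) i)
      }

    ofLength : ∀ {F} k xs → 3 ≤ k → Holds F → isCycle? F xs ≡ true → (length xs ≡ᵇ k) ≡ true → HasCycleOfLength G k
    ofLength {F} k xs 3≤k H c h with ≡ᵇ⇒≡ {length xs} h
    ... | refl = buildCycle {F} xs 3≤k H c

    no-forbidden : ∀ {F} xs → Holds F → forbiddenLength (length xs) ≡ true → isCycle? F xs ≡ true → ⊥
    no-forbidden {F} xs H l c with ∨-≡ {length xs ≡ᵇ 4} l
    ... | inj₁ e = no4 (ofLength {F} 4 xs (ℕₚ.m≤m+n 3 1) H c e)
    ... | inj₂ l′ with ∨-≡ {length xs ≡ᵇ 7} l′
    ...   | inj₁ e = no7 (ofLength {F} 7 xs (ℕₚ.m≤m+n 3 4) H c e)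
    ...   | inj₂ e = no9 (ofLength {F} 9 xs (ℕₚ.m≤m+n 3 6) H c e)

    rename≡ : ∀ {i j} → ρ i ≡ ρ j → ∀ x → ρ (rename i j x) ≡ ρ x
    rename≡ {i} {j} e x with x ≡ᵇ j in eq
    ... | true  = trans e (cong ρ (sym (≡ᵇ⇒≡ eq)))
    ... | false = refl

    merge-holds : ∀ {F i j} → ρ i ≡ ρ j → Holds F → Holds (merge i j F)
    merge-holds {F} {i} {j} e (holds E C) = holds
      (Allₚ.map⁺ (All.map (λ {(x , y)} → subst₂ (Adj G) (sym (rename≡ e x)) (sym (rename≡ e y))) E))
      (Allₚ.map⁺ (All.map (λ ¬c c → ¬c (All.map (λ {(x , y)} h → trans (sym (rename≡ e x)) (trans h (rename≡ e y))) (Allₚ.map⁻ c))) C))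

    separate-holds : ∀ {F i j} → ρ i ≢ ρ j → Holds F → Holds (separate i j F)
    separate-holds ne (holds E C) = holds E ((λ { (e ∷ []) → ne e }) ∷ C)

    no-house : ∀ {F} a b c d e z → Holds F → isCycle? F (a ∷ b ∷ c ∷ d ∷ e ∷ []) ≡ true → isCycle? F (a ∷ b ∷ z ∷ []) ≡ true →
               all (distinct? F z) (a ∷ b ∷ c ∷ d ∷ e ∷ []) ≡ true → ⊥
    no-house {F} a b c d e z H h₁ h₂ h₃ =
      no53 C₅ C₃ (ρ a , ρ b , adj≢ (Cycle.edge C₅ zero)
        , ((zero , refl) , (zero , refl)) , ((suc zero , refl) , (suc zero , refl))
        , common , (zero , inj₁ (refl , refl)) , (zero , inj₁ (refl , refl)))
      where
      five = a ∷ b ∷ c ∷ d ∷ e ∷ []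
      C₅ = buildCycle {F} five (s≤s (s≤s (s≤s z≤n))) H h₁
      C₃ = buildCycle {F} (a ∷ b ∷ z ∷ []) (s≤s (s≤s (s≤s z≤n))) H h₂
      z≢ : ∀ i → ρ z ≢ ρ (List.lookup five i)
      z≢ i = distinct?⁻ {F} H (all⁻ (distinct? F z) five h₃ i)
      common : ∀ w → OnCycle C₅ w → OnCycle C₃ w → w ≡ ρ a ⊎ w ≡ ρ b
      common w _ (zero , refl) = inj₁ refl
      common w _ (suc zero , refl) = inj₂ refl
      common w (i , e) (suc (suc zero) , refl) = ⊥-elim (z≢ i (sym e))

    opaque
      unfolding check

      -- In `split`, the first certificate refutes that the two names coincide; the second may then
      -- assume that they differ.
      refute : ∀ {F} p → Holds F → check F p ≡ true → ⊥
      refute {F} absurd (holds E C) h with ∨-≡ {any (uncurry _≡ᵇ_) (adjacent F)} h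
      ... | inj₁ e with any⁻ (uncurry _≡ᵇ_) (adjacent F) E e
      ...   | (x , y) , eq , xy = adj≢ xy (cong ρ (≡ᵇ⇒≡ eq))
      refute {F} absurd (holds E C) h | inj₂ c with any⁻ (all (uncurry _≡ᵇ_)) (clauses F) C c
      ...   | ps , eq , ¬c = ¬c (coincide ps eq)
        where
        coincide : ∀ ps → all (uncurry _≡ᵇ_) ps ≡ true → All Coincide ps
        coincide [] _ = []
        coincide ((x , y) ∷ ps) h = cong ρ (≡ᵇ⇒≡ (proj₁ (∧-≡ h))) ∷ coincide ps (proj₂ (∧-≡ {x ≡ᵇ y} h))
      refute {F} (cycle xs) H h = let l , c = ∧-≡ h in no-forbidden {F} xs H l c
      refute {F} (house a b c d e z) H h =
        let h₁ , h′ = ∧-≡ {isCycle? F (a ∷ b ∷ c ∷ d ∷ e ∷ [])} h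
            h₂ , h₃ = ∧-≡ {isCycle? F (a ∷ b ∷ z ∷ [])} h′
        in no-house {F} a b c d e z H h₁ h₂ h₃
      refute {F} (split i j p q) H h = let h₁ , h₂ = ∧-≡ {check (merge i j F) p} h in
        refute {separate i j F} q (separate-holds {F} (λ e → refute {merge i j F} p (merge-holds {F} e H) h₁) H) h₂

    opaque
      unfolding saturate

      saturate-holds : ∀ {F} ps → Holds F → Holds (saturate F ps)
      saturate-holds [] H = H
      saturate-holds {F} ((i , j , p) ∷ ps) H with check (merge i j F) p in eq
      ... | true  = saturate-holds {separate i j F} ps (separate-holds {F} (λ e → refute {merge i j F} p (merge-holds {F} e H) eq) H)
      ... | false = saturate-holds {F} ps H

table : ∀ {A : Set} → ℕ → (ℕ → A) → List A
table zero    f = []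
table (suc k) f = f k ∷ table k f

table⁺ : ∀ {A : Set} {P : A → Set} k {f : ℕ → A} → (∀ i → i < k → P (f i)) → All P (table k f)
table⁺ zero    h = []
table⁺ (suc k) h = h k ℕₚ.≤-refl ∷ table⁺ k λ i i<k → h i (ℕₚ.m≤n⇒m≤1+n i<k)

opaque
  allBelow : ℕ → (ℕ → Bool) → Bool
  allBelow zero    p = true
  allBelow (suc k) p = p k ∧ allBelow k p

  allBelow⁻ : ∀ {k p} → allBelow k p ≡ true → ∀ {i} → i < k → p i ≡ true
  allBelow⁻ {suc k} {p} h {i} (s≤s i≤k) with ℕₚ.m≤n⇒m<n∨m≡n i≤k
  ... | inj₁ i<k  = allBelow⁻ (proj₂ (∧-≡ {p k} h)) i<k
  ... | inj₂ refl = proj₁ (∧-≡ h)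

-- The default is harmless, since `absurd` is checked like any other certificate.
lookupCert : List (ℕ × ℕ × Cert) → ℕ → ℕ → Cert
lookupCert [] i j = absurd
lookupCert ((x , y , p) ∷ ps) i j = if (x ≡ᵇ i) ∧ (y ≡ᵇ j) then p else lookupCert ps i j

wrap : ℕ → ℕ → ℕ
wrap ℓ i = if i <ᵇ ℓ then i else i ∸ ℓ

-- In the facts on a closed walk with a triangle on its first edge, 0 names the
-- apex of the triangle and suc i the i-th vertex of the walk.
closedEdges : ℕ → List Pair
closedEdges ℓ = table ℓ λ i → suc i , suc (wrap ℓ (suc i))

turns : ℕ → List (List Pair)
turns ℓ = table ℓ λ i → (suc i , suc (wrap ℓ (2 + i))) ∷ []

-- The clauses say, in this order: the third and the last vertex of the walk are not the apex; no
-- step is reversed at once; the walk never goes from `w 1` to `w 0`, nor from `w 1` over the apex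
-- to `w 0`. The last two would be stretches of the triangular face.
triangleFacts : ℕ → Facts
triangleFacts ℓ = facts
  ((1 , 0) ∷ (2 , 0) ∷ closedEdges ℓ)
  (((3 , 0) ∷ []) ∷ ((ℓ , 0) ∷ []) ∷ turns ℓ
    ++ table ℓ (λ i → (2 , suc i) ∷ (1 , suc (wrap ℓ (suc i))) ∷ [])
    ++ table ℓ (λ i → (2 , suc i) ∷ (0 , suc (wrap ℓ (suc i))) ∷ (1 , suc (wrap ℓ (2 + i))) ∷ []))

allPairs : ℕ → List (List Pair)
allPairs zero    = []
allPairs (suc k) = table k (λ i → (i , k) ∷ []) ++ allPairs k

-- The starting point for excluding chords, after saturation has shown that the apex and the ten
-- vertices all differ.
apartFacts : Facts
apartFacts = facts ((1 , 0) ∷ (2 , 0) ∷ closedEdges 10) (allPairs 11)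

walkFacts : ℕ → Facts
walkFacts ℓ = facts (table ℓ λ i → i , wrap ℓ (suc i)) (table ℓ λ i → (i , wrap ℓ (2 + i)) ∷ [])

consecutive : ℕ → ℕ → Bool
consecutive i j = (wrap 10 (suc i) ≡ᵇ j) ∨ (wrap 10 (suc j) ≡ᵇ i)

-- The certificates below were found by a computer search.
walk7-cert : Cert
walk7-cert = split 0 3 (cycle (0 ∷ 4 ∷ 5 ∷ 6 ∷ [])) (split 0 4 (cycle (0 ∷ 1 ∷ 2 ∷ 3 ∷ [])) (split 1 4 (cycle (0 ∷ 1 ∷ 5 ∷ 6 ∷ []))
  (split 1 5 (cycle (1 ∷ 2 ∷ 3 ∷ 4 ∷ [])) (split 2 5 (cycle (0 ∷ 1 ∷ 2 ∷ 6 ∷ [])) (split 2 6 (cycle (2 ∷ 3 ∷ 4 ∷ 5 ∷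
  [])) (split 3 6 (cycle (0 ∷ 1 ∷ 2 ∷ 3 ∷ [])) (cycle (0 ∷ 1 ∷ 2 ∷ 3 ∷ 4 ∷ 5 ∷ 6 ∷ []))))))))

-- A pentagon and a hexagon with a common edge bound a cycle of length 5 + 6 - 2 = 9 if nothing else
-- coincides.
p6-cert : Cert
p6-cert = split 0 7 (split 3 8 (cycle (0 ∷ 1 ∷ 2 ∷ 3 ∷ [])) (split 4 8 (cycle (1 ∷ 2 ∷ 3 ∷ 4 ∷ [])) (house 0 1 2 3 4 8))) (split
  4 8 (cycle (1 ∷ 2 ∷ 3 ∷ 4 ∷ [])) (split 4 7 (cycle (0 ∷ 1 ∷ 8 ∷ 4 ∷ [])) (split 4 6 (split 5 8 (cycle (0 ∷ 1 ∷ 5 ∷ 4 ∷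
  [])) (house 4 0 1 8 7 5)) (split 3 8 (cycle (0 ∷ 1 ∷ 3 ∷ 4 ∷ [])) (split 3 7 (cycle (1 ∷ 2 ∷ 3 ∷ 8 ∷ [])) (split 3 6
  (cycle (0 ∷ 4 ∷ 3 ∷ 5 ∷ [])) (split 3 5 (cycle (0 ∷ 1 ∷ 2 ∷ 3 ∷ [])) (split 2 7 (house 1 2 3 4 0 8) (split 2 6 (cycle
  (0 ∷ 1 ∷ 2 ∷ 5 ∷ [])) (split 2 5 (cycle (0 ∷ 2 ∷ 3 ∷ 4 ∷ [])) (split 1 6 (house 0 1 2 3 4 5) (split 5 8 (house 0 1 2 3
  4 5) (cycle (0 ∷ 4 ∷ 3 ∷ 2 ∷ 1 ∷ 8 ∷ 7 ∷ 6 ∷ 5 ∷ []))))))))))))))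

-- Three pentagons around a vertex of degree 3 bound a cycle of length 15 - 6 = 9 if nothing else
-- coincides.
ppp-cert : Cert
ppp-cert = split 1 6 (cycle (0 ∷ 1 ∷ 7 ∷ 3 ∷ [])) (split 1 7 (cycle (0 ∷ 1 ∷ 6 ∷ 2 ∷ [])) (split 4 6 (cycle (0 ∷ 1 ∷ 4 ∷ 2 ∷ []))
  (split 4 7 (cycle (0 ∷ 1 ∷ 4 ∷ 3 ∷ [])) (split 3 4 (cycle (0 ∷ 2 ∷ 5 ∷ 3 ∷ [])) (split 4 8 (cycle (0 ∷ 1 ∷ 4 ∷ 3 ∷
  [])) (split 5 7 (cycle (0 ∷ 2 ∷ 5 ∷ 3 ∷ [])) (split 3 5 (cycle (0 ∷ 1 ∷ 4 ∷ 3 ∷ [])) (split 5 8 (cycle (0 ∷ 2 ∷ 5 ∷ 3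
  ∷ [])) (split 5 9 (cycle (0 ∷ 1 ∷ 5 ∷ 2 ∷ [])) (split 2 8 (cycle (0 ∷ 1 ∷ 9 ∷ 2 ∷ [])) (split 2 9 (cycle (0 ∷ 2 ∷ 8 ∷
  3 ∷ [])) (split 6 8 (cycle (0 ∷ 2 ∷ 6 ∷ 3 ∷ [])) (split 6 9 (cycle (0 ∷ 1 ∷ 6 ∷ 2 ∷ [])) (split 7 9 (cycle (0 ∷ 1 ∷ 7
  ∷ 3 ∷ [])) (cycle (1 ∷ 4 ∷ 5 ∷ 2 ∷ 6 ∷ 7 ∷ 3 ∷ 8 ∷ 9 ∷ []))))))))))))))))

-- A detour over the apex lengthens a cycle by one: lengths 6 and 8 give the forbidden 7 and 9,
-- while a pentagon is normally adjacent to the triangle. A walk of length 9 is itself forbidden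
-- unless it repeats a vertex, and these repetitions make up its certificate.
triangle5-cert : Cert
triangle5-cert = split 0 4 (cycle (0 ∷ 1 ∷ 2 ∷ 3 ∷ [])) (house 1 2 3 4 5 0)

triangle6-cert : Cert
triangle6-cert = split 0 5 (cycle (0 ∷ 2 ∷ 1 ∷ 6 ∷ [])) (split 0 4 (cycle (0 ∷ 1 ∷ 2 ∷ 3 ∷ [])) (split 1 4 (cycle (0 ∷ 1 ∷ 3 ∷ 2 ∷ []))
  (split 3 6 (cycle (0 ∷ 1 ∷ 3 ∷ 2 ∷ [])) (split 2 5 (cycle (0 ∷ 1 ∷ 6 ∷ 2 ∷ [])) (cycle (0 ∷ 1 ∷ 6 ∷ 5 ∷ 4 ∷ 3 ∷ 2 ∷
  []))))))

triangle8-cert : Cert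
triangle8-cert = split 0 7 (cycle (0 ∷ 2 ∷ 1 ∷ 8 ∷ [])) (split 0 6 (cycle (0 ∷ 1 ∷ 8 ∷ 7 ∷ [])) (split 0 5 (cycle (0 ∷ 2 ∷ 3 ∷ 4 ∷ []))
  (split 0 4 (cycle (0 ∷ 1 ∷ 2 ∷ 3 ∷ [])) (split 1 6 (house 1 2 3 4 5 0) (split 1 5 (cycle (1 ∷ 2 ∷ 3 ∷ 4 ∷ [])) (split
  1 4 (cycle (0 ∷ 1 ∷ 3 ∷ 2 ∷ [])) (split 5 8 (house 1 2 3 4 5 0) (split 4 8 (cycle (1 ∷ 2 ∷ 3 ∷ 4 ∷ [])) (split 3 8
  (cycle (0 ∷ 1 ∷ 3 ∷ 2 ∷ [])) (split 4 7 (house 1 2 3 4 8 0) (split 3 7 (cycle (1 ∷ 2 ∷ 3 ∷ 8 ∷ [])) (split 2 7 (cycle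
  (0 ∷ 1 ∷ 8 ∷ 2 ∷ [])) (split 3 6 (house 1 2 3 7 8 0) (split 2 6 (cycle (1 ∷ 2 ∷ 7 ∷ 8 ∷ [])) (split 2 5 (house 1 2 6 7
  8 0) (cycle (0 ∷ 1 ∷ 8 ∷ 7 ∷ 6 ∷ 5 ∷ 4 ∷ 3 ∷ 2 ∷ [])))))))))))))))))

triangle9-cert : Cert
triangle9-cert = split 1 4 (cycle (0 ∷ 1 ∷ 3 ∷ 2 ∷ [])) (split 1 5 (cycle (1 ∷ 2 ∷ 3 ∷ 4 ∷ [])) (split 1 6 (cycle (1 ∷ 7 ∷ 8 ∷ 9 ∷ []))
  (split 1 7 (split 0 6 (house 0 2 3 4 5 1) (split 0 5 (cycle (0 ∷ 2 ∷ 1 ∷ 6 ∷ [])) (split 0 4 (cycle (0 ∷ 1 ∷ 2 ∷ 3 ∷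
  [])) (split 3 6 (cycle (0 ∷ 1 ∷ 3 ∷ 2 ∷ [])) (split 2 5 (cycle (0 ∷ 1 ∷ 6 ∷ 2 ∷ [])) (cycle (0 ∷ 1 ∷ 6 ∷ 5 ∷ 4 ∷ 3 ∷ 2
  ∷ []))))))) (split 2 5 (split 0 8 (cycle (0 ∷ 2 ∷ 1 ∷ 9 ∷ [])) (split 0 7 (cycle (0 ∷ 1 ∷ 2 ∷ 6 ∷ [])) (split 0 6
  (split 2 8 (cycle (0 ∷ 1 ∷ 2 ∷ 7 ∷ [])) (house 0 1 9 8 7 2)) (split 6 9 (cycle (0 ∷ 1 ∷ 6 ∷ 2 ∷ [])) (split 2 8 (cycle
  (0 ∷ 1 ∷ 9 ∷ 2 ∷ [])) (cycle (0 ∷ 1 ∷ 9 ∷ 8 ∷ 7 ∷ 6 ∷ 2 ∷ []))))))) (split 2 6 (cycle (2 ∷ 3 ∷ 4 ∷ 5 ∷ [])) (split 2 7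
  (cycle (1 ∷ 2 ∷ 8 ∷ 9 ∷ [])) (split 2 8 (cycle (0 ∷ 1 ∷ 9 ∷ 2 ∷ [])) (split 3 6 (split 0 8 (cycle (0 ∷ 2 ∷ 1 ∷ 9 ∷
  [])) (split 0 7 (cycle (0 ∷ 1 ∷ 2 ∷ 3 ∷ [])) (split 3 9 (cycle (0 ∷ 1 ∷ 3 ∷ 2 ∷ [])) (cycle (0 ∷ 1 ∷ 9 ∷ 8 ∷ 7 ∷ 3 ∷ 2
  ∷ []))))) (split 3 7 (cycle (3 ∷ 4 ∷ 5 ∷ 6 ∷ [])) (split 3 8 (cycle (1 ∷ 2 ∷ 3 ∷ 9 ∷ [])) (split 3 9 (cycle (0 ∷ 1 ∷ 3
  ∷ 2 ∷ [])) (split 4 7 (split 0 8 (cycle (0 ∷ 2 ∷ 1 ∷ 9 ∷ [])) (split 0 4 (cycle (0 ∷ 1 ∷ 2 ∷ 3 ∷ [])) (cycle (0 ∷ 1 ∷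
  9 ∷ 8 ∷ 4 ∷ 3 ∷ 2 ∷ [])))) (split 4 8 (cycle (4 ∷ 5 ∷ 6 ∷ 7 ∷ [])) (split 4 9 (cycle (1 ∷ 2 ∷ 3 ∷ 4 ∷ [])) (split 5 8
  (split 0 5 (cycle (0 ∷ 2 ∷ 1 ∷ 9 ∷ [])) (split 0 4 (cycle (0 ∷ 1 ∷ 2 ∷ 3 ∷ [])) (cycle (0 ∷ 1 ∷ 9 ∷ 5 ∷ 4 ∷ 3 ∷ 2 ∷
  [])))) (split 5 9 (cycle (5 ∷ 6 ∷ 7 ∷ 8 ∷ [])) (split 6 9 (split 0 5 (cycle (0 ∷ 2 ∷ 1 ∷ 6 ∷ [])) (split 0 4 (cycle (0
  ∷ 1 ∷ 2 ∷ 3 ∷ [])) (cycle (0 ∷ 1 ∷ 6 ∷ 5 ∷ 4 ∷ 3 ∷ 2 ∷ [])))) (cycle (1 ∷ 2 ∷ 3 ∷ 4 ∷ 5 ∷ 6 ∷ 7 ∷ 8 ∷ 9 ∷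
  [])))))))))))))))))))

separation-certs : List (ℕ × ℕ × Cert)
separation-certs = (0 , 4 , cycle (0 ∷ 1 ∷ 2 ∷ 3 ∷ [])) ∷ (0 , 5 , cycle (0 ∷ 2 ∷ 3 ∷ 4 ∷ [])) ∷ (0 , 8 , cycle (0 ∷ 1 ∷ 10 ∷ 9 ∷ [])) ∷
  (0 , 9 , cycle (0 ∷ 2 ∷ 1 ∷ 10 ∷ [])) ∷ (1 , 4 , cycle (0 ∷ 1 ∷ 3 ∷ 2 ∷ [])) ∷ (1 , 5 , cycle (1 ∷ 2 ∷ 3 ∷ 4 ∷ [])) ∷
  (1 , 6 , house 1 2 3 4 5 0) ∷ (1 , 7 , cycle (1 ∷ 8 ∷ 9 ∷ 10 ∷ [])) ∷ (2 , 6 , cycle (2 ∷ 3 ∷ 4 ∷ 5 ∷ [])) ∷ (2 , 7 ,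
  house 1 2 8 9 10 0) ∷ (2 , 8 , cycle (1 ∷ 2 ∷ 9 ∷ 10 ∷ [])) ∷ (2 , 9 , cycle (0 ∷ 1 ∷ 10 ∷ 2 ∷ [])) ∷ (3 , 7 , cycle
  (3 ∷ 4 ∷ 5 ∷ 6 ∷ [])) ∷ (3 , 8 , house 1 2 3 9 10 0) ∷ (3 , 9 , cycle (1 ∷ 2 ∷ 3 ∷ 10 ∷ [])) ∷ (3 , 10 , cycle (0 ∷ 1
  ∷ 3 ∷ 2 ∷ [])) ∷ (4 , 8 , cycle (4 ∷ 5 ∷ 6 ∷ 7 ∷ [])) ∷ (4 , 9 , house 1 2 3 4 10 0) ∷ (4 , 10 , cycle (1 ∷ 2 ∷ 3 ∷ 4
  ∷ [])) ∷ (5 , 8 , cycle (1 ∷ 2 ∷ 3 ∷ 4 ∷ 5 ∷ 9 ∷ 10 ∷ [])) ∷ (5 , 9 , cycle (5 ∷ 6 ∷ 7 ∷ 8 ∷ [])) ∷ (5 , 10 , house 1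
  2 3 4 5 0) ∷ (6 , 10 , cycle (6 ∷ 7 ∷ 8 ∷ 9 ∷ [])) ∷ (4 , 7 , split 1 8 (cycle (1 ∷ 2 ∷ 3 ∷ 4 ∷ [])) (cycle (1 ∷ 2 ∷ 3
  ∷ 4 ∷ 8 ∷ 9 ∷ 10 ∷ []))) ∷ (6 , 9 , split 2 5 (cycle (1 ∷ 2 ∷ 6 ∷ 10 ∷ [])) (cycle (1 ∷ 2 ∷ 3 ∷ 4 ∷ 5 ∷ 6 ∷ 10 ∷ [])))
  ∷ (1 , 8 , split 2 5 (cycle (1 ∷ 2 ∷ 6 ∷ 7 ∷ [])) (split 3 6 (cycle (1 ∷ 2 ∷ 3 ∷ 7 ∷ [])) (cycle (1 ∷ 2 ∷ 3 ∷ 4 ∷ 5 ∷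
  6 ∷ 7 ∷ [])))) ∷ (0 , 7 , house 0 1 10 9 8 2) ∷ (0 , 6 , split 7 10 (cycle (0 ∷ 2 ∷ 1 ∷ 7 ∷ [])) (cycle (0 ∷ 2 ∷ 1 ∷
  10 ∷ 9 ∷ 8 ∷ 7 ∷ []))) ∷ (2 , 5 , split 7 10 (cycle (1 ∷ 2 ∷ 6 ∷ 7 ∷ [])) (cycle (1 ∷ 2 ∷ 6 ∷ 7 ∷ 8 ∷ 9 ∷ 10 ∷ []))) ∷
  (3 , 6 , split 7 10 (cycle (1 ∷ 2 ∷ 3 ∷ 7 ∷ [])) (cycle (1 ∷ 2 ∷ 3 ∷ 7 ∷ 8 ∷ 9 ∷ 10 ∷ []))) ∷ (7 , 10 , cycle (1 ∷ 2 ∷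
  3 ∷ 4 ∷ 5 ∷ 6 ∷ 7 ∷ [])) ∷ []

-- A chord cuts the 10-cycle into cycles of lengths 3 and 9, 4 and 8, 5 and 7, or 6 and 6; in the
-- last case a detour over the apex gives length 7.
chord-certs : List (ℕ × ℕ × Cert)
chord-certs = (0 , 2 , cycle (0 ∷ 1 ∷ 3 ∷ 2 ∷ [])) ∷ (0 , 3 , cycle (1 ∷ 2 ∷ 3 ∷ 4 ∷ [])) ∷ (0 , 4 , cycle (1 ∷ 5 ∷ 6 ∷ 7 ∷ 8 ∷ 9 ∷
  10 ∷ [])) ∷ (0 , 5 , cycle (0 ∷ 1 ∷ 6 ∷ 5 ∷ 4 ∷ 3 ∷ 2 ∷ [])) ∷ (0 , 6 , cycle (1 ∷ 2 ∷ 3 ∷ 4 ∷ 5 ∷ 6 ∷ 7 ∷ [])) ∷ (0 ,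
  7 , cycle (1 ∷ 8 ∷ 9 ∷ 10 ∷ [])) ∷ (0 , 8 , cycle (1 ∷ 2 ∷ 3 ∷ 4 ∷ 5 ∷ 6 ∷ 7 ∷ 8 ∷ 9 ∷ [])) ∷ (1 , 3 , cycle (1 ∷ 2 ∷
  4 ∷ 5 ∷ 6 ∷ 7 ∷ 8 ∷ 9 ∷ 10 ∷ [])) ∷ (1 , 4 , cycle (2 ∷ 3 ∷ 4 ∷ 5 ∷ [])) ∷ (1 , 5 , cycle (1 ∷ 2 ∷ 6 ∷ 7 ∷ 8 ∷ 9 ∷ 10
  ∷ [])) ∷ (1 , 6 , cycle (0 ∷ 1 ∷ 10 ∷ 9 ∷ 8 ∷ 7 ∷ 2 ∷ [])) ∷ (1 , 7 , cycle (2 ∷ 3 ∷ 4 ∷ 5 ∷ 6 ∷ 7 ∷ 8 ∷ [])) ∷ (1 , 8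
  , cycle (1 ∷ 2 ∷ 9 ∷ 10 ∷ [])) ∷ (1 , 9 , cycle (0 ∷ 1 ∷ 10 ∷ 2 ∷ [])) ∷ (2 , 4 , cycle (1 ∷ 2 ∷ 3 ∷ 5 ∷ 6 ∷ 7 ∷ 8 ∷ 9
  ∷ 10 ∷ [])) ∷ (2 , 5 , cycle (3 ∷ 4 ∷ 5 ∷ 6 ∷ [])) ∷ (2 , 6 , cycle (1 ∷ 2 ∷ 3 ∷ 7 ∷ 8 ∷ 9 ∷ 10 ∷ [])) ∷ (2 , 7 ,
  cycle (0 ∷ 1 ∷ 10 ∷ 9 ∷ 8 ∷ 3 ∷ 2 ∷ [])) ∷ (2 , 8 , cycle (3 ∷ 4 ∷ 5 ∷ 6 ∷ 7 ∷ 8 ∷ 9 ∷ [])) ∷ (2 , 9 , cycle (1 ∷ 2 ∷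
  3 ∷ 10 ∷ [])) ∷ (3 , 5 , cycle (1 ∷ 2 ∷ 3 ∷ 4 ∷ 6 ∷ 7 ∷ 8 ∷ 9 ∷ 10 ∷ [])) ∷ (3 , 6 , cycle (4 ∷ 5 ∷ 6 ∷ 7 ∷ [])) ∷ (3
  , 7 , cycle (1 ∷ 2 ∷ 3 ∷ 4 ∷ 8 ∷ 9 ∷ 10 ∷ [])) ∷ (3 , 8 , cycle (0 ∷ 1 ∷ 10 ∷ 9 ∷ 4 ∷ 3 ∷ 2 ∷ [])) ∷ (3 , 9 , cycle (4
  ∷ 5 ∷ 6 ∷ 7 ∷ 8 ∷ 9 ∷ 10 ∷ [])) ∷ (4 , 6 , cycle (1 ∷ 2 ∷ 3 ∷ 4 ∷ 5 ∷ 7 ∷ 8 ∷ 9 ∷ 10 ∷ [])) ∷ (4 , 7 , cycle (5 ∷ 6 ∷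
  7 ∷ 8 ∷ [])) ∷ (4 , 8 , cycle (1 ∷ 2 ∷ 3 ∷ 4 ∷ 5 ∷ 9 ∷ 10 ∷ [])) ∷ (4 , 9 , cycle (0 ∷ 1 ∷ 10 ∷ 5 ∷ 4 ∷ 3 ∷ 2 ∷ [])) ∷
  (5 , 7 , cycle (1 ∷ 2 ∷ 3 ∷ 4 ∷ 5 ∷ 6 ∷ 8 ∷ 9 ∷ 10 ∷ [])) ∷ (5 , 8 , cycle (6 ∷ 7 ∷ 8 ∷ 9 ∷ [])) ∷ (5 , 9 , cycle (1 ∷
  2 ∷ 3 ∷ 4 ∷ 5 ∷ 6 ∷ 10 ∷ [])) ∷ (6 , 8 , cycle (1 ∷ 2 ∷ 3 ∷ 4 ∷ 5 ∷ 6 ∷ 7 ∷ 9 ∷ 10 ∷ [])) ∷ (6 , 9 , cycle (7 ∷ 8 ∷ 9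
  ∷ 10 ∷ [])) ∷ (7 , 9 , cycle (1 ∷ 2 ∷ 3 ∷ 4 ∷ 5 ∷ 6 ∷ 7 ∷ 8 ∷ 10 ∷ [])) ∷ []

apex-certs : List (ℕ × ℕ × Cert)
apex-certs = (0 , 2 , cycle (0 ∷ 1 ∷ 2 ∷ 3 ∷ [])) ∷ (0 , 3 , cycle (0 ∷ 2 ∷ 3 ∷ 4 ∷ [])) ∷ (0 , 4 , cycle (0 ∷ 2 ∷ 1 ∷ 10 ∷ 9 ∷ 8 ∷
  7 ∷ 6 ∷ 5 ∷ [])) ∷ (0 , 5 , cycle (0 ∷ 1 ∷ 2 ∷ 3 ∷ 4 ∷ 5 ∷ 6 ∷ [])) ∷ (0 , 6 , cycle (0 ∷ 2 ∷ 1 ∷ 10 ∷ 9 ∷ 8 ∷ 7 ∷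
  [])) ∷ (0 , 7 , cycle (0 ∷ 1 ∷ 2 ∷ 3 ∷ 4 ∷ 5 ∷ 6 ∷ 7 ∷ 8 ∷ [])) ∷ (0 , 8 , cycle (0 ∷ 1 ∷ 10 ∷ 9 ∷ [])) ∷ (0 , 9 ,
  cycle (0 ∷ 2 ∷ 1 ∷ 10 ∷ [])) ∷ []

p6-edges : List Pair
p6-edges = (0 , 1) ∷ (1 , 2) ∷ (2 , 3) ∷ (3 , 4) ∷ (4 , 0) ∷ (0 , 5) ∷ (5 , 6) ∷ (6 , 7) ∷ (7 , 8) ∷ (8 , 1) ∷ []

p6-clauses : List (List Pair)
p6-clauses = ((0 , 2) ∷ []) ∷ ((1 , 3) ∷ []) ∷ ((2 , 4) ∷ []) ∷ ((3 , 0) ∷ []) ∷ ((4 , 1) ∷ []) ∷ ((1 , 5) ∷ []) ∷ ((0 , 6) ∷ []) ∷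
  ((5 , 7) ∷ []) ∷ ((6 , 8) ∷ []) ∷ ((7 , 1) ∷ []) ∷ ((8 , 0) ∷ []) ∷ ((4 , 5) ∷ []) ∷ ((2 , 8) ∷ []) ∷ []

ppp-edges : List Pair
ppp-edges = (0 , 1) ∷ (1 , 4) ∷ (4 , 5) ∷ (5 , 2) ∷ (2 , 0) ∷ (0 , 2) ∷ (2 , 6) ∷ (6 , 7) ∷ (7 , 3) ∷ (3 , 0) ∷ (0 , 3) ∷ (3 , 8)
  ∷ (8 , 9) ∷ (9 , 1) ∷ (1 , 0) ∷ []

ppp-clauses : List (List Pair)
ppp-clauses = ((0 , 4) ∷ []) ∷ ((1 , 5) ∷ []) ∷ ((4 , 2) ∷ []) ∷ ((5 , 0) ∷ []) ∷ ((2 , 1) ∷ []) ∷ ((0 , 6) ∷ []) ∷ ((2 , 7) ∷ []) ∷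
  ((6 , 3) ∷ []) ∷ ((7 , 0) ∷ []) ∷ ((3 , 2) ∷ []) ∷ ((0 , 8) ∷ []) ∷ ((3 , 9) ∷ []) ∷ ((8 , 1) ∷ []) ∷ ((9 , 0) ∷ []) ∷
  ((1 , 3) ∷ []) ∷ ((5 , 6) ∷ []) ∷ ((7 , 8) ∷ []) ∷ ((9 , 4) ∷ []) ∷ []

opaque
  unfolding check saturate allBelow

  p6-check : check (facts p6-edges p6-clauses) p6-cert ≡ true
  p6-check = refl

  ppp-check : check (facts ppp-edges ppp-clauses) ppp-cert ≡ true
  ppp-check = refl

  square-check : check (walkFacts 4) (cycle (0 ∷ 1 ∷ 2 ∷ 3 ∷ [])) ≡ true
  square-check = refl

  diamond-check : check (facts ((0 , 1) ∷ (0 , 2) ∷ (1 , 2) ∷ (0 , 3) ∷ (1 , 3) ∷ []) (((2 , 3) ∷ []) ∷ [])) (cycle (0 ∷ 2 ∷ 1 ∷ 3 ∷ [])) ≡ true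
  diamond-check = refl

  walk7-check : check (walkFacts 7) walk7-cert ≡ true
  walk7-check = refl

  triangle5-check : check (triangleFacts 5) triangle5-cert ≡ true
  triangle5-check = refl

  triangle6-check : check (triangleFacts 6) triangle6-cert ≡ true
  triangle6-check = refl

  triangle8-check : check (triangleFacts 8) triangle8-cert ≡ true
  triangle8-check = refl

  triangle9-check : check (triangleFacts 9) triangle9-cert ≡ true
  triangle9-check = refl

  separation-check : (λ F → allBelow 11 λ j → allBelow j λ i → distinct? F i j) (saturate (triangleFacts 10) separation-certs) ≡ true
  separation-check = refl

  chord-check : allBelow 10 (λ j → allBelow j λ i →
    consecutive i j ∨ check (addEdge (suc i) (suc j) apartFacts) (lookupCert chord-certs i j)) ≡ true
  chord-check = refl

  apex-check : allBelow 10 (λ j → (j ≤ᵇ 1) ∨ check (addEdge 0 (suc j) apartFacts) (lookupCert apex-certs 0 j)) ≡ true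
  apex-check = refl

module Walks (G : Graph) (S : Sparse G) where
  open Graph G hiding (sym)
  open Connectivity G using (adj-sym; adj≢)
  open Soundness G S
  private V = Fin n

  record ClosedWalk (ℓ : ℕ) (w : ℕ → V) : Set where
    field
      periodic : ∀ i → w (ℓ + i) ≡ w i
      steps    : ∀ i → Adj G (w i) (w (suc i))
      turn     : ∀ i → w i ≢ w (2 + i)

    w-wrap : ∀ i → w (wrap ℓ i) ≡ w i
    w-wrap i with i <ᵇ ℓ in eq
    ... | true = refl
    ... | false = trans (sym (periodic (i ∸ ℓ))) (cong w (ℕₚ.m+[n∸m]≡n {ℓ} {i} (ℕₚ.≮⇒≥ λ lt → ≡false⇒¬T eq (ℕₚ.<⇒<ᵇ lt))))

  open ClosedWalk

  walk-holds : ∀ {ℓ w} → ClosedWalk ℓ w → Holds w (walkFacts ℓ)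
  walk-holds {ℓ} {w} W = holds
    (table⁺ ℓ λ i _ → subst (Adj G (w i)) (sym (w-wrap W (suc i))) (steps W i))
    (table⁺ ℓ λ i _ → λ { (e ∷ []) → turn W i (trans e (w-wrap W (2 + i))) })

  no-walk4 : ∀ {w} → ¬ ClosedWalk 4 w
  no-walk4 {w} W = refute w (cycle (0 ∷ 1 ∷ 2 ∷ 3 ∷ [])) (walk-holds W) square-check

  no-walk7 : ∀ {w} → ¬ ClosedWalk 7 w
  no-walk7 {w} W = refute w walk7-cert (walk-holds W) walk7-check

  -- A closed walk on whose first edge, traversed backwards, lies a triangular
  -- face w₁ w₀ z. The last three fields hold because w follows a different face.
  record TriangleWalk (ℓ : ℕ) (w : ℕ → V) (z : V) : Set where
    field
      walk     : ClosedWalk ℓ w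
      w₀z      : Adj G (w 0) z
      w₁z      : Adj G (w 1) z
      after    : w 2 ≢ z
      before   : ∀ {k} → suc k ≡ ℓ → w k ≢ z
      no-edge  : ∀ i → ¬ (w 1 ≡ w i × w 0 ≡ w (suc i))
      no-apex  : ∀ i → ¬ (w 1 ≡ w i × z ≡ w (suc i) × w 0 ≡ w (2 + i))

  name : (ℕ → V) → V → ℕ → V
  name w z zero    = z
  name w z (suc i) = w i

  triangle-holds : ∀ {ℓ w z} → 3 ≤ ℓ → TriangleWalk ℓ w z → Holds (name w z) (triangleFacts ℓ)
  triangle-holds {suc ℓ} {w} {z} 3≤ℓ W = holds
    (w₀z ∷ w₁z ∷ table⁺ (suc ℓ) λ i _ → subst (Adj G (w i)) (sym (w-wrap walk (suc i))) (steps walk i))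
    ((λ { (e ∷ []) → after e }) ∷ (λ { (e ∷ []) → before refl e }) ∷
      Allₚ.++⁺ (table⁺ (suc ℓ) λ i _ → λ { (e ∷ []) → turn walk i (trans e (w-wrap walk (2 + i))) })
        (Allₚ.++⁺ (table⁺ (suc ℓ) λ i _ → λ { (e ∷ e′ ∷ []) → no-edge i (e , trans e′ (w-wrap walk (suc i))) })
          (table⁺ (suc ℓ) λ i _ → λ { (e ∷ e′ ∷ e″ ∷ []) → no-apex i (e , trans e′ (w-wrap walk (suc i)) , trans e″ (w-wrap walk (2 + i))) })))
    where open TriangleWalk W

  private
    3≤ : ∀ {k} → 3 ≤ 3 + k
    3≤ = s≤s (s≤s (s≤s z≤n))

  no-triangle5 : ∀ {w z} → ¬ TriangleWalk 5 w z
  no-triangle5 {w} {z} W = refute (name w z) triangle5-cert (triangle-holds 3≤ W) triangle5-check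

  no-triangle6 : ∀ {w z} → ¬ TriangleWalk 6 w z
  no-triangle6 {w} {z} W = refute (name w z) triangle6-cert (triangle-holds 3≤ W) triangle6-check

  no-triangle8 : ∀ {w z} → ¬ TriangleWalk 8 w z
  no-triangle8 {w} {z} W = refute (name w z) triangle8-cert (triangle-holds 3≤ W) triangle8-check

  no-triangle9 : ∀ {w z} → ¬ TriangleWalk 9 w z
  no-triangle9 {w} {z} W = refute (name w z) triangle9-cert (triangle-holds 3≤ W) triangle9-check

  module _ {w z} (W : TriangleWalk 10 w z) where
    private
      ρ = name w z

      apart< : ∀ {i j} → i < j → j < 11 → ρ i ≢ ρ j
      apart< {i} {j} i<j j<11 = distinct?⁻ ρ {F} {i} {j} (saturate-holds ρ separation-certs (triangle-holds 3≤ W))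
        (allBelow⁻ (allBelow⁻ separation-check j<11) i<j)
        where F = saturate (triangleFacts 10) separation-certs

      apart-holds : Holds ρ apartFacts
      apart-holds = holds (w₀z ∷ w₁z ∷ table⁺ 10 λ i _ → subst (Adj G (w i)) (sym (w-wrap walk (suc i))) (steps walk i))
                          (pairs⁺ 11 ℕₚ.≤-refl)
        where
        open TriangleWalk W
        pairs⁺ : ∀ k → k ≤ 11 → All (Refuted ρ) (allPairs k)
        pairs⁺ zero    _    = []
        pairs⁺ (suc k) k<11 = Allₚ.++⁺ (table⁺ k λ i i<k → λ { (e ∷ []) → apart< i<k k<11 e }) (pairs⁺ k (ℕₚ.<⇒≤ k<11))

      add-holds : ∀ {i j} → Adj G (ρ i) (ρ j) → Holds ρ (addEdge i j apartFacts)
      add-holds ij = let holds E C = apart-holds in holds (ij ∷ E) C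

    walk10-distinct : ∀ {i j} → i < j → j < 10 → w i ≢ w j
    walk10-distinct i<j j<10 = apart< (s≤s i<j) (s≤s j<10)

    walk10-chordless : ∀ {i j} → i < j → j < 10 → Adj G (w i) (w j) → consecutive i j ≡ true
    walk10-chordless {i} {j} i<j j<10 ij with ∨-≡ {consecutive i j} (allBelow⁻ (allBelow⁻ chord-check j<10) i<j)
    ... | inj₁ c = c
    ... | inj₂ h = ⊥-elim (refute ρ {addEdge (suc i) (suc j) apartFacts} (lookupCert chord-certs i j) (add-holds {suc i} {suc j} ij) h)

    walk10-apex-chordless : ∀ {j} → 2 ≤ j → j < 10 → ¬ Adj G z (w j)
    walk10-apex-chordless {suc zero} (s≤s ())
    walk10-apex-chordless {suc (suc j)} _ j<10 zj = refute ρ {addEdge 0 (3 + j) apartFacts} (lookupCert apex-certs 0 (2 + j))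
      (add-holds {0} {3 + j} zj) (allBelow⁻ apex-check j<10)

  two-triangles : ∀ {x y z z′} → Adj G x y → Adj G x z → Adj G y z → Adj G x z′ → Adj G y z′ → z ≢ z′ → ⊥
  two-triangles {x} {y} {z} {z′} xy xz yz xz′ yz′ z≢z′ = refute ρ {facts E C} (cycle (0 ∷ 2 ∷ 1 ∷ 3 ∷ []))
      (holds (xy ∷ xz ∷ yz ∷ xz′ ∷ yz′ ∷ []) ((λ { (e ∷ []) → z≢z′ e }) ∷ [])) diamond-check
    where
    ρ : ℕ → V
    ρ 0 = x
    ρ 1 = y
    ρ 2 = z
    ρ _ = z′
    E = (0 , 1) ∷ (0 , 2) ∷ (1 , 2) ∷ (0 , 3) ∷ (1 , 3) ∷ []
    C = ((2 , 3) ∷ []) ∷ []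

  pentagon-hexagon : ∀ {p q} → ClosedWalk 5 p → ClosedWalk 6 q → q 0 ≡ p 1 → q 1 ≡ p 0 → p 4 ≢ q 2 → p 2 ≢ q 5 → ⊥
  pentagon-hexagon {p} {q} P Q q₀ q₁ p₄≢q₂ p₂≢q₅ = refute ρ {facts p6-edges p6-clauses} p6-cert (holds
      (steps P 0 ∷ steps P 1 ∷ steps P 2 ∷ steps P 3 ∷ subst (Adj G (p 4)) (periodic P 0) (steps P 4) ∷
       subst (λ x → Adj G x (q 2)) q₁ (steps Q 1) ∷ steps Q 2 ∷ steps Q 3 ∷ steps Q 4 ∷ subst (Adj G (q 5)) (trans (periodic Q 0) q₀) (steps Q 5) ∷ [])
      ((λ { (e ∷ []) → turn P 0 e }) ∷ (λ { (e ∷ []) → turn P 1 e }) ∷ (λ { (e ∷ []) → turn P 2 e }) ∷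
       (λ { (e ∷ []) → turn P 3 (trans e (sym (periodic P 0))) }) ∷ (λ { (e ∷ []) → turn P 4 (trans e (sym (periodic P 1))) }) ∷
       (λ { (e ∷ []) → turn Q 0 (trans q₀ e) }) ∷ (λ { (e ∷ []) → turn Q 1 (trans q₁ e) }) ∷ (λ { (e ∷ []) → turn Q 2 e }) ∷ (λ { (e ∷ []) → turn Q 3 e }) ∷
       (λ { (e ∷ []) → turn Q 4 (trans e (sym (trans (periodic Q 0) q₀))) }) ∷ (λ { (e ∷ []) → turn Q 5 (trans e (sym (trans (periodic Q 1) q₁))) }) ∷
       (λ { (e ∷ []) → p₄≢q₂ e }) ∷ (λ { (e ∷ []) → p₂≢q₅ e }) ∷ [])) p6-check
    where
    ρ : ℕ → V
    ρ 5 = q 2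
    ρ 6 = q 3
    ρ 7 = q 4
    ρ 8 = q 5
    ρ i = p i

  three-pentagons : ∀ {a b c} → ClosedWalk 5 a → ClosedWalk 5 b → ClosedWalk 5 c →
    b 0 ≡ a 0 → c 0 ≡ a 0 → a 4 ≡ b 1 → b 4 ≡ c 1 → c 4 ≡ a 1 → a 3 ≢ b 2 → b 3 ≢ c 2 → c 3 ≢ a 2 → ⊥
  three-pentagons {a} {b} {c} A B C b₀ c₀ a₄ b₄ c₄ ne₁ ne₂ ne₃ = refute ρ {facts ppp-edges ppp-clauses} ppp-cert (holds
      (steps A 0 ∷ steps A 1 ∷ steps A 2 ∷ subst (Adj G (a 3)) a₄ (steps A 3) ∷
         subst₂ (Adj G) a₄ (periodic A 0) (steps A 4) ∷
       subst (λ x → Adj G x (b 1)) b₀ (steps B 0) ∷ steps B 1 ∷ steps B 2 ∷ subst (Adj G (b 3)) b₄ (steps B 3) ∷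
         subst₂ (Adj G) b₄ (trans (periodic B 0) b₀) (steps B 4) ∷
       subst (λ x → Adj G x (c 1)) c₀ (steps C 0) ∷ steps C 1 ∷ steps C 2 ∷ subst (Adj G (c 3)) c₄ (steps C 3) ∷
         subst₂ (Adj G) c₄ (trans (periodic C 0) c₀) (steps C 4) ∷ [])
      (clash A 0 refl refl ∷ clash A 1 refl refl ∷ clash A 2 refl a₄ ∷ clash A 3 refl (periodic A 0) ∷ clash A 4 a₄ (periodic A 1) ∷
       clash B 0 b₀ refl ∷ clash B 1 refl refl ∷ clash B 2 refl b₄ ∷ clash B 3 refl (trans (periodic B 0) b₀) ∷ clash B 4 b₄ (periodic B 1) ∷
       clash C 0 c₀ refl ∷ clash C 1 refl refl ∷ clash C 2 refl c₄ ∷ clash C 3 refl (trans (periodic C 0) c₀) ∷ clash C 4 c₄ (periodic C 1) ∷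
       (λ { (e ∷ []) → ne₁ e }) ∷ (λ { (e ∷ []) → ne₂ e }) ∷ (λ { (e ∷ []) → ne₃ e }) ∷ []))
      ppp-check
    where
    ρ : ℕ → V
    ρ 0 = a 0
    ρ 1 = a 1
    ρ 2 = b 1
    ρ 3 = c 1
    ρ 4 = a 2
    ρ 5 = a 3
    ρ 6 = b 2
    ρ 7 = b 3
    ρ 8 = c 2
    ρ _ = c 3
    clash : ∀ {w} → ClosedWalk 5 w → ∀ i {j k} → w i ≡ ρ j → w (2 + i) ≡ ρ k → Refuted ρ ((j , k) ∷ [])
    clash W i e e′ (h ∷ []) = turn W i (trans e (trans h (sym e′)))

-- A rotation is a single cycle on the neighbours of a vertex, so its period is the degree; periods
-- 1 and 2 are excluded.
MinDegree≥3 : (G : Graph) → RotationSystem G → Set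
MinDegree≥3 G R = ∀ u v → Adj G u v → rot u v ≢ v × rot u (rot u v) ≢ v
  where open RotationSystem R

-- Faces in an embedding of minimum degree 3

module Darts (G : Graph) (R : RotationSystem G) (S : Sparse G)
             (deg≥3 : MinDegree≥3 G R) where
  open Graph G hiding (sym)
  open RotationSystem R
  open Embedding G R
  open Enum E using (_≟_)
  open Walks G S public
  V = Fin n
  D = V × V

  Arc : D → Set
  Arc (u , v) = Adj G u v

  rev : D → D
  rev (u , v) = v , u

  spin : D → D
  spin (u , v) = u , rot u v

  -- Hence the face across `d` is the face of `spin d`, and the faces around a vertex are read off
  -- by iterating `spin`.
  φ-rev : ∀ {d} → Arc d → φ̂ (rev d) ≡ spin d
  φ-rev uv = φ̂-dart (adj-sym uv)

  rotⁿ-adj : ∀ k {u v} → Adj G u v → Adj G u (pow (rot u) k v)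
  rotⁿ-adj zero    uv = uv
  rotⁿ-adj (suc k) uv = rot-adj _ _ (rotⁿ-adj k uv)

  pow-comm : ∀ {A : Set} (f : A → A) j k x → pow f j (pow f k x) ≡ pow f k (pow f j x)
  pow-comm f j k x = trans (sym (pow-+ f j k x)) (trans (cong (λ m → pow f m x) (ℕₚ.+-comm j k)) (pow-+ f k j x))

  Tri Pent : D → Set
  Tri d  = pow φ̂ 3 d ≡ d
  Pent d = pow φ̂ 5 d ≡ d

  -- Since degrees are at least 3, these say that the first vertex has degree 3, respectively 4.
  Low Four : D → Set
  Low (u , v)  = pow (rot u) 3 v ≡ v
  Four (u , v) = pow (rot u) 4 v ≡ v

  φ-closed : ∀ m k {d} → pow φ̂ m d ≡ d → pow φ̂ m (pow φ̂ k d) ≡ pow φ̂ k d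
  φ-closed m k {d} h = trans (pow-comm φ̂ m k d) (cong (pow φ̂ k) h)

  φ-closed⁻ : ∀ m k {d} → pow φ̂ m (pow φ̂ k d) ≡ pow φ̂ k d → pow φ̂ m d ≡ d
  φ-closed⁻ m k {d} h = pow-injective k (trans (pow-comm φ̂ k m d) h)

  pow-wrap : ∀ {b} → pow φ̂ 10 b ≡ b → ∀ i → pow φ̂ (wrap 10 i) b ≡ pow φ̂ i b
  pow-wrap {b} closed i with i <ᵇ 10 in eq
  ... | true = refl
  ... | false = trans (sym (φ-closed 10 (i ∸ 10) closed)) (trans (sym (pow-+ φ̂ 10 (i ∸ 10) b))
                  (cong (λ m → pow φ̂ m b) (ℕₚ.m+[n∸m]≡n {10} {i} (ℕₚ.≮⇒≥ λ lt → ≡false⇒¬T eq (ℕₚ.<⇒<ᵇ lt)))))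

  pow-period* : ∀ {b} → pow φ̂ 10 b ≡ b → ∀ q r → pow φ̂ (q * 10 + r) b ≡ pow φ̂ r b
  pow-period* closed zero    r = refl
  pow-period* {b} closed (suc q) r = trans (pow-+ φ̂ 10 (q * 10 + r) b)
    (trans (φ-closed 10 (q * 10 + r) closed) (pow-period* closed q r))

  pow-mod : ∀ {b} → pow φ̂ 10 b ≡ b → ∀ i → pow φ̂ i b ≡ pow φ̂ (i % 10) b
  pow-mod {b} closed i = trans (cong (λ m → pow φ̂ m b) (trans (m≡m%n+[m/n]*n i 10) (ℕₚ.+-comm (i % 10) _)))
                               (pow-period* closed (i / 10) (i % 10))

  -- `rot u` is transitive on the neighbours of `u` and commutes with its powers, so a power fixing
  -- one neighbour fixes all.
  rot-fixed : ∀ m {u v w} → Adj G u v → Adj G u w → pow (rot u) m v ≡ v → pow (rot u) m w ≡ w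
  rot-fixed m {u} {v} uv uw h with rot-pow uv uw
  ... | k , refl = trans (pow-comm (rot u) m k v) (cong (pow (rot u) k) h)

  neighbour-list : ∀ m {u v w} → Adj G u v → Adj G u w → pow (rot u) (suc m) v ≡ v → ∃[ k ] (k ≤ m × w ≡ pow (rot u) k v)
  neighbour-list m {u} {v} uv uw h with rot-pow uv uw
  ... | k , refl = go k
    where
    go : ∀ k → ∃[ j ] (j ≤ m × pow (rot u) k v ≡ pow (rot u) j v)
    go zero = 0 , z≤n , refl
    go (suc k) with go k
    ... | j , j≤m , eq with ℕₚ.m≤n⇒m<n∨m≡n j≤m
    ...   | inj₁ j<m = suc j , j<m , cong (rot u) eq
    ...   | inj₂ refl = 0 , z≤n , trans (cong (rot u) eq) h

  low-neighbours : ∀ {u v w} → Adj G u v → Low (u , v) → Adj G u w → w ≡ v ⊎ w ≡ rot u v ⊎ w ≡ rot u (rot u v)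
  low-neighbours uv low uw with neighbour-list 2 uv uw low
  ... | 0 , _ , e = inj₁ e
  ... | 1 , _ , e = inj₂ (inj₁ e)
  ... | 2 , _ , e = inj₂ (inj₂ e)
  ... | suc (suc (suc _)) , s≤s (s≤s ()) , _

  four-neighbours : ∀ {u v w} → Adj G u v → Four (u , v) → Adj G u w →
                    w ≡ v ⊎ w ≡ rot u v ⊎ w ≡ rot u (rot u v) ⊎ w ≡ rot u (rot u (rot u v))
  four-neighbours uv four uw with neighbour-list 3 uv uw four
  ... | 0 , _ , e = inj₁ e
  ... | 1 , _ , e = inj₂ (inj₁ e)
  ... | 2 , _ , e = inj₂ (inj₂ (inj₁ e))
  ... | 3 , _ , e = inj₂ (inj₂ (inj₂ e))
  ... | suc (suc (suc (suc _))) , s≤s (s≤s (s≤s ())) , _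

  src : D → ℕ → V
  src d i = proj₁ (pow φ̂ i d)

  pow-src : ∀ i {d} → Arc d → pow φ̂ i d ≡ (src d i , src d (suc i))
  pow-src i {d} dd = cong (src d i ,_) (sym (cong proj₁ (φ̂-dart (pow-isDart i dd))))

  src-adj : ∀ i {d} → Arc d → Adj G (src d i) (src d (suc i))
  src-adj i {d} dd = subst Arc (pow-src i dd) (pow-isDart i dd)

  src-rot : ∀ i {d} → Arc d → src d (2 + i) ≡ rot (src d (suc i)) (src d i)
  src-rot i {d} dd = cong proj₁ (trans (cong (φ̂ ∘ φ̂) (pow-src i dd)) (trans (cong φ̂ (φ̂-dart (src-adj i dd)))
                       (φ̂-dart (rot-adj _ _ (adj-sym (src-adj i dd))))))

  src-pow : ∀ i j d → src (pow φ̂ i d) j ≡ src d (j + i)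
  src-pow i j d = cong proj₁ (sym (pow-+ φ̂ j i d))

  closedWalk : ∀ {ℓ d} → Arc d → pow φ̂ ℓ d ≡ d → ClosedWalk ℓ (src d)
  closedWalk {ℓ} {d} dd h = record
    { periodic = λ i → cong proj₁ (trans (cong (λ m → pow φ̂ m d) (ℕₚ.+-comm ℓ i)) (trans (pow-+ φ̂ i ℓ d) (cong (pow φ̂ i) h)))
    ; steps = λ i → src-adj i dd
    ; turn = λ i e → proj₁ (deg≥3 _ _ (adj-sym (src-adj i dd))) (trans (sym (src-rot i dd)) (sym e))
    }

  tri-third : ∀ {u v} → Adj G u v → Tri (u , v) →
              let t = rot v u in rot t v ≡ u × rot u t ≡ v × Adj G v t × Adj G t u
  tri-third {u} {v} uv h = rtv , rut , vt , tu
    where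
    d = u , v
    t = rot v u
    e₁ : src d 1 ≡ v
    e₁ = cong proj₁ (φ̂-dart uv)
    e₂ : src d 2 ≡ t
    e₂ = trans (src-rot 0 uv) (cong (λ x → rot x u) e₁)
    e₃ : src d 3 ≡ u
    e₃ = cong proj₁ h
    rtv : rot t v ≡ u
    rtv = trans (sym (trans (src-rot 1 uv) (cong₂ rot e₂ e₁))) e₃
    rut : rot u t ≡ v
    rut = trans (sym (trans (src-rot 2 uv) (cong₂ rot e₃ e₂))) (trans (cong proj₁ (cong φ̂ h)) e₁)
    vt : Adj G v t
    vt = subst₂ (Adj G) e₁ e₂ (src-adj 1 uv)
    tu : Adj G t u
    tu = subst₂ (Adj G) e₂ e₃ (src-adj 2 uv)

  -- The third vertices differ, since otherwise `u` would have degree 2; the two triangles then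
  -- contain a 4-cycle.
  no-two-tri : ∀ {d} → Arc d → Tri d → ¬ Tri (rev d)
  no-two-tri {u , v} uv t t′ with tri-third uv t | tri-third (adj-sym uv) t′
  ... | _ , e , vt , tu | e′ , _ , ut′ , t′v =
    two-triangles uv (adj-sym tu) vt ut′ (adj-sym t′v) λ same → proj₂ (deg≥3 u v uv) (trans (cong (rot u) (sym same)) e)

  triangleWalk : ∀ {ℓ d} → Arc d → Tri (rev d) → pow φ̂ ℓ d ≡ d →
                 TriangleWalk ℓ (src d) (rot (proj₁ d) (proj₂ d))
  triangleWalk {ℓ} {y , x} yx t h with tri-third (adj-sym yx) t
  ... | rzy , rxz , yz , zx = record
    { walk = W
    ; w₀z = yz
    ; w₁z = subst (λ w → Adj G w z) (sym e₁) (adj-sym zx)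
    ; after = λ e → proj₂ (deg≥3 x y (adj-sym yx)) (trans (cong (rot x) (trans (sym (trans (src-rot 0 yx) (cong (λ w → rot w y) e₁))) e)) rxz)
    ; before = before
    ; no-edge = λ i (e , e′) → no-two-tri yx (φ-closed⁻ 3 i (subst Tri (sym (trans (pow-src i yx) (cong₂ _,_ (trans (sym e) e₁) (sym e′)))) t)) t
    ; no-apex = λ i (e , e′ , e″) → proj₂ (deg≥3 z y (adj-sym yz))
        (trans (cong (rot z) rzy) (sym (trans e″ (trans (src-rot i yx) (cong₂ rot (sym e′) (trans (sym e) e₁))))))
    }
    where
    z = rot y x
    d = y , x
    W = closedWalk {ℓ} yx h
    e₁ : src d 1 ≡ x
    e₁ = cong proj₁ (φ̂-dart yx)
    before : ∀ {k} → suc k ≡ ℓ → src d k ≢ z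
    before {k} refl e = proj₂ (deg≥3 y x yx) (trans (cong (rot y) (sym e)) (sym
      (trans (sym e₁) (trans (cong proj₁ (cong φ̂ (sym h))) (trans (src-rot k yx) (cong (λ w → rot w (src d k)) (cong proj₁ h)))))))

  tri-not-5 : ∀ {d} → Arc d → Tri (rev d) → pow φ̂ 5 d ≢ d
  tri-not-5 dd t h = no-triangle5 (triangleWalk dd t h)

  tri-not-6 : ∀ {d} → Arc d → Tri (rev d) → pow φ̂ 6 d ≢ d
  tri-not-6 dd t h = no-triangle6 (triangleWalk dd t h)

  tri-not-8 : ∀ {d} → Arc d → Tri (rev d) → pow φ̂ 8 d ≢ d
  tri-not-8 dd t h = no-triangle8 (triangleWalk dd t h)

  tri-not-9 : ∀ {d} → Arc d → Tri (rev d) → pow φ̂ 9 d ≢ d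
  tri-not-9 dd t h = no-triangle9 (triangleWalk dd t h)

  pent-not-6 : ∀ {d} → Arc d → Pent (rev d) → pow φ̂ 6 d ≢ d
  pent-not-6 {v , u} vu h₅ h₆ = pentagon-hexagon P Q (sym p₁) q₁
      -- A further common edge at `u`, or at `v` in the next argument, would give that vertex degree
      -- 2.
      (λ e → proj₂ (deg≥3 u v uv) (trans (cong (rot u) (sym (trans e q₂))) (sym p₆)))
      (λ e → proj₂ (deg≥3 v u vu) (trans (cong (rot v) (trans (sym p₂) e)) (sym q₇)))
    where
    uv = adj-sym vu
    P = closedWalk {5} {u , v} uv h₅
    Q = closedWalk {6} {v , u} vu h₆
    p = src (u , v)
    q = src (v , u)
    p₁ : p 1 ≡ v
    p₁ = cong proj₁ (φ̂-dart uv)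
    q₁ : q 1 ≡ u
    q₁ = cong proj₁ (φ̂-dart vu)
    q₂ : q 2 ≡ rot u v
    q₂ = trans (src-rot 0 vu) (cong (λ x → rot x v) q₁)
    p₂ : p 2 ≡ rot v u
    p₂ = trans (src-rot 0 uv) (cong (λ x → rot x u) p₁)
    p₆ : v ≡ rot u (p 4)
    p₆ = trans (sym p₁) (trans (sym (ClosedWalk.periodic P 1)) (trans (src-rot 4 uv) (cong (λ x → rot x (p 4)) (ClosedWalk.periodic P 0))))
    q₇ : u ≡ rot v (q 5)
    q₇ = trans (sym q₁) (trans (sym (ClosedWalk.periodic Q 1)) (trans (src-rot 5 vu) (cong (λ x → rot x (q 5)) (ClosedWalk.periodic Q 0))))

  no-three-pent : ∀ {d} → Arc d → Low d → Pent d → Pent (spin d) → ¬ Pent (spin (spin d))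
  no-three-pent {v , a} va low p p′ p″ = three-pentagons (walk va p) (walk vb p″) (walk vc p′) refl refl
      (meet va p vb low) (meet vb p″ vc refl) (meet vc p′ va refl)
      (clash va p vb p″ low) (clash vb p″ vc p′ refl) (clash vc p′ va p refl)
    where
    -- The face of `(v , x)` returns to `v` through the predecessor of `x` in the rotation. The
    -- pentagons therefore follow one another against the rotation, in the order `a`, `b`, `c`.
    c = rot v a
    b = rot v c
    vc = rot-adj v a va
    vb = rot-adj v c vc
    walk : ∀ {x} → Adj G v x → Pent (v , x) → ClosedWalk 5 (src (v , x))
    walk vx h = closedWalk vx h
    first : ∀ {x} → Adj G v x → src (v , x) 1 ≡ x
    first vx = cong proj₁ (φ̂-dart vx)
    v4 : ∀ {x} (vx : Adj G v x) (h : Pent (v , x)) → Adj G v (src (v , x) 4)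
    v4 {x} vx h = adj-sym (subst (Adj G (src (v , x) 4)) (ClosedWalk.periodic (walk vx h) 0) (src-adj 4 vx))
    rot4 : ∀ {x} (vx : Adj G v x) (h : Pent (v , x)) → rot v (src (v , x) 4) ≡ x
    rot4 {x} vx h = sym (trans (sym (first vx)) (trans (sym (ClosedWalk.periodic (walk vx h) 1))
      (trans (src-rot 4 vx) (cong (λ w → rot w (src (v , x) 4)) (ClosedWalk.periodic (walk vx h) 0)))))
    meet : ∀ {x y} (vx : Adj G v x) (h : Pent (v , x)) (vy : Adj G v y) → rot v y ≡ x → src (v , x) 4 ≡ src (v , y) 1
    meet vx h vy e = trans (rot-inj v _ _ (v4 vx h) vy (trans (rot4 vx h) (sym e))) (sym (first vy))
    clash : ∀ {x y} (vx : Adj G v x) (h : Pent (v , x)) (vy : Adj G v y) → Pent (v , y) → rot v y ≡ x →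
            src (v , x) 3 ≢ src (v , y) 2
    clash {x} {y} vx h vy h′ e same = proj₂ (deg≥3 y v (adj-sym vy)) (trans (cong (rot y) (sym x3)) back)
      where
      x4 : src (v , x) 4 ≡ y
      x4 = trans (meet vx h vy e) (first vy)
      x3 : src (v , x) 3 ≡ rot y v
      x3 = trans same (trans (src-rot 0 vy) (cong (λ w → rot w v) (first vy)))
      back : rot y (src (v , x) 3) ≡ v
      back = trans (cong (λ w → rot w (src (v , x) 3)) (sym x4))
               (trans (sym (src-rot 3 vx)) (ClosedWalk.periodic (walk vx h) 0))

  -- The two configurations excluded by recolouring. In the first, `pow φ̂ 2 (rev b)` is the dart
  -- that starts at the apex of the triangle on `b`.
  NoLowApex NoCrossing : Set
  NoLowApex = ∀ b → Arc b → pow φ̂ 10 b ≡ b → (∀ i → Low (pow φ̂ i b)) → Tri (rev b) → ¬ Low (pow φ̂ 2 (rev b))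
  NoCrossing = ∀ g → Arc g → pow φ̂ 10 g ≡ g →
    (∀ i → (i ≡ 0 ⊎ i ≡ 2 ⊎ i ≡ 3 ⊎ i ≡ 5 ⊎ i ≡ 9) → Tri (rev (pow φ̂ i g))) →
    (∀ i → (i ≡ 4 ⊎ i ≡ 5 ⊎ i ≡ 6 ⊎ i ≡ 9) → Low (pow φ̂ i g)) →
    (∀ i → (i ≡ 0 ⊎ i ≡ 3) → Four (pow φ̂ i g)) →
    pow φ̂ 10 (rev (pow φ̂ 1 g)) ≡ rev (pow φ̂ 1 g) →
    (∀ i → Low (pow φ̂ i (rev (pow φ̂ 1 g)))) → ⊥

-- The two reducible configurations around a 10-face

module Reductions (G : Graph) (R : RotationSystem G) (S : Sparse G)
             (deg≥3 : MinDegree≥3 G R)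
             (deleted : ∀ a b (ab : Adj G a b) → IFPartitionable (EdgeDeletion.G′ G R a b ab)) where
  open Graph G hiding (sym)
  open RotationSystem R
  open Embedding G R
  open Darts G R S deg≥3
  open Colouring G

  module LowFace (b : D) (arc : Arc b) (closed : pow φ̂ 10 b ≡ b) (low : ∀ i → Low (pow φ̂ i b)) (tri : Tri (rev b)) where
    v o : ℕ → V
    v i = src b i
    o i = rot (v i) (v (suc i))

    W : TriangleWalk 10 v (rot (proj₁ b) (proj₂ b))
    W = triangleWalk {10} arc tri closed

    low′ : ∀ i → Low (v i , v (suc i))
    low′ i = subst Low (pow-src i arc) (low i)

    vo : ∀ i → Adj G (v i) (o i)
    vo i = rot-adj _ _ (src-adj i arc)

    rot²o : ∀ i → rot (v (suc i)) (o (suc i)) ≡ v i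
    rot²o i = rot-inj (v (suc i)) _ _ (rot-adj _ _ (vo (suc i))) (adj-sym (src-adj i arc))
                (trans (low′ (suc i)) (src-rot i arc))

    v-mod : ∀ i → v i ≡ v (i % 10)
    v-mod i = cong proj₁ (pow-mod closed i)

    vsuc-mod : ∀ i → v (suc i) ≡ v (suc (i % 10))
    vsuc-mod i = cong (proj₁ ∘ φ̂) (pow-mod closed i)

    -- Distinctness is known for positions below 10, so both positions are reduced; if the second
    -- wraps around, the two change order.
    distinct : ∀ {i j} → i < j → j < 10 + i → v i ≢ v j
    distinct {i} {j} i<j j<10+i eq = go (r + d <? 10)
      where
      d = j ∸ i
      r = i % 10
      r<10 = m%n<n i 10
      vj : v (r + d) ≡ v j
      vj = sym (cong proj₁ (trans (cong (λ m → pow φ̂ m b) (sym (ℕₚ.m∸n+n≡m (ℕₚ.<⇒≤ i<j)))) (trans (pow-+ φ̂ d i b)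
             (trans (cong (pow φ̂ d) (pow-mod closed i)) (trans (sym (pow-+ φ̂ d r b)) (cong (λ m → pow φ̂ m b) (ℕₚ.+-comm d r)))))))
      d<10 : d < 10
      d<10 = ℕₚ.+-cancelʳ-< i d 10 (subst (_< 10 + i) (sym (ℕₚ.m∸n+n≡m (ℕₚ.<⇒≤ i<j))) j<10+i)
      go : Dec (r + d < 10) → ⊥
      go (yes lt) = walk10-distinct W (ℕₚ.m<m+n r (ℕₚ.m<n⇒0<n∸m i<j)) lt (trans (sym (v-mod i)) (trans eq (sym vj)))
      go (no ≥10) = walk10-distinct W r′<r r<10 (trans vr′ (trans (sym eq) (v-mod i)))
        where
        r′ = r + d ∸ 10
        10≤ : 10 ≤ r + d
        10≤ = ℕₚ.≮⇒≥ ≥10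
        r′<r : r′ < r
        r′<r = ℕₚ.+-cancelʳ-< 10 r′ r (subst (_< r + 10) (sym (ℕₚ.m∸n+n≡m 10≤)) (ℕₚ.+-monoʳ-< r d<10))
        vr′ : v r′ ≡ v j
        vr′ = trans (cong proj₁ (sym (trans (cong (λ m → pow φ̂ m b) (trans (sym (ℕₚ.m∸n+n≡m 10≤)) (ℕₚ.+-comm r′ 10)))
                (trans (pow-+ φ̂ 10 r′ b) (φ-closed 10 r′ closed))))) vj

    -- The face has no chords, so `o i` on the face would be a neighbour of `v i` along it, which
    -- contradicts the degree of `v i`.
    o-off : ∀ i j → o i ≢ v j
    o-off i j eq = go (ℕₚ.<-cmp r s)
      where
      r = i % 10
      s = j % 10
      r<10 = m%n<n i 10
      s<10 = m%n<n j 10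
      eq′ : o r ≡ v s
      eq′ = trans (sym (cong₂ rot (v-mod i) (vsuc-mod i))) (trans eq (v-mod j))
      onward : ∀ k → v k ≡ v (suc r) → v s ≢ v k
      onward k e e′ = proj₁ (deg≥3 _ _ (src-adj r arc)) (trans eq′ (trans e′ e))
      backward : pow φ̂ (suc s) b ≡ pow φ̂ r b → ⊥
      backward e = proj₂ (deg≥3 _ _ (src-adj r arc)) (trans (cong₂ rot (sym (cong proj₁ e)) eq′)
        (trans (sym (src-rot s arc)) (cong (proj₁ ∘ φ̂) e)))
      link : consecutive r s ≡ true → ⊥
      link c with ∨-≡ {wrap 10 (suc r) ≡ᵇ s} c
      ... | inj₁ h = onward s (trans (cong v (sym (≡ᵇ⇒≡ {wrap 10 (suc r)} h))) (cong proj₁ (pow-wrap closed (suc r)))) refl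
      ... | inj₂ h = backward (trans (sym (pow-wrap closed (suc s))) (cong (λ m → pow φ̂ m b) (≡ᵇ⇒≡ {wrap 10 (suc s)} h)))
      adj-rs : Adj G (v r) (v s)
      adj-rs = subst (Adj G (v r)) eq′ (vo r)
      go : _ → ⊥
      go (tri< r<s _ _) = link (walk10-chordless W r<s s<10 adj-rs)
      go (tri≈ _ r≡s _) = adj≢ adj-rs (cong v r≡s)
      go (tri> _ _ s<r) = link (trans (Boolₚ.∨-comm (wrap 10 (suc r) ≡ᵇ s) _) (walk10-chordless W s<r r<10 (adj-sym adj-rs)))

    lowCycle : LowCycle
    lowCycle = record
      { v = v ; o = o
      ; v-periodic = λ i → cong proj₁ (trans (pow-+ φ̂ 10 i b) (φ-closed 10 i closed))
      ; o-periodic = λ i → let e = trans (pow-+ φ̂ 10 i b) (φ-closed 10 i closed) in cong₂ rot (cong proj₁ e) (cong (proj₁ ∘ φ̂) e)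
      ; neighbours = λ i w vw → case low-neighbours (src-adj (suc i) arc) (low′ (suc i)) vw of λ
          { (inj₁ e) → inj₂ (inj₁ e) ; (inj₂ (inj₁ e)) → inj₂ (inj₂ e) ; (inj₂ (inj₂ e)) → inj₁ (trans e (rot²o i)) }
      ; distinct = distinct
      ; o-off = o-off
      }

    open LowCycle lowCycle using (Blank; Filled)

    outside : ∃[ c ] (Valid c × Blank c × Filled c)
    outside = let c , val , c-in , c-𝕌 = restrict G R (src-adj 0 arc) (deleted _ _ (src-adj 0 arc)) on (on⁺ 0)
              in c , val , (λ i → c-in (v i) (on⁺ i)) , (λ w h → on⁻ w (c-𝕌 w h))
      where
      on? : ∀ w → Dec (∃[ i ] w ≡ v (toℕ {10} i))
      on? w = Finₚ.any? (λ i → w Finₚ.≟ v (toℕ i))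
      on : V → Bool
      on w = does (on? w)
      on⁺ : ∀ i → on (v i) ≡ true
      on⁺ i = true-dec (on? (v i)) (fromℕ< (m%n<n i 10) , trans (v-mod i) (cong v (sym (Finₚ.toℕ-fromℕ< (m%n<n i 10)))))
      on⁻ : ∀ w → on w ≡ true → ∃[ i ] w ≡ v i
      on⁻ w h = let i , e = dec-true (on? w) h in toℕ i , e

    low-apex : Low (pow φ̂ 2 (rev b)) → IFPartitionable G
    low-apex low-z with outside | tri-third (adj-sym arc) tri
    ... | c , val , blank , filled | rzy , rxz , yz , zx =
      bad-triangle lowCycle 0 z (rot z x) val blank filled (cong (rot y) (cong proj₁ (φ̂-dart arc)))
        λ w zw → case low-neighbours zx low-zx zw of λ
          { (inj₁ e) → inj₂ (inj₁ (trans e (sym (cong proj₁ (φ̂-dart arc)))))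
          ; (inj₂ (inj₁ e)) → inj₂ (inj₂ e)
          ; (inj₂ (inj₂ e)) → inj₁ (trans e (rot-inj z _ _ (rot-adj _ _ (rot-adj _ _ zx)) (adj-sym yz) (trans low-zx (sym rzy)))) }
      where
      y = proj₁ b
      x = proj₂ b
      z = rot y x
      low-zx : Low (z , x)
      low-zx = subst Low (trans (cong φ̂ (φ̂-dart (adj-sym arc))) (trans (φ̂-dart yz) (cong (z ,_) rzy))) low-z

  -- Ten consecutive vertices x z y x′ q a b e d p of a face; the face across z y is special.
  module Crossing (g : D) (arc : Arc g) (closed : pow φ̂ 10 g ≡ g)
                  (tri : ∀ i → (i ≡ 0 ⊎ i ≡ 2 ⊎ i ≡ 3 ⊎ i ≡ 5 ⊎ i ≡ 9) → Tri (rev (pow φ̂ i g)))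
                  (low : ∀ i → (i ≡ 4 ⊎ i ≡ 5 ⊎ i ≡ 6 ⊎ i ≡ 9) → Low (pow φ̂ i g))
                  (four : ∀ i → (i ≡ 0 ⊎ i ≡ 3) → Four (pow φ̂ i g))
                  (special : pow φ̂ 10 (rev (pow φ̂ 1 g)) ≡ rev (pow φ̂ 1 g))
                  (special-low : ∀ i → Low (pow φ̂ i (rev (pow φ̂ 1 g)))) where
    w : ℕ → V
    w = src g

    x = w 0
    z = w 1
    y = w 2
    x′ = w 3
    q = w 4
    a = w 5
    b = w 6
    e = w 7
    d = w 8
    p = w 9

    adj-w : ∀ i → Adj G (w i) (w (suc i))
    adj-w i = src-adj i arc

    turnᵍ : ∀ i → rot (w (suc i)) (w i) ≡ w (2 + i)
    turnᵍ i = sym (src-rot i arc)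

    w10 : w 10 ≡ x
    w10 = cong proj₁ closed

    w11 : w 11 ≡ z
    w11 = cong (proj₁ ∘ φ̂) closed

    px : Adj G p x
    px = subst (Adj G p) w10 (adj-w 9)

    rpd : rot p d ≡ x
    rpd = trans (turnᵍ 8) w10

    rxp : rot x p ≡ z
    rxp = trans (cong (λ u → rot u p) (sym w10)) (trans (turnᵍ 9) w11)

    triᵍ : ∀ i → (i ≡ 0 ⊎ i ≡ 2 ⊎ i ≡ 3 ⊎ i ≡ 5 ⊎ i ≡ 9) → Tri (w (suc i) , w i)
    triᵍ i h = subst (Tri ∘ rev) (pow-src i arc) (tri i h)

    lowᵍ : ∀ i → (i ≡ 4 ⊎ i ≡ 5 ⊎ i ≡ 6 ⊎ i ≡ 9) → Low (w i , w (suc i))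
    lowᵍ i h = subst Low (pow-src i arc) (low i h)

    fourᵍ : ∀ i → (i ≡ 0 ⊎ i ≡ 3) → Four (w i , w (suc i))
    fourᵍ i h = subst Four (pow-src i arc) (four i h)

    zy = adj-w 1
    yz = adj-sym zy
    s = y , z

    s-closed : pow φ̂ 10 s ≡ s
    s-closed = subst (λ t → pow φ̂ 10 t ≡ t) (cong rev (pow-src 1 arc)) special

    s-low : ∀ i → Low (pow φ̂ i s)
    s-low i = subst (λ t → Low (pow φ̂ i t)) (cong rev (pow-src 1 arc)) (special-low i)

    low-y : Low (y , z)
    low-y = s-low 0

    f = rot z y
    low-z : Low (z , f)
    low-z = subst Low (φ̂-dart yz) (s-low 1)

    -- The special face is read from `z`, so that `v 0 = z` and `v 9 = y`. The triangles `z f x` and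
    -- `t₂ y x′` hang on it, with `x = o 0` and `x′ = o 8`.
    base : D
    base = z , f

    base-arc : Arc base
    base-arc = rot-adj z y zy

    φs : φ̂ s ≡ base
    φs = φ̂-dart yz

    base-closed : pow φ̂ 10 base ≡ base
    base-closed = subst (λ t → pow φ̂ 10 t ≡ t) φs (φ-closed 10 1 s-closed)

    base-low : ∀ i → Low (pow φ̂ i base)
    base-low i = subst (λ t → Low (pow φ̂ i t)) φs (subst Low (pow-suc φ̂ i s) (s-low (suc i)))

    rzf : rot z f ≡ x
    rzf = rot-inj z _ _ (rot-adj _ _ base-arc) (adj-sym (adj-w 0)) (trans zfix (sym (turnᵍ 0)))
      where
      zfix : rot z (rot z f) ≡ y
      zfix = rot-inj z _ _ (rot-adj _ _ (rot-adj _ _ base-arc)) zy low-z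

    T₀ = tri-third (adj-sym (adj-w 0)) (triᵍ 0 (inj₁ refl))

    rxz : rot x z ≡ f
    rxz = rot-inj z _ _ (adj-sym (proj₂ (proj₂ (proj₂ T₀)))) base-arc (trans (proj₁ (proj₂ T₀)) (sym rzf))

    base-tri : Tri (rev base)
    base-tri = subst Tri (trans (cong φ̂ (φ̂-dart (adj-sym (adj-w 0)))) (trans (φ̂-dart (rot-adj _ _ (adj-w 0)))
                 (trans (cong (λ u → u , rot u x) rxz) (cong (f ,_) (trans (cong (λ u → rot u x) (sym rxz)) (proj₁ T₀))))))
                 (φ-closed 3 2 (triᵍ 0 (inj₁ refl)))

    open LowFace base base-arc base-closed base-low base-tri

    v1 : v 1 ≡ f
    v1 = cong proj₁ (φ̂-dart base-arc)

    pow9 : pow φ̂ 9 base ≡ s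
    pow9 = trans (cong (pow φ̂ 9) (sym φs)) (trans (sym (pow-suc φ̂ 9 s)) s-closed)

    v9 : v 9 ≡ y
    v9 = cong proj₁ pow9

    v10 : v 10 ≡ z
    v10 = cong proj₁ base-closed

    o0 : o 0 ≡ x
    o0 = trans (cong (rot z) v1) rzf

    T₂ = tri-third (adj-sym (adj-w 2)) (triᵍ 2 (inj₂ (inj₁ refl)))
    t₂ = rot y x′

    v8 : v 8 ≡ t₂
    v8 = rot-inj y _ _ (subst (λ u → Adj G u (v 8)) v9 (adj-sym (src-adj 8 base-arc))) (proj₁ (proj₂ (proj₂ T₂)))
           (trans (trans (cong (λ u → rot u (v 8)) (sym v9)) (trans (sym (src-rot 8 base-arc)) v10))
             (sym (trans (cong (λ u → rot y (rot y u)) (sym (turnᵍ 1))) low-y)))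

    o8 : o 8 ≡ x′
    o8 = trans (cong₂ rot v8 v9) (proj₁ T₂)

    T₃ = tri-third (adj-sym (adj-w 3)) (triᵍ 3 (inj₂ (inj₂ (inj₁ refl))))
    q̂ = rot x′ q

    x′q = adj-w 3
    x′q̂ = rot-adj _ _ x′q

    rot³q : rot x′ (rot x′ q̂) ≡ y
    rot³q = rot-inj x′ _ _ (rot-adj _ _ (rot-adj _ _ x′q̂)) (adj-sym (adj-w 2)) (trans (fourᵍ 3 (inj₂ refl)) (sym (turnᵍ 2)))

    rot²q : rot x′ q̂ ≡ t₂
    rot²q = rot-inj x′ _ _ (rot-adj _ _ x′q̂) (adj-sym (proj₂ (proj₂ (proj₂ T₂)))) (trans rot³q (sym (proj₁ (proj₂ T₂))))

    low-q = lowᵍ 4 (inj₁ refl)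
    qa = adj-w 4

    rot²a : rot q (rot q a) ≡ x′
    rot²a = rot-inj q _ _ (rot-adj _ _ (rot-adj _ _ qa)) (adj-sym x′q) (trans low-q (sym (turnᵍ 3)))

    rqa : rot q a ≡ q̂
    rqa = rot-inj q _ _ (rot-adj _ _ qa) (adj-sym (proj₂ (proj₂ (proj₂ T₃)))) (trans rot²a (sym (proj₁ (proj₂ T₃))))

    -- Re-indexes the face from its `k`-th dart; going back by `k` is going on by `k′`.
    relative : ∀ k k′ → k + k′ ≡ 10 → ∀ j → ∃[ m ] (m < 10 × v j ≡ src (pow φ̂ k base) m)
    relative k k′ sum j = (j + k′) % 10 , m%n<n (j + k′) 10 , cong proj₁ (begin
      pow φ̂ j base                              ≡⟨ cong (pow φ̂ j) (sym base-closed) ⟩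
      pow φ̂ j (pow φ̂ 10 base)                   ≡⟨ cong (λ m → pow φ̂ j (pow φ̂ m base)) (trans (sym sum) (ℕₚ.+-comm k k′)) ⟩
      pow φ̂ j (pow φ̂ (k′ + k) base)             ≡⟨ cong (pow φ̂ j) (pow-+ φ̂ k′ k base) ⟩
      pow φ̂ j (pow φ̂ k′ (pow φ̂ k base))         ≡⟨ pow-+ φ̂ j k′ (pow φ̂ k base) ⟨
      pow φ̂ (j + k′) (pow φ̂ k base)             ≡⟨ pow-mod (φ-closed 10 k base-closed) (j + k′) ⟩
      pow φ̂ ((j + k′) % 10) (pow φ̂ k base)      ∎)
      where open ≡-Reasoning

    b8 = pow φ̂ 8 base
    b8≡ : b8 ≡ (t₂ , y)
    b8≡ = trans (pow-src 8 base-arc) (cong₂ _,_ v8 v9)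
    b8-arc : Arc b8
    b8-arc = pow-isDart 8 base-arc
    b8-tri : Tri (rev b8)
    b8-tri = subst Tri (trans (φ̂-dart (adj-sym (adj-w 2))) (sym (cong rev b8≡))) (φ-closed 3 1 (triᵍ 2 (inj₂ (inj₁ refl))))
    W8 = triangleWalk {10} b8-arc b8-tri (φ-closed 10 8 base-closed)

    -- On the special face, the apex `x′` is adjacent to `t₂` and `y` only, and `q` equal to either
    -- would contradict the degree of `x′`.
    q-off : ∀ j → q ≢ v j
    q-off j eq with relative 8 2 refl j
    ... | 0 , _ , e = proj₂ (deg≥3 x′ q x′q) (trans rot²q (sym (trans (trans eq e) (cong proj₁ b8≡))))
    ... | 1 , _ , e = proj₁ (deg≥3 x′ q x′q) (trans (cong (rot x′) (trans (trans eq e) (trans (src-pow 8 1 base) v9))) (turnᵍ 2))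
    ... | suc (suc m) , m<10 , e = walk10-apex-chordless W8 (s≤s (s≤s z≤n)) m<10
            (subst₂ (Adj G) (sym (trans (cong₂ rot (cong proj₁ b8≡) (cong proj₂ b8≡)) (proj₁ T₂))) (trans eq e) x′q)

    hanging-x′ : Hanging lowCycle 8 q q̂ a
    hanging-x′ = record
      { x-nbrs = λ u h → case four-neighbours x′q (fourᵍ 3 (inj₂ refl)) (subst (λ t → Adj G t u) o8 h) of λ
          { (inj₁ h) → inj₂ (inj₂ (inj₁ h))
          ; (inj₂ (inj₁ h)) → inj₂ (inj₂ (inj₂ h))
          ; (inj₂ (inj₂ (inj₁ h))) → inj₁ (trans h (trans rot²q (sym v8)))
          ; (inj₂ (inj₂ (inj₂ h))) → inj₂ (inj₁ (trans h (trans rot³q (sym v9)))) }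
      ; q-nbrs = λ u h → case low-neighbours qa low-q h of λ
          { (inj₁ h) → inj₂ (inj₂ h)
          ; (inj₂ (inj₁ h)) → inj₂ (inj₁ (trans h rqa))
          ; (inj₂ (inj₂ h)) → inj₁ (trans h (trans rot²a (sym o8))) }
      ; xq = subst (λ t → Adj G t q) (sym o8) x′q
      ; xq̂ = subst (λ t → Adj G t q̂) (sym o8) x′q̂
      ; q-off = q-off
      }

    T₉ = tri-third (adj-sym px) (subst (λ u → Tri (u , p)) w10 (triᵍ 9 (inj₂ (inj₂ (inj₂ (inj₂ refl))))))
    p̂ = rot p x
    xz = adj-w 0
    xp = adj-sym px
    four-x = fourᵍ 0 (inj₁ refl)

    rot³z : rot x (rot x (rot x z)) ≡ p
    rot³z = rot-inj x _ _ (rotⁿ-adj 3 xz) xp (trans four-x (sym rxp))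

    rot²z : rot x (rot x z) ≡ p̂
    rot²z = rot-inj x _ _ (rotⁿ-adj 2 xz) (adj-sym (proj₂ (proj₂ (proj₂ T₉)))) (trans rot³z (sym (proj₁ (proj₂ T₉))))

    p-off : ∀ j → p ≢ v j
    p-off j eq with relative 0 10 refl j
    ... | 0 , _ , h = proj₁ (deg≥3 x p xp) (trans rxp (sym (trans eq h)))
    ... | 1 , _ , h = proj₂ (deg≥3 x p xp) (trans (cong (rot x) rxp) (trans rxz (sym (trans (trans eq h) v1))))
    ... | suc (suc m) , m<10 , h = walk10-apex-chordless W (s≤s (s≤s z≤n)) m<10 (subst₂ (Adj G) (sym rzf) (trans eq h) xp)

    low-p : Low (p , x)
    low-p = subst (λ u → Low (p , u)) w10 (lowᵍ 9 (inj₂ (inj₂ (inj₂ refl))))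

    hanging-x : Hanging lowCycle 0 p p̂ d
    hanging-x = record
      { x-nbrs = λ u h → case four-neighbours xz four-x (subst (λ t → Adj G t u) o0 h) of λ
          { (inj₁ h) → inj₁ h
          ; (inj₂ (inj₁ h)) → inj₂ (inj₁ (trans h (trans rxz (sym v1))))
          ; (inj₂ (inj₂ (inj₁ h))) → inj₂ (inj₂ (inj₂ (trans h rot²z)))
          ; (inj₂ (inj₂ (inj₂ h))) → inj₂ (inj₂ (inj₁ (trans h rot³z))) }
      ; q-nbrs = λ u h → case low-neighbours px low-p h of λ
          { (inj₁ h) → inj₁ (trans h (sym o0))
          ; (inj₂ (inj₁ h)) → inj₂ (inj₁ h)
          ; (inj₂ (inj₂ h)) → inj₂ (inj₂ (trans h
              (rot-inj p _ _ (rotⁿ-adj 2 px) (adj-sym (adj-w 8)) (trans low-p (sym rpd))))) }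
      ; xq = subst (λ t → Adj G t p) (sym o0) xp
      ; xq̂ = subst (λ t → Adj G t p̂) (sym o0) (adj-sym (proj₂ (proj₂ (proj₂ T₉))))
      ; q-off = p-off
      }

    T₅ = tri-third (adj-sym (adj-w 5)) (triᵍ 5 (inj₂ (inj₂ (inj₂ (inj₁ refl)))))
    t = rot a b
    low-a = lowᵍ 5 (inj₂ (inj₁ refl))
    low-b = lowᵍ 6 (inj₂ (inj₂ (inj₁ refl)))
    ab = adj-w 5
    be = adj-w 6

    rot²b : rot a t ≡ q
    rot²b = rot-inj a _ _ (rotⁿ-adj 2 ab) (adj-sym qa) (trans low-a (sym (turnᵍ 4)))

    rot²e : rot b (rot b e) ≡ a
    rot²e = rot-inj b _ _ (rotⁿ-adj 2 be) (adj-sym ab) (trans low-b (sym (turnᵍ 5)))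

    rbe : rot b e ≡ t
    rbe = rot-inj b _ _ (rot-adj _ _ be) (adj-sym (proj₂ (proj₂ (proj₂ T₅)))) (trans rot²e (sym (proj₁ (proj₂ T₅))))

    Wᵍ = triangleWalk {10} arc (subst (Tri ∘ rev) (sym (pow-src 0 arc)) (triᵍ 0 (inj₁ refl))) closed

    -- The cycle can be coloured as soon as one of `x = o 0` and `x′ = o 8` is outside `𝕀`. Each can
    -- be released through its second triangle, `x p p̂` or `x′ q q̂`, unless `d` and `a` are both
    -- in `𝕀`.
    reducible : IFPartitionable G
    reducible with outside
    ... | c , val , blank , filled with c (o 8) ≟ᶜ 𝕀 | c (o 0) ≟ᶜ 𝕀
    ...   | no ≢𝕀 | _ = extend-cycle lowCycle val blank filled 8 ≢𝕀
    ...   | yes _ | no ≢𝕀 = extend-cycle lowCycle val blank filled 0 ≢𝕀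
    ...   | yes cx′ | yes cx with c a ≟ᶜ 𝕀 | c d ≟ᶜ 𝕀
    ...     | no ≢𝕀 | _ = outer-𝕀 lowCycle hanging-x′ val blank filled cx′ ≢𝕀
    ...     | yes _ | no ≢𝕀 = outer-𝕀 lowCycle hanging-x val blank filled cx ≢𝕀
    -- Now `e`, being adjacent to `d`, is outside `𝕀`, so `b` can take over the colour of `a`. This
    -- connects the two ends of the face.
    ...     | yes ca | yes cd = relay lowCycle hanging-x′ val blank filled cx′ {b} {t} {e} ca
      (λ ce → Valid.independent val (adj-w 7) ce cd)
      (λ u h → case low-neighbours ab low-a h of λ
        { (inj₁ h) → inj₂ (inj₁ h) ; (inj₂ (inj₁ h)) → inj₂ (inj₂ h) ; (inj₂ (inj₂ h)) → inj₁ (trans h rot²b) })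
      (λ u h → case low-neighbours be low-b h of λ
        { (inj₁ h) → inj₂ (inj₂ h) ; (inj₂ (inj₁ h)) → inj₂ (inj₁ (trans h rbe)) ; (inj₂ (inj₂ h)) → inj₁ (trans h rot²e) })
      (rot-adj _ _ ab) (adj-sym qa)
      (λ h → proj₂ (deg≥3 a q (adj-sym qa)) (trans (cong (rot a) (turnᵍ 4)) h))
      (λ h → proj₁ (deg≥3 a q (adj-sym qa)) (trans (turnᵍ 4) h))
      (λ h → walk10-distinct Wᵍ {4} {7} (ℕₚ.m≤m+n 5 2) (ℕₚ.m≤m+n 8 2) (sym h))
      (λ h → walk10-distinct Wᵍ {3} {6} (ℕₚ.m≤m+n 4 2) (ℕₚ.m≤m+n 7 3) (sym (trans h o8)))

-- Discharging

data Kind : Set where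
  tri pent other : Kind

data Class : Set where
  low four high : Class

isTri isPent : Kind → Bool
isTri tri = true
isTri _   = false
isPent pent = true
isPent _    = false

isLow isFour : Class → Bool
isLow low = true
isLow _   = false
isFour four = true
isFour _    = false

-- Triangular faces are adjacent neither to each other nor to pentagons.
compatible : Kind → Kind → Bool
compatible tri   tri  = false
compatible tri   pent = false
compatible pent  tri  = false
compatible _     _    = true

-- The charge, in eighths, of a corner whose face has kind k₀ and is followed in the rotation
-- by faces of kinds k₁, k₂, …. Charges are shifted so that each corner starts with 8: a face is
-- satisfied by a total of 48, and a vertex of degree d may hand out 24 d − 48.
lowValue : Kind → Kind → Kind → ℕ
lowValue tri   k₁ k₂ = 16
lowValue pent  k₁ k₂ = if isPent k₁ ∨ isPent k₂ then 9 else 12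
lowValue other k₁ k₂ = if isTri k₁ ∨ isTri k₂ then 4 else if isPent k₁ ∨ isPent k₂ then 6 else 8

-- The budget at degree 4 is 24 · 4 - 48 = 48, of which a triangle takes 16. Its successors around
-- the vertex get 8, 16, 8 if the opposite face is a triangle, 10, 12, 10 if it is a pentagon
-- between other faces, and 12, 8, 12 if all three are other faces.
fourValue : Kind → Kind → Kind → Kind → ℕ
fourValue tri   _    _   _    = 16
fourValue _     tri  _   tri  = 8
fourValue _     tri  _   pent = 10
fourValue _     pent _   tri  = 10
fourValue _     tri  _   _    = 12
fourValue _     _    _   tri  = 12
fourValue other _    tri _    = 8
fourValue _     _    _   _    = 12

highValue : Kind → ℕ
highValue k = if isTri k then 16 else 12

value : Class → Kind → Kind → Kind → Kind → ℕ
value low  k₀ k₁ k₂ k₃ = lowValue k₀ k₁ k₂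
value four k₀ k₁ k₂ k₃ = fourValue k₀ k₁ k₂ k₃
value high k₀ k₁ k₂ k₃ = highValue k₀

everyKind : (Kind → Bool) → Bool
everyKind p = p tri ∧ p pent ∧ p other

everyKind⁻ : ∀ {p} → everyKind p ≡ true → ∀ k → p k ≡ true
everyKind⁻ {p} h tri = proj₁ (∧-≡ h)
everyKind⁻ {p} h pent = proj₁ (∧-≡ {p pent} (proj₂ (∧-≡ {p tri} h)))
everyKind⁻ {p} h other = proj₂ (∧-≡ {p pent} (proj₂ (∧-≡ {p tri} h)))

infixr 4 _⇒ᵇ_
_⇒ᵇ_ : Bool → Bool → Bool
a ⇒ᵇ b = not a ∨ b

⇒ᵇ⁻ : ∀ {a b} → (a ⇒ᵇ b) ≡ true → a ≡ true → b ≡ true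
⇒ᵇ⁻ h refl = h

≤ᵇ⁻ : ∀ {m n} → (m ≤ᵇ n) ≡ true → m ≤ n
≤ᵇ⁻ {m} {n} h = ℕₚ.≤ᵇ⇒≤ m n (≡⇒T h)

value≤16 : ∀ c k₀ k₁ k₂ k₃ → value c k₀ k₁ k₂ k₃ ≤ 16
value≤16 low k₀ k₁ k₂ k₃ = ≤ᵇ⁻ {lowValue k₀ k₁ k₂} (everyKind⁻ {λ k₂ → lowValue k₀ k₁ k₂ ≤ᵇ 16} (everyKind⁻ {λ k₁ → everyKind λ k₂ → lowValue k₀ k₁ k₂ ≤ᵇ 16}
  (everyKind⁻ {λ k₀ → everyKind λ k₁ → everyKind λ k₂ → lowValue k₀ k₁ k₂ ≤ᵇ 16} refl k₀) k₁) k₂)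
value≤16 four k₀ k₁ k₂ k₃ = ≤ᵇ⁻ {fourValue k₀ k₁ k₂ k₃} (everyKind⁻ {λ k₃ → fourValue k₀ k₁ k₂ k₃ ≤ᵇ 16} (everyKind⁻ {λ k₂ → everyKind λ k₃ → fourValue k₀ k₁ k₂ k₃ ≤ᵇ 16}
  (everyKind⁻ {λ k₁ → everyKind λ k₂ → everyKind λ k₃ → fourValue k₀ k₁ k₂ k₃ ≤ᵇ 16}
  (everyKind⁻ {λ k₀ → everyKind λ k₁ → everyKind λ k₂ → everyKind λ k₃ → fourValue k₀ k₁ k₂ k₃ ≤ᵇ 16} refl k₀) k₁) k₂) k₃)
value≤16 high tri   _ _ _ = ℕₚ.≤-refl
value≤16 high pent  _ _ _ = ℕₚ.m≤m+n 12 4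
value≤16 high other _ _ _ = ℕₚ.m≤m+n 12 4

-- The budget at degree 3 is 24. Three pentagons would take 9 each, which is why they have to be
-- excluded.
low-vertex : ∀ k₀ k₁ k₂ → compatible k₀ k₁ ≡ true → compatible k₁ k₂ ≡ true → compatible k₂ k₀ ≡ true →
             isPent k₀ ∧ isPent k₁ ∧ isPent k₂ ≡ false →
             lowValue k₀ k₁ k₂ + lowValue k₁ k₂ k₀ + lowValue k₂ k₀ k₁ ≤ 24
low-vertex k₀ k₁ k₂ h₀ h₁ h₂ h₃ = ≤ᵇ⁻ {lowValue k₀ k₁ k₂ + lowValue k₁ k₂ k₀ + lowValue k₂ k₀ k₁}
  (⇒ᵇ⁻ (everyKind⁻ {claim k₀ k₁} (everyKind⁻ {λ k₁ → everyKind (claim k₀ k₁)} (everyKind⁻ {λ k₀ → everyKind λ k₁ → everyKind (claim k₀ k₁)} refl k₀) k₁) k₂)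
    (cong₂ _∧_ h₀ (cong₂ _∧_ h₁ (cong₂ _∧_ h₂ (cong not h₃)))))
  where
  claim : Kind → Kind → Kind → Bool
  claim k₀ k₁ k₂ = (compatible k₀ k₁ ∧ compatible k₁ k₂ ∧ compatible k₂ k₀ ∧ not (isPent k₀ ∧ isPent k₁ ∧ isPent k₂)) ⇒ᵇ
                   (lowValue k₀ k₁ k₂ + lowValue k₁ k₂ k₀ + lowValue k₂ k₀ k₁ ≤ᵇ 24)

four-vertex : ∀ k₀ k₁ k₂ k₃ → compatible k₀ k₁ ≡ true → compatible k₁ k₂ ≡ true → compatible k₂ k₃ ≡ true → compatible k₃ k₀ ≡ true →
              fourValue k₀ k₁ k₂ k₃ + fourValue k₁ k₂ k₃ k₀ + fourValue k₂ k₃ k₀ k₁ + fourValue k₃ k₀ k₁ k₂ ≤ 48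
four-vertex k₀ k₁ k₂ k₃ h₀ h₁ h₂ h₃ = ≤ᵇ⁻ {total k₀ k₁ k₂ k₃}
  (⇒ᵇ⁻ (everyKind⁻ {claim k₀ k₁ k₂} (everyKind⁻ {λ k₂ → everyKind (claim k₀ k₁ k₂)} (everyKind⁻ {λ k₁ → everyKind λ k₂ → everyKind (claim k₀ k₁ k₂)}
    (everyKind⁻ {λ k₀ → everyKind λ k₁ → everyKind λ k₂ → everyKind (claim k₀ k₁ k₂)} refl k₀) k₁) k₂) k₃)
    (cong₂ _∧_ h₀ (cong₂ _∧_ h₁ (cong₂ _∧_ h₂ h₃))))
  where
  total : Kind → Kind → Kind → Kind → ℕ
  total k₀ k₁ k₂ k₃ = fourValue k₀ k₁ k₂ k₃ + fourValue k₁ k₂ k₃ k₀ + fourValue k₂ k₃ k₀ k₁ + fourValue k₃ k₀ k₁ k₂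
  claim : Kind → Kind → Kind → Kind → Bool
  claim k₀ k₁ k₂ k₃ = (compatible k₀ k₁ ∧ compatible k₁ k₂ ∧ compatible k₂ k₃ ∧ compatible k₃ k₀) ⇒ᵇ (total k₀ k₁ k₂ k₃ ≤ᵇ 48)

-- Each of the two disjoint compatible pairs takes at most 16 + 12 and the fifth corner at most 16;
-- the sum 72 is the budget 24 · 5 - 48.
five-vertex : ∀ k₀ k₁ k₂ k₃ k₄ → compatible k₀ k₁ ≡ true → compatible k₂ k₃ ≡ true →
              highValue k₀ + highValue k₁ + highValue k₂ + highValue k₃ + highValue k₄ ≤ 72
five-vertex k₀ k₁ k₂ k₃ k₄ h₀ h₁ = ≤ᵇ⁻ {total k₀ k₁ k₂ k₃ k₄}
  (⇒ᵇ⁻ (everyKind⁻ {claim k₀ k₁ k₂ k₃} (everyKind⁻ {λ k₃ → everyKind (claim k₀ k₁ k₂ k₃)} (everyKind⁻ {λ k₂ → everyKind λ k₃ → everyKind (claim k₀ k₁ k₂ k₃)}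
    (everyKind⁻ {λ k₁ → everyKind λ k₂ → everyKind λ k₃ → everyKind (claim k₀ k₁ k₂ k₃)}
    (everyKind⁻ {λ k₀ → everyKind λ k₁ → everyKind λ k₂ → everyKind λ k₃ → everyKind (claim k₀ k₁ k₂ k₃)} refl k₀) k₁) k₂) k₃) k₄)
    (cong₂ _∧_ h₀ h₁))
  where
  total : Kind → Kind → Kind → Kind → Kind → ℕ
  total k₀ k₁ k₂ k₃ k₄ = highValue k₀ + highValue k₁ + highValue k₂ + highValue k₃ + highValue k₄
  claim : Kind → Kind → Kind → Kind → Kind → Bool
  claim k₀ k₁ k₂ k₃ k₄ = (compatible k₀ k₁ ∧ compatible k₂ k₃) ⇒ᵇ (total k₀ k₁ k₂ k₃ k₄ ≤ᵇ 72)

-- A face boundary is read as a cyclic word; a letter is the class of a vertex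
-- together with the kind of the face across the edge leaving it.
Letter : Set
Letter = Class × Kind

letters : List Letter
letters = (low , tri) ∷ (low , pent) ∷ (low , other) ∷ (four , tri) ∷ (four , pent) ∷ (four , other)
        ∷ (high , tri) ∷ (high , pent) ∷ (high , other) ∷ []

every : ∀ {p : Letter → Bool} → all p letters ≡ true → ∀ l → p l ≡ true
every {p} h l = go l
  where
  at : ∀ i → p (List.lookup letters i) ≡ true
  at = all⁻ p letters h
  go : ∀ l → p l ≡ true
  go (low , tri)    = at zero
  go (low , pent)   = at (suc zero)
  go (low , other)  = at (suc (suc zero))
  go (four , tri)   = at (suc (suc (suc zero)))
  go (four , pent)  = at (suc (suc (suc (suc zero))))
  go (four , other) = at (suc (suc (suc (suc (suc zero)))))
  go (high , tri)   = at (suc (suc (suc (suc (suc (suc zero))))))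
  go (high , pent)  = at (suc (suc (suc (suc (suc (suc (suc zero)))))))
  go (high , other) = at (suc (suc (suc (suc (suc (suc (suc (suc zero))))))))

-- Lower bound for the value of a corner of a long face, from the kinds across its two edges.
cornerBound : Kind → Letter → ℕ
cornerBound k′ (low , k)  = lowValue other k k′
-- The kind of the opposite face is unknown. A triangle is the worst case, but it cannot stand next
-- to a pentagon.
cornerBound k′ (four , k) = fourValue other k (if isPent k ∨ isPent k′ then other else tri) k′
cornerBound k′ (high , k) = 12

-- At a vertex of degree 3, the faces across the two boundary edges share the third edge.
legal : Kind → Letter → Bool
legal k′ (low , k) = compatible k′ k
legal k′ _         = true

-- The same bound after a possible loss through the edge following the corner's edge.
reducedBound : Kind → Letter → ℕ
reducedBound k′ (c , k) = cornerBound k′ (c , k) ∸ (if not (isLow c) ∧ isTri k then 2 else 0)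

matches : List (Letter → Bool) → (ℕ → Letter) → Bool
matches []       U = true
matches (p ∷ ps) U = p (U 0) ∧ matches ps (U ∘ suc)

-- The patterns combine `low` with any kind, but `four` with `tri` only, and the last clause is this
-- second test.
is : Class → Kind → Letter → Bool
is low   k (c , k′) = isLow c ∧ sameKind k k′
  where
  sameKind : Kind → Kind → Bool
  sameKind tri   = isTri
  sameKind pent  = isPent
  sameKind other k = not (isTri k) ∧ not (isPent k)
is _     k (c , k′) = isFour c ∧ isTri k′

hasKindTri notLow : Letter → Bool
hasKindTri (_ , k) = isTri k
notLow (c , _) = not (isLow c)

-- The letters at `x`, `z`, `y`, `x′` when the face pays across `z y`: `x z` and `y x′` lie on
-- triangles whose apexes, seen from the special face, are `x` and `x′`, so these do not have degree
-- 3.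
lossPattern : List (Letter → Bool)
lossPattern = (λ l → notLow l ∧ hasKindTri l) ∷ is low other ∷ is low tri ∷ notLow ∷ []

-- Such a face is guaranteed exactly 48: 8 at each of the two vertices of degree 4 and 4 at the
-- other eight. Nothing is left for the 2 that it would pay across its second edge.
crossingPattern : List (Letter → Bool)
crossingPattern = is four tri ∷ is low other ∷ is low tri ∷ is four tri ∷ is low other ∷ is low tri
                ∷ is low other ∷ is low tri ∷ is low other ∷ is low tri ∷ []

gainPattern : List (Letter → Bool)
gainPattern = hasKindTri ∷ (λ _ → true) ∷ hasKindTri ∷ []

loses : ℕ → (ℕ → Letter) → Bool
loses ℓ U = matches lossPattern U ∧ not ((ℓ ≡ᵇ 10) ∧ matches crossingPattern U)

from : ℕ → (ℕ → Letter) → ℕ → Letter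
from j U i = U (i + j)

sumTo : ℕ → (ℕ → ℕ) → ℕ
sumTo zero    f = 0
sumTo (suc n) f = f 0 + sumTo n (f ∘ suc)

sumTo-cong : ∀ n {f g : ℕ → ℕ} → (∀ i → f i ≡ g i) → sumTo n f ≡ sumTo n g
sumTo-cong zero    h = refl
sumTo-cong (suc n) h = cong₂ _+_ (h 0) (sumTo-cong n (h ∘ suc))

allLow : ℕ → (ℕ → Letter) → Bool
allLow zero    U = true
allLow (suc n) U = isLow (proj₁ (U 0)) ∧ allLow n (U ∘ suc)

gains : ℕ → (ℕ → Letter) → ℕ
gains ℓ U = if (ℓ ≡ᵇ 10) ∧ allLow ℓ U then 2 * sumTo ℓ (λ j → when (matches gainPattern (from j U)) 1) else 0

required provided : ℕ → (ℕ → Letter) → ℕ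
required ℓ U = 48 + 2 * sumTo ℓ (λ j → when (loses ℓ (from j U)) 1)
provided ℓ U = sumTo ℓ (λ j → cornerBound (proj₂ (U j)) (U (suc j))) + gains ℓ U

opaque
  balanced : ℕ → (ℕ → Letter) → Bool
  balanced ℓ U = required ℓ U ≤ᵇ provided ℓ U

  balanced⁻ : ∀ {ℓ U} → balanced ℓ U ≡ true → required ℓ U ≤ provided ℓ U
  balanced⁻ {ℓ} {U} h = ≤ᵇ⁻ {required ℓ U} {provided ℓ U} h

nth : List Letter → ℕ → Letter
nth []       i       = low , other
nth (l ∷ ls) zero    = l
nth (l ∷ ls) (suc i) = nth ls i

residue : ℕ → ℕ → ℕ
residue zero    i = i
residue (suc ℓ) i = i % suc ℓ

-- Every corner still to come keeps at least 4, so a prefix is dropped once 48 is certain.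
search : ℕ → ℕ → List Letter → Letter → ℕ → Bool
search ℓ zero    ls l acc = legal (proj₂ l) (nth ls 0) ⇒ᵇ ((48 ≤ᵇ acc) ∨ balanced ℓ (nth ls ∘ residue ℓ))
search ℓ (suc r) ls l acc = (48 ≤ᵇ 4 * suc r + acc) ∨
  all (λ l′ → legal (proj₂ l) l′ ⇒ᵇ search ℓ r (ls ++ l′ ∷ []) l′ (reducedBound (proj₂ l) l′ + acc)) letters

reducedBound≥4 : ∀ k′ l → legal k′ l ≡ true → 4 ≤ reducedBound k′ l
reducedBound≥4 k′ l h = ≤ᵇ⁻ (⇒ᵇ⁻ (every {λ l → legal k′ l ⇒ᵇ (4 ≤ᵇ reducedBound k′ l)}
  (everyKind⁻ {λ k′ → all (λ l → legal k′ l ⇒ᵇ (4 ≤ᵇ reducedBound k′ l)) letters} refl k′) l) h)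

opaque
  unfolding balanced

  -- The value at the first letter depends on the last one, so it enters with the general minimum 4.
  search10 : all (λ l → search 10 9 (l ∷ []) l 4) letters ≡ true
  search10 = refl

  search11 : all (λ l → search 11 10 (l ∷ []) l 4) letters ≡ true
  search11 = refl

prefix : (ℕ → Letter) → ℕ → List Letter
prefix U zero    = []
prefix U (suc m) = prefix U m ++ U m ∷ []

length-prefix : ∀ U m → length (prefix U m) ≡ m
length-prefix U zero    = refl
length-prefix U (suc m) = trans (Listₚ.length-++ (prefix U m)) (trans (ℕₚ.+-comm _ 1) (cong suc (length-prefix U m)))

nth-prefix : ∀ U m {i} → i < m → nth (prefix U m) i ≡ U i
nth-prefix U (suc m) {i} (s≤s i≤m) with ℕₚ.m≤n⇒m<n∨m≡n i≤m
... | inj₁ i<m = trans (nth-++ (prefix U m) (subst (i <_) (sym (length-prefix U m)) i<m)) (nth-prefix U m i<m)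
  where
  nth-++ : ∀ ls {l i} → i < length ls → nth (ls ++ l ∷ []) i ≡ nth ls i
  nth-++ (l ∷ ls) {i = zero}  _ = refl
  nth-++ (l ∷ ls) {i = suc i} (s≤s h) = nth-++ ls h
... | inj₂ refl = trans (cong (nth (prefix U i ++ U i ∷ [])) (sym (length-prefix U i))) (nth-last (prefix U i))
  where
  nth-last : ∀ ls {l} → nth (ls ++ l ∷ []) (length ls) ≡ l
  nth-last []       = refl
  nth-last (l ∷ ls) = nth-last ls

matches-cong : ∀ ps {U U′ : ℕ → Letter} → (∀ i → U i ≡ U′ i) → matches ps U ≡ matches ps U′
matches-cong []       h = refl
matches-cong (p ∷ ps) h = cong₂ _∧_ (cong p (h 0)) (matches-cong ps (h ∘ suc))

allLow-cong : ∀ n {U U′ : ℕ → Letter} → (∀ i → U i ≡ U′ i) → allLow n U ≡ allLow n U′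
allLow-cong zero    h = refl
allLow-cong (suc n) h = cong₂ _∧_ (cong (isLow ∘ proj₁) (h 0)) (allLow-cong n (h ∘ suc))

module _ (ℓ : ℕ) (U : ℕ → Letter) (legal-U : ∀ i → legal (proj₂ (U i)) (U (suc i)) ≡ true) where
  private
    bound : ℕ → ℕ
    bound i = reducedBound (proj₂ (U i)) (U (suc i))

    shifted : ℕ → ℕ → ℕ
    shifted m i = bound (i + m)

    bound-sum : ∀ m r → 4 * r ≤ sumTo r (shifted m)
    bound-sum m zero = z≤n
    bound-sum m (suc r) = subst (_≤ sumTo (suc r) (shifted m)) (sym (ℕₚ.*-suc 4 r))
      (ℕₚ.+-mono-≤ (reducedBound≥4 (proj₂ (U m)) (U (suc m)) (legal-U m)) (ℕₚ.≤-trans (bound-sum (suc m) r)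
        (ℕₚ.≤-reflexive (sumTo-cong r λ i → cong bound (ℕₚ.+-suc i m)))))

  search-sound : ∀ r m acc → legal (proj₂ (U (r + m))) (U 0) ≡ true → search ℓ r (prefix U (suc m)) (U m) acc ≡ true →
    48 ≤ acc + sumTo r (λ i → reducedBound (proj₂ (U (i + m))) (U (suc (i + m)))) ⊎ balanced ℓ (nth (prefix U (suc (r + m))) ∘ residue ℓ) ≡ true
  search-sound zero m acc c h with ∨-≡ {48 ≤ᵇ acc} (⇒ᵇ⁻ h (trans (cong (legal (proj₂ (U m))) (nth-prefix U (suc m) (s≤s z≤n))) c))
  ... | inj₁ e = inj₁ (ℕₚ.≤-trans (≤ᵇ⁻ {48} e) (ℕₚ.m≤m+n acc 0))
  ... | inj₂ e = inj₂ e
  search-sound (suc r) m acc c h with ∨-≡ {48 ≤ᵇ 4 * suc r + acc} h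
  ... | inj₁ e = inj₁ (ℕₚ.≤-trans (≤ᵇ⁻ {48} e) (ℕₚ.≤-trans (ℕₚ.≤-reflexive (ℕₚ.+-comm (4 * suc r) acc)) (ℕₚ.+-monoʳ-≤ acc (bound-sum m (suc r)))))
  ... | inj₂ e with search-sound r (suc m) (bound m + acc) (subst (λ k → legal (proj₂ (U k)) (U 0) ≡ true) (sym (ℕₚ.+-suc r m)) c)
        (⇒ᵇ⁻ (every {λ l′ → legal (proj₂ (U m)) l′ ⇒ᵇ search ℓ r (prefix U (suc m) ++ l′ ∷ []) l′ (reducedBound (proj₂ (U m)) l′ + acc)} e (U (suc m))) (legal-U m))
  ...   | inj₁ big = inj₁ (ℕₚ.≤-trans big (ℕₚ.≤-reflexive (trans (cong (_+ sumTo r (shifted (suc m))) (ℕₚ.+-comm (bound m) acc))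
            (trans (ℕₚ.+-assoc acc (bound m) _) (cong (λ s → acc + (bound m + s)) (sumTo-cong r λ i → cong bound (ℕₚ.+-suc i m)))))))
  ...   | inj₂ g = inj₂ (subst (λ k → balanced ℓ (nth (prefix U (suc k)) ∘ residue ℓ) ≡ true) (ℕₚ.+-suc r m) g)

  -- Reduced bounds deduct a loss wherever one could fall on the corner. If they do not add up to
  -- 48, the losses and gains of the whole cyclic word are counted by their patterns.
  balanced-word : (∀ i → U (ℓ + i) ≡ U i) → ∀ r → suc r ≡ ℓ → all (λ l → search ℓ r (l ∷ []) l 4) letters ≡ true →
    48 ≤ sumTo ℓ (λ i → reducedBound (proj₂ (U i)) (U (suc i))) ⊎ required ℓ U ≤ provided ℓ U
  balanced-word periodic r refl h with search-sound r 0 4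
    (subst₂ (λ k l → legal (proj₂ (U k)) l ≡ true) (sym (ℕₚ.+-identityʳ r)) (trans (cong U (cong suc (sym (ℕₚ.+-identityʳ r)))) (periodic 0)) (legal-U r))
    (every {λ l → search ℓ r (l ∷ []) l 4} h (U 0))
  ... | inj₁ big = inj₁ (ℕₚ.≤-trans big (ℕₚ.≤-trans
          (ℕₚ.+-monoˡ-≤ (sumTo r (shifted 0)) (reducedBound≥4 (proj₂ (U r)) (U (suc r)) (legal-U r)))
          (ℕₚ.≤-reflexive (trans (ℕₚ.+-comm (bound r) _) (trans (cong (_+ bound r) (sumTo-cong r λ i → cong bound (ℕₚ.+-identityʳ i))) (sumTo-last r bound))))))
    where
    sumTo-last : ∀ n f → sumTo n f + f n ≡ sumTo (suc n) f
    sumTo-last zero    f = sym (ℕₚ.+-identityʳ (f 0))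
    sumTo-last (suc n) f = trans (ℕₚ.+-assoc (f 0) _ _) (cong (f 0 +_) (sumTo-last n (f ∘ suc)))
  ... | inj₂ g = inj₂ (subst₂ _≤_
          (cong (λ s → 48 + 2 * s) (sumTo-cong ℓ λ j → cong (λ b → when b 1) (loses-cong λ i → same (i + j))))
          (cong₂ _+_ (sumTo-cong ℓ λ j → cong₂ (λ a b → cornerBound (proj₂ a) b) (same j) (same (suc j))) gains-cong)
          (balanced⁻ g))
    where
    U′ = nth (prefix U (suc (r + 0))) ∘ residue ℓ
    U-period* : ∀ q i → U (q * ℓ + i) ≡ U i
    U-period* zero    i = refl
    U-period* (suc q) i = trans (cong U (ℕₚ.+-assoc ℓ (q * ℓ) i)) (trans (periodic (q * ℓ + i)) (U-period* q i))
    same : ∀ i → U′ i ≡ U i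
    same i = trans (nth-prefix U (suc (r + 0)) (subst (λ k → i % ℓ < suc k) (sym (ℕₚ.+-identityʳ r)) (m%n<n i ℓ)))
      (sym (trans (cong U (trans (m≡m%n+[m/n]*n i ℓ) (ℕₚ.+-comm (i % ℓ) _))) (U-period* (i / ℓ) (i % ℓ))))
    loses-cong : ∀ {X Y : ℕ → Letter} → (∀ i → X i ≡ Y i) → loses ℓ X ≡ loses ℓ Y
    loses-cong h = cong₂ (λ a b → a ∧ not ((ℓ ≡ᵇ 10) ∧ b)) (matches-cong lossPattern h) (matches-cong crossingPattern h)
    gains-cong : gains ℓ U′ ≡ gains ℓ U
    gains-cong = cong₂ (λ a s → if (ℓ ≡ᵇ 10) ∧ a then 2 * s else 0) (allLow-cong ℓ same)
      (sumTo-cong ℓ λ j → cong (λ b → when b 1) (matches-cong gainPattern λ i → same (i + j)))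

∑≡sumTo : ∀ m (f : ℕ → ℕ) → ∑ {m} (f ∘ toℕ) ≡ sumTo m f
∑≡sumTo zero    f = refl
∑≡sumTo (suc m) f = cong (f 0 +_) (∑≡sumTo m (f ∘ suc))

sumTo-mono : ∀ m {f g : ℕ → ℕ} → (∀ i → f i ≤ g i) → sumTo m f ≤ sumTo m g
sumTo-mono zero    h = z≤n
sumTo-mono (suc m) h = ℕₚ.+-mono-≤ (h 0) (sumTo-mono m (h ∘ suc))

sumTo-const : ∀ m c → sumTo m (λ _ → c) ≡ m * c
sumTo-const zero    c = refl
sumTo-const (suc m) c = cong (c +_) (sumTo-const m c)

sumTo-+ : ∀ m (f g : ℕ → ℕ) → sumTo m (λ i → f i + g i) ≡ sumTo m f + sumTo m g
sumTo-+ zero    f g = refl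
sumTo-+ (suc m) f g = trans (cong (f 0 + g 0 +_) (sumTo-+ m (f ∘ suc) (g ∘ suc))) (interchange (f 0) (g 0) _ _)
  where
  interchange : ∀ a b c d → a + b + (c + d) ≡ a + c + (b + d)
  interchange = solve-∀

sumTo-shift : ∀ m (f : ℕ → ℕ) → f m ≡ f 0 → sumTo m (f ∘ suc) ≡ sumTo m f
sumTo-shift m f h = ℕₚ.+-cancelˡ-≡ (f 0) _ _ (trans (last m f) (trans (cong (sumTo m f +_) h) (ℕₚ.+-comm _ (f 0))))
  where
  last : ∀ n f → sumTo (suc n) f ≡ sumTo n f + f n
  last zero    f = ℕₚ.+-identityʳ (f 0)
  last (suc n) f = trans (cong (f 0 +_) (last n (f ∘ suc))) (sym (ℕₚ.+-assoc (f 0) _ _))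

-- Charges around a vertex

module Discharging (G : Graph) (R : RotationSystem G) (S : Sparse G)
             (deg≥3 : MinDegree≥3 G R) where
  open Graph G hiding (sym)
  open RotationSystem R
  open Embedding G R
  open Enum E using (_≟_)
  open Darts G R S deg≥3

  Tri? : ∀ d → Dec (Tri d)
  Tri? d = pow φ̂ 3 d ≟ d

  Pent? : ∀ d → Dec (Pent d)
  Pent? d = pow φ̂ 5 d ≟ d

  Low? : ∀ d → Dec (Low d)
  Low? (u , v) = pow (rot u) 3 v Finₚ.≟ v

  Four? : ∀ d → Dec (Four d)
  Four? (u , v) = pow (rot u) 4 v Finₚ.≟ v

  opaque
    kind : D → Kind
    kind d = if does (Tri? d) then tri else if does (Pent? d) then pent else other

    kind-cases : ∀ d → (Tri d × kind d ≡ tri) ⊎ (¬ Tri d × Pent d × kind d ≡ pent) ⊎ (¬ Tri d × ¬ Pent d × kind d ≡ other)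
    kind-cases d with Tri? d | Pent? d
    ... | yes t | _     = inj₁ (t , refl)
    ... | no ¬t | yes p = inj₂ (inj₁ (¬t , p , refl))
    ... | no ¬t | no ¬p = inj₂ (inj₂ (¬t , ¬p , refl))

    class : D → Class
    class d = if does (Low? d) then low else if does (Four? d) then four else high

    class-cases : ∀ d → (Low d × class d ≡ low) ⊎ (¬ Low d × Four d × class d ≡ four) ⊎ (¬ Low d × ¬ Four d × class d ≡ high)
    class-cases d with Low? d | Four? d
    ... | yes t | _     = inj₁ (t , refl)
    ... | no ¬t | yes p = inj₂ (inj₁ (¬t , p , refl))
    ... | no ¬t | no ¬p = inj₂ (inj₂ (¬t , ¬p , refl))

  kind-tri : ∀ {d} → Tri d → kind d ≡ tri
  kind-tri {d} t with kind-cases d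
  ... | inj₁ (_ , e) = e
  ... | inj₂ (inj₁ (¬t , _)) = ⊥-elim (¬t t)
  ... | inj₂ (inj₂ (¬t , _)) = ⊥-elim (¬t t)

  kind-other : ∀ {d} → ¬ Tri d → ¬ Pent d → kind d ≡ other
  kind-other {d} ¬t ¬p with kind-cases d
  ... | inj₁ (t , _) = ⊥-elim (¬t t)
  ... | inj₂ (inj₁ (_ , p , _)) = ⊥-elim (¬p p)
  ... | inj₂ (inj₂ (_ , _ , e)) = e

  kind-tri⁻ : ∀ {d} → isTri (kind d) ≡ true → Tri d
  kind-tri⁻ {d} h with kind-cases d
  ... | inj₁ (t , _) = t
  ... | inj₂ (inj₁ (_ , _ , e)) rewrite e = case h of λ ()
  ... | inj₂ (inj₂ (_ , _ , e)) rewrite e = case h of λ ()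

  kind-pent⁻ : ∀ {d} → isPent (kind d) ≡ true → Pent d
  kind-pent⁻ {d} h with kind-cases d
  ... | inj₂ (inj₁ (_ , p , _)) = p
  ... | inj₁ (_ , e) rewrite e = case h of λ ()
  ... | inj₂ (inj₂ (_ , _ , e)) rewrite e = case h of λ ()

  class-low : ∀ {d} → Low d → class d ≡ low
  class-low {d} l with class-cases d
  ... | inj₁ (_ , e) = e
  ... | inj₂ (inj₁ (¬l , _)) = ⊥-elim (¬l l)
  ... | inj₂ (inj₂ (¬l , _)) = ⊥-elim (¬l l)

  class-low⁻ : ∀ {d} → isLow (class d) ≡ true → Low d
  class-low⁻ {d} h with class-cases d
  ... | inj₁ (l , _) = l
  ... | inj₂ (inj₁ (_ , _ , e)) rewrite e = case h of λ ()
  ... | inj₂ (inj₂ (_ , _ , e)) rewrite e = case h of λ ()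

  class-notLow : ∀ {d} → ¬ Low d → isLow (class d) ≡ false
  class-notLow ¬l = ¬T⇒≡false λ t → ¬l (class-low⁻ (T⇒≡ t))

  class-four⁻ : ∀ {d} → isFour (class d) ≡ true → Four d
  class-four⁻ {d} h with class-cases d
  ... | inj₂ (inj₁ (_ , f , _)) = f
  ... | inj₁ (_ , e) rewrite e = case h of λ ()
  ... | inj₂ (inj₂ (_ , _ , e)) rewrite e = case h of λ ()

  kind-φ : ∀ d → kind (φ̂ d) ≡ kind d
  kind-φ d with kind-cases d | kind-cases (φ̂ d)
  ... | inj₁ (_ , e) | inj₁ (_ , e′) = trans e′ (sym e)
  ... | inj₂ (inj₁ (_ , _ , e)) | inj₂ (inj₁ (_ , _ , e′)) = trans e′ (sym e)
  ... | inj₂ (inj₂ (_ , _ , e)) | inj₂ (inj₂ (_ , _ , e′)) = trans e′ (sym e)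
  ... | inj₁ (t , _) | inj₂ (inj₁ (¬t , _)) = ⊥-elim (¬t (φ-closed 3 1 t))
  ... | inj₁ (t , _) | inj₂ (inj₂ (¬t , _)) = ⊥-elim (¬t (φ-closed 3 1 t))
  ... | inj₂ (inj₁ (¬t , _)) | inj₁ (t , _) = ⊥-elim (¬t (φ-closed⁻ 3 1 t))
  ... | inj₂ (inj₂ (¬t , _)) | inj₁ (t , _) = ⊥-elim (¬t (φ-closed⁻ 3 1 t))
  ... | inj₂ (inj₁ (_ , p , _)) | inj₂ (inj₂ (_ , ¬p , _)) = ⊥-elim (¬p (φ-closed 5 1 p))
  ... | inj₂ (inj₂ (_ , ¬p , _)) | inj₂ (inj₁ (_ , p , _)) = ⊥-elim (¬p (φ-closed⁻ 5 1 p))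

  kind-pow : ∀ i d → kind (pow φ̂ i d) ≡ kind d
  kind-pow zero    d = refl
  kind-pow (suc i) d = trans (kind-φ (pow φ̂ i d)) (kind-pow i d)

  kind-spin : ∀ {d} → Arc d → kind (spin d) ≡ kind (rev d)
  kind-spin {d} dd = trans (cong kind (sym (φ-rev dd))) (kind-φ (rev d))

  tri-spin : ∀ {d} → Arc d → Tri (spin d) → Tri (rev d)
  tri-spin dd t = φ-closed⁻ 3 1 (subst Tri (sym (φ-rev dd)) t)

  compatible-rev : ∀ {d} → Arc d → compatible (kind d) (kind (rev d)) ≡ true
  compatible-rev {d} dd with kind-cases d | kind-cases (rev d)
  ... | inj₁ (t , _) | inj₁ (t′ , _) = ⊥-elim (no-two-tri dd t t′)
  ... | inj₁ (t , _) | inj₂ (inj₁ (_ , p , _)) = ⊥-elim (tri-not-5 (adj-sym dd) t p)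
  ... | inj₂ (inj₁ (_ , p , _)) | inj₁ (t , _) = ⊥-elim (tri-not-5 dd t p)
  ... | inj₁ (_ , e) | inj₂ (inj₂ (_ , _ , e′)) rewrite e | e′ = refl
  ... | inj₂ (inj₁ (_ , _ , e)) | inj₂ (inj₁ (_ , _ , e′)) rewrite e | e′ = refl
  ... | inj₂ (inj₁ (_ , _ , e)) | inj₂ (inj₂ (_ , _ , e′)) rewrite e | e′ = refl
  ... | inj₂ (inj₂ (_ , _ , e)) | _ rewrite e = refl

  compatible-spin : ∀ {d} → Arc d → compatible (kind d) (kind (spin d)) ≡ true
  compatible-spin dd = trans (cong (compatible _) (kind-spin dd)) (compatible-rev dd)

  class-same : ∀ {u v w} → Adj G u v → Adj G u w → class (u , v) ≡ class (u , w)
  class-same {u} {v} {w} uv uw with class-cases (u , v) | class-cases (u , w)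
  ... | inj₁ (_ , e) | inj₁ (_ , e′) = trans e (sym e′)
  ... | inj₂ (inj₁ (_ , _ , e)) | inj₂ (inj₁ (_ , _ , e′)) = trans e (sym e′)
  ... | inj₂ (inj₂ (_ , _ , e)) | inj₂ (inj₂ (_ , _ , e′)) = trans e (sym e′)
  ... | inj₁ (l , _) | inj₂ (inj₁ (¬l , _)) = ⊥-elim (¬l (rot-fixed 3 uv uw l))
  ... | inj₁ (l , _) | inj₂ (inj₂ (¬l , _)) = ⊥-elim (¬l (rot-fixed 3 uv uw l))
  ... | inj₂ (inj₁ (¬l , _)) | inj₁ (l , _) = ⊥-elim (¬l (rot-fixed 3 uw uv l))
  ... | inj₂ (inj₂ (¬l , _)) | inj₁ (l , _) = ⊥-elim (¬l (rot-fixed 3 uw uv l))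
  ... | inj₂ (inj₁ (_ , f , _)) | inj₂ (inj₂ (_ , ¬f , _)) = ⊥-elim (¬f (rot-fixed 4 uv uw f))
  ... | inj₂ (inj₂ (_ , ¬f , _)) | inj₂ (inj₁ (_ , f , _)) = ⊥-elim (¬f (rot-fixed 4 uw uv f))

  A : D → ℕ
  A d = value (class d) (kind d) (kind (spin d)) (kind (spin (spin d))) (kind (spin (spin (spin d))))

  A≤16 : ∀ d → A d ≤ 16
  A≤16 d = value≤16 (class d) (kind d) (kind (spin d)) (kind (spin (spin d))) (kind (spin (spin (spin d))))

  -- `rot v` extended by the identity to a permutation of all vertices. The neighbours of `v` form
  -- one orbit, so sums over them become sums over powers.
  around : Fin n → Fin n → Fin n
  around v w = if adj v w then rot v w else w

  around-adj : ∀ {v w} → Adj G v w → around v w ≡ rot v w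
  around-adj vw rewrite T⇒≡ vw = refl

  around-injective : ∀ v {w w′} → around v w ≡ around v w′ → w ≡ w′
  around-injective v {w} {w′} h with adj v w in eq | adj v w′ in eq′
  ... | true  | true  = rot-inj v w w′ (≡⇒T eq) (≡⇒T eq′) h
  ... | false | false = h
  ... | true  | false = ⊥-elim (≡false⇒¬T eq′ (subst (Adj G v) h (rot-adj v w (≡⇒T eq))))
  ... | false | true  = ⊥-elim (≡false⇒¬T eq (subst (Adj G v) (sym h) (rot-adj v w′ (≡⇒T eq′))))

  module _ {v u : Fin n} (vu : Adj G v u) where
    private
      module P = Permutation (finEnum n) (around v) (around-injective v)
      m = P.period u

      powers : ∀ k → pow (around v) k u ≡ pow (rot v) k u
      powers zero = refl
      powers (suc k) = trans (cong (around v) (powers k)) (around-adj (rotⁿ-adj k vu))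

    neighbour-sum : ∀ g → ∑ (λ w → when (adj v w) (g w)) ≡ sumTo m (λ i → g (pow (rot v) i u))
    neighbour-sum g = trans
      (Enum.Σ-listing (finEnum n) (P.orbitList u) (P.orbitList-injective u) (adj v)
        (λ i → T⇒≡ (subst (Adj G v) (sym (powers (toℕ i))) (rotⁿ-adj (toℕ i) vu)))
        (λ w h → let k , e = rot-pow vu (≡⇒T h) in P.orbitList-surjective u (k , trans (powers k) e)) g)
      (trans (∑≡sumTo m (λ i → g (pow (around v) i u))) (sumTo-cong m (λ i → cong g (powers i))))

    private
      Aᵢ : ℕ → ℕ
      Aᵢ i = A (v , pow (rot v) i u)

      K : ℕ → Kind
      K i = kind (v , pow (rot v) i u)

      c = class (v , u)

      Aᵢ≡ : ∀ i → Aᵢ i ≡ value c (K i) (K (1 + i)) (K (2 + i)) (K (3 + i))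
      Aᵢ≡ i = cong (λ c → value c (K i) (K (1 + i)) (K (2 + i)) (K (3 + i))) (class-same (rotⁿ-adj i vu) vu)

      comp : ∀ i → compatible (K i) (K (suc i)) ≡ true
      comp i = compatible-spin (rotⁿ-adj i vu)

      -- Degrees 3, 4 and 5 are finite tables. From degree 6 on, the maximum 16 per corner is
      -- affordable, as `16 * m + 48 ≤ 24 * m`.
      corner-sum : ∀ m → pow (rot v) m u ≡ u → (∀ j → 0 < j → j < m → pow (rot v) j u ≢ u) → 0 < m → sumTo m Aᵢ + 48 ≤ 24 * m
      corner-sum 1 h _ _ = ⊥-elim (proj₁ (deg≥3 v u vu) h)
      corner-sum 2 h _ _ = ⊥-elim (proj₂ (deg≥3 v u vu) h)
      corner-sum 3 h _ _ = ℕₚ.+-monoˡ-≤ 48 (ℕₚ.≤-trans (ℕₚ.≤-reflexive total)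
          (low-vertex (K 0) (K 1) (K 2) (comp 0) (comp 1) (trans (cong (compatible (K 2)) (sym K₃)) (comp 2)) notAll))
        where
        K₃ : K 3 ≡ K 0
        K₃ = cong (λ w → kind (v , w)) h
        K₄ : K 4 ≡ K 1
        K₄ = cong (λ w → kind (v , rot v w)) h
        notAll : isPent (K 0) ∧ isPent (K 1) ∧ isPent (K 2) ≡ false
        notAll = ¬T⇒≡false λ t → let h₀ , t′ = ∧-T {isPent (K 0)} t ; h₁ , h₂ = ∧-T {isPent (K 1)} t′ in
          no-three-pent vu h (kind-pent⁻ (T⇒≡ h₀)) (kind-pent⁻ (T⇒≡ h₁)) (kind-pent⁻ (T⇒≡ h₂))
        at : ∀ i {a b} → K (1 + i) ≡ a → K (2 + i) ≡ b → Aᵢ i ≡ lowValue (K i) a b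
        at i refl refl = trans (Aᵢ≡ i) (cong (λ c → value c (K i) (K (1 + i)) (K (2 + i)) (K (3 + i))) (class-low h))
        total : sumTo 3 Aᵢ ≡ lowValue (K 0) (K 1) (K 2) + lowValue (K 1) (K 2) (K 0) + lowValue (K 2) (K 0) (K 1)
        total = trans (cong₂ (λ a b → a + (b + (Aᵢ 2 + 0))) (at 0 refl refl) (at 1 refl K₃))
          (trans (cong (λ a → lowValue (K 0) (K 1) (K 2) + (lowValue (K 1) (K 2) (K 0) + (a + 0))) (at 2 K₃ K₄))
            (reassoc (lowValue (K 0) (K 1) (K 2)) (lowValue (K 1) (K 2) (K 0)) (lowValue (K 2) (K 0) (K 1))))
          where
          reassoc : ∀ a b c → a + (b + (c + 0)) ≡ a + b + c
          reassoc = solve-∀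
      corner-sum 4 h least _ = ℕₚ.+-monoˡ-≤ 48 (ℕₚ.≤-trans (ℕₚ.≤-reflexive total)
          (four-vertex (K 0) (K 1) (K 2) (K 3) (comp 0) (comp 1) (comp 2) (trans (cong (compatible (K 3)) (sym K₄)) (comp 3))))
        where
        K₄ : K 4 ≡ K 0
        K₄ = cong (λ w → kind (v , w)) h
        K₅ : K 5 ≡ K 1
        K₅ = cong (λ w → kind (v , rot v w)) h
        K₆ : K 6 ≡ K 2
        K₆ = cong (λ w → kind (v , rot v (rot v w))) h
        isFour′ : class (v , u) ≡ four
        isFour′ with class-cases (v , u)
        ... | inj₁ (l , _) = ⊥-elim (least 3 (s≤s z≤n) ℕₚ.≤-refl l)
        ... | inj₂ (inj₁ (_ , _ , e)) = e
        ... | inj₂ (inj₂ (_ , ¬f , _)) = ⊥-elim (¬f h)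
        at : ∀ i {a b c} → K (1 + i) ≡ a → K (2 + i) ≡ b → K (3 + i) ≡ c → Aᵢ i ≡ fourValue (K i) a b c
        at i refl refl refl = trans (Aᵢ≡ i) (cong (λ c → value c (K i) (K (1 + i)) (K (2 + i)) (K (3 + i))) isFour′)
        total : sumTo 4 Aᵢ ≡ fourValue (K 0) (K 1) (K 2) (K 3) + fourValue (K 1) (K 2) (K 3) (K 0) +
                             fourValue (K 2) (K 3) (K 0) (K 1) + fourValue (K 3) (K 0) (K 1) (K 2)
        total = trans (cong₂ (λ a b → a + (b + (Aᵢ 2 + (Aᵢ 3 + 0)))) (at 0 refl refl refl) (at 1 refl refl K₄))
          (trans (cong₂ (λ a b → fourValue (K 0) (K 1) (K 2) (K 3) + (fourValue (K 1) (K 2) (K 3) (K 0) + (a + (b + 0)))) (at 2 refl K₄ K₅) (at 3 K₄ K₅ K₆))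
            (reassoc (fourValue (K 0) (K 1) (K 2) (K 3)) (fourValue (K 1) (K 2) (K 3) (K 0)) (fourValue (K 2) (K 3) (K 0) (K 1)) (fourValue (K 3) (K 0) (K 1) (K 2))))
          where
          reassoc : ∀ a b c d → a + (b + (c + (d + 0))) ≡ a + b + c + d
          reassoc = solve-∀
      corner-sum 5 h least _ = ℕₚ.+-monoˡ-≤ 48 (ℕₚ.≤-trans (ℕₚ.≤-reflexive total)
          (five-vertex (K 0) (K 1) (K 2) (K 3) (K 4) (comp 0) (comp 2)))
        where
        isHigh : class (v , u) ≡ high
        isHigh with class-cases (v , u)
        ... | inj₁ (l , _) = ⊥-elim (least 3 (s≤s z≤n) (s≤s (s≤s (s≤s (s≤s z≤n)))) l)
        ... | inj₂ (inj₁ (_ , f , _)) = ⊥-elim (least 4 (s≤s z≤n) ℕₚ.≤-refl f)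
        ... | inj₂ (inj₂ (_ , _ , e)) = e
        at : ∀ i → Aᵢ i ≡ highValue (K i)
        at i = trans (Aᵢ≡ i) (cong (λ c → value c (K i) (K (1 + i)) (K (2 + i)) (K (3 + i))) isHigh)
        total : sumTo 5 Aᵢ ≡ highValue (K 0) + highValue (K 1) + highValue (K 2) + highValue (K 3) + highValue (K 4)
        total = trans (sumTo-cong 5 at) (reassoc (highValue (K 0)) (highValue (K 1)) (highValue (K 2)) (highValue (K 3)) (highValue (K 4)))
          where
          reassoc : ∀ a b c d e → a + (b + (c + (d + (e + 0)))) ≡ a + b + c + d + e
          reassoc = solve-∀
      corner-sum m@(suc (suc (suc (suc (suc (suc k)))))) _ _ _ = begin
        sumTo m Aᵢ + 48         ≤⟨ ℕₚ.+-monoˡ-≤ 48 (sumTo-mono m (λ i → A≤16 (v , pow (rot v) i u))) ⟩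
        sumTo m (λ _ → 16) + 48 ≡⟨ cong (_+ 48) (sumTo-const m 16) ⟩
        m * 16 + 48             ≤⟨ ℕₚ.+-monoʳ-≤ (m * 16) (ℕₚ.*-monoˡ-≤ 8 (ℕₚ.m≤m+n 6 k)) ⟩
        m * 16 + m * 8          ≡⟨ ℕₚ.*-distribˡ-+ m 16 8 ⟨
        m * 24                  ≡⟨ ℕₚ.*-comm m 24 ⟩
        24 * m                  ∎
        where open ℕₚ.≤-Reasoning

    vertex-charge : ∑ (λ w → when (adj v w) (A (v , w))) + 48 ≤ 24 * ∑ (λ w → when (adj v w) 1)
    vertex-charge = subst₂ (λ a b → a + 48 ≤ 24 * b) (sym (neighbour-sum (λ w → A (v , w))))
      (sym (trans (neighbour-sum (λ _ → 1)) (trans (sumTo-const m 1) (ℕₚ.*-identityʳ m))))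
      (corner-sum m (trans (sym (powers m)) (P.pow-period u))
        (λ j 0<j j<m e → P.period-least u 0<j j<m (trans (powers j) e)) (P.period>0 u))

-- Among five cyclically arranged bits the number of changes is even, so not every corner of
-- a pentagon can be of the poorer type.
pentValue : Bool → Bool → ℕ
pentValue true  true  = 12
pentValue false false = 12
pentValue _     _     = 9

everyBool : (Bool → Bool) → Bool
everyBool p = p true ∧ p false

everyBool⁻ : ∀ p → everyBool p ≡ true → ∀ x → p x ≡ true
everyBool⁻ p h true  = proj₁ (∧-≡ h)
everyBool⁻ p h false = proj₂ (∧-≡ {p true} h)

pentSum : Bool → Bool → Bool → Bool → Bool → ℕ
pentSum a b c d e = pentValue a b + (pentValue b c + (pentValue c d + (pentValue d e + (pentValue e a + 0))))

pentSum≥48 : ∀ a b c d e → 48 ≤ pentSum a b c d e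
pentSum≥48 a b c d e = ≤ᵇ⁻ {48} {pentSum a b c d e}
  (everyBool⁻ (λ e → 48 ≤ᵇ pentSum a b c d e) (everyBool⁻ (λ d → everyBool λ e → 48 ≤ᵇ pentSum a b c d e)
  (everyBool⁻ (λ c → everyBool λ d → everyBool λ e → 48 ≤ᵇ pentSum a b c d e)
  (everyBool⁻ (λ b → everyBool λ c → everyBool λ d → everyBool λ e → 48 ≤ᵇ pentSum a b c d e)
  (everyBool⁻ (λ a → everyBool λ b → everyBool λ c → everyBool λ d → everyBool λ e → 48 ≤ᵇ pentSum a b c d e) refl a) b) c) d) e)

-- Charges around a face

module FaceCharges (G : Graph) (R : RotationSystem G) (S : Sparse G)
             (deg≥3 : MinDegree≥3 G R) where
  open Graph G hiding (sym)
  open RotationSystem R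
  open Embedding G R
  open Enum E using (_≟_)
  open Darts G R S deg≥3
  open Discharging G R S deg≥3

  -- Ten steps also close up on a face of length 5, hence the exclusion of pentagons.
  Special : D → Set
  Special d = pow φ̂ 10 d ≡ d × ¬ Pent d × (∀ (i : Fin 10) → Low (pow φ̂ (toℕ i) d))

  Special? : ∀ d → Dec (Special d)
  Special? d = (pow φ̂ 10 d ≟ d) ×-dec (¬? (Pent? d) ×-dec Finₚ.all? (λ i → Low? (pow φ̂ (toℕ i) d)))

  special-low : ∀ {d} → Special d → ∀ i → Low (pow φ̂ i d)
  special-low {d} (closed , _ , l) i = subst Low (sym (trans (pow-mod closed i)
    (cong (λ m → pow φ̂ m d) (sym (Finₚ.toℕ-fromℕ< (m%n<n i 10)))))) (l (fromℕ< (m%n<n i 10)))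

  -- A charge of 2 passes to the face of d, across d, when the face of d is special
  -- and the edges of this face before and after d lie on triangles.
  Receives : D → Set
  Receives d = Special d × Tri (spin (spin d)) × Tri (spin (φ̂ d))

  opaque
    Receives? : ∀ d → Dec (Receives d)
    Receives? d = Special? d ×-dec (Tri? (spin (spin d)) ×-dec Tri? (spin (φ̂ d)))

  receipt : D → ℕ
  receipt d = when (does (Receives? d)) 2

  module Unavoidable (no-low-apex : NoLowApex) (no-crossing : NoCrossing) where

    -- The situation around an edge z y across which the face of x z y x′ pays.
    module Payment {x z : V} (xz : Adj G x z) (pays : Receives (rot z x , z)) where
      y = rot z x
      x′ = rot y z
      q = rot x′ y
      s = y , z
      special = proj₁ pays

      zx = adj-sym xz
      zy = rot-adj z x zx
      yz = adj-sym zy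
      yx′ = rot-adj y z yz
      x′y = adj-sym yx′
      x′q = rot-adj x′ y x′y
      f = rot z y
      zf = rot-adj z y zy

      φs : φ̂ s ≡ (z , f)
      φs = φ̂-dart yz

      low-zf : Low (z , f)
      low-zf = subst Low φs (special-low special 1)

      low-yz : Low (y , z)
      low-yz = special-low special 0

      low-zy : Low (z , y)
      low-zy = rot-fixed 3 zf zy low-zf

      rzf : rot z f ≡ x
      rzf = rot-fixed 3 zf zx low-zf

      tri-zx : Tri (z , x)
      tri-zx = subst Tri (trans (cong spin φs) (cong (z ,_) rzf)) (proj₂ (proj₂ pays))

      low-yx′ : Low (y , x′)
      low-yx′ = rot-fixed 3 yz yx′ low-yz

      tri-x′y : Tri (x′ , y)
      tri-x′y = tri-spin yx′ (proj₁ (proj₂ pays))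

      private
        b₀ = z , f

        b₀-tri : Tri (rev b₀)
        b₀-tri = tri-spin zf (subst Tri (cong (z ,_) (sym rzf)) tri-zx)

        b₀-closed : pow φ̂ 10 b₀ ≡ b₀
        b₀-closed = subst (λ t → pow φ̂ 10 t ≡ t) φs (φ-closed 10 1 (proj₁ special))

        b₀-low : ∀ i → Low (pow φ̂ i b₀)
        b₀-low i = subst (λ t → Low (pow φ̂ i t)) φs (subst Low (pow-suc φ̂ i s) (special-low special (suc i)))

      -- `x` is the apex of the triangle on the edge `z f` of the special face; in the same way `x′`
      -- is the apex over its edge `m y`.
      ¬low-x : ¬ Low (x , z)
      ¬low-x l = no-low-apex b₀ zf b₀-closed b₀-low b₀-tri
        (subst Low (sym (trans (cong φ̂ (trans (φ-rev zf) (cong (z ,_) rzf))) (φ̂-dart zx))) (rot-fixed 3 xz (rot-adj x z xz) l))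

      private
        b₉ = pow φ̂ 9 s

        b₉-arc : Arc b₉
        b₉-arc = pow-isDart 9 yz

        φb₉ : φ̂ b₉ ≡ s
        φb₉ = proj₁ special

        m = proj₁ b₉

        b₉≡ : b₉ ≡ (m , y)
        b₉≡ = trans (pow-src 9 yz) (cong (m ,_) (cong proj₁ φb₉))

        my : Adj G m y
        my = subst Arc b₉≡ b₉-arc

        rym : rot y m ≡ z
        rym = cong proj₂ (trans (sym (φ̂-dart my)) (trans (cong φ̂ (sym b₉≡)) φb₉))

        m≡ : rot y x′ ≡ m
        m≡ = rot-inj y _ _ (rot-adj y x′ yx′) (adj-sym my) (trans low-yz (sym rym))

        b₉-tri : Tri (rev b₉)
        b₉-tri = subst (Tri ∘ rev) (sym b₉≡) (subst (λ w → Tri (y , w)) m≡ (proj₁ (proj₂ pays)))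

      ¬low-x′ : ¬ Low (x′ , q)
      ¬low-x′ l with tri-third x′y tri-x′y
      ... | e₁ , e₂ , _ , tx′ = no-low-apex b₉ b₉-arc (φ-closed 10 9 (proj₁ special))
            (λ i → subst Low (pow-+ φ̂ i 9 s) (special-low special (i + 9))) b₉-tri
            (subst Low (sym second) (rot-fixed 3 x′q x′y l))
        where
        second : pow φ̂ 2 (rev b₉) ≡ (x′ , y)
        second = trans (cong (λ t → φ̂ (φ̂ t)) (cong rev b₉≡)) (trans (cong φ̂ (trans (φ̂-dart (adj-sym my))
          (trans (cong (λ w → w , rot w y) (sym m≡)) (cong (rot y x′ ,_) e₁))))
          (trans (φ̂-dart tx′) (cong (x′ ,_) e₂)))

      ¬tri-s : ¬ Tri s
      ¬tri-s t = no-two-tri b₉-arc (φ-closed⁻ 3 1 (subst Tri (sym φb₉) t)) b₉-tri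

    module Corner {e : D} (arc : Arc e) where
      private
        x = proj₁ e
        z = proj₂ e
        y = rot z x
        zx = adj-sym arc
        zy = rot-adj z x zx

      φe : φ̂ e ≡ (z , y)
      φe = φ̂-dart arc

      kind-next : kind (spin (z , y)) ≡ kind (rev (z , y))
      kind-next = kind-spin zy

      value-low : Low (z , y) → A (z , y) ≡ lowValue (kind e) (kind (rev (z , y))) (kind (rev e))
      value-low l rewrite class-low l = trans (cong (λ k → lowValue k (kind (spin (z , y))) (kind (spin (spin (z , y))))) kind-e)
        (cong₂ (lowValue (kind e)) kind-next (cong (λ w → kind (z , w)) (rot-fixed 3 zy zx l)))
        where
        kind-e : kind (z , y) ≡ kind e
        kind-e = trans (cong kind (sym φe)) (kind-φ e)

      value-bound : kind e ≡ other → cornerBound (kind (rev e)) (class (z , y) , kind (rev (z , y))) ≤ A (z , y)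
      value-bound other-e with class-cases (z , y)
      ... | inj₁ (l , c) rewrite c = ℕₚ.≤-reflexive (sym (trans (cong (λ c → value c (kind (z , y)) (kind (spin (z , y))) (kind (spin (spin (z , y)))) (kind (spin (spin (spin (z , y)))))) (sym c)) (trans (value-low l) (cong (λ k → lowValue k (kind (rev (z , y))) (kind (rev e))) other-e))))
      ... | inj₂ (inj₁ (_ , f , c)) rewrite c = four-bound
        where
        kind-e : kind (z , y) ≡ other
        kind-e = trans (trans (cong kind (sym φe)) (kind-φ e)) other-e
        prev : kind (spin (spin (spin (z , y)))) ≡ kind (rev e)
        prev = cong (λ w → kind (z , w)) (rot-fixed 4 zy zx f)
        k₁ = kind (rev (z , y))
        k₂ = kind (spin (spin (z , y)))
        k₃ = kind (rev e)
        comp₁ : compatible k₁ k₂ ≡ true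
        comp₁ = trans (cong (λ k → compatible k k₂) (sym kind-next)) (compatible-spin (rot-adj z y zy))
        comp₂ : compatible k₂ k₃ ≡ true
        comp₂ = trans (cong (compatible k₂) (sym prev)) (compatible-spin (rotⁿ-adj 2 zy))
        table-bound : ∀ a b c → compatible a b ≡ true → compatible b c ≡ true →
                      cornerBound c (four , a) ≤ fourValue other a b c
        table-bound a b c h h′ = ≤ᵇ⁻ {cornerBound c (four , a)} (⇒ᵇ⁻ (everyKind⁻ {claim a b} (everyKind⁻ {λ b → everyKind (claim a b)}
          (everyKind⁻ {λ a → everyKind λ b → everyKind (claim a b)} refl a) b) c) (cong₂ _∧_ h h′))
          where
          claim : Kind → Kind → Kind → Bool
          claim a b c = (compatible a b ∧ compatible b c) ⇒ᵇ (cornerBound c (four , a) ≤ᵇ fourValue other a b c)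
        four-bound : cornerBound k₃ (four , k₁) ≤ fourValue (kind (z , y)) (kind (spin (z , y))) k₂ (kind (spin (spin (spin (z , y)))))
        four-bound rewrite kind-e | kind-next | prev = table-bound k₁ k₂ k₃ comp₁ comp₂
      ... | inj₂ (inj₂ (_ , _ , c)) rewrite c | trans (cong kind (sym φe)) (trans (kind-φ e) other-e) = ℕₚ.≤-refl

      legal-corner : kind e ≡ other → legal (kind (rev e)) (class (z , y) , kind (rev (z , y))) ≡ true
      legal-corner other-e with class-cases (z , y)
      ... | inj₂ (inj₁ (_ , _ , c)) rewrite c = refl
      ... | inj₂ (inj₂ (_ , _ , c)) rewrite c = refl
      ... | inj₁ (l , c) rewrite c = compatible-sym (kind (rev (z , y))) (kind (rev e))
            (trans (cong₂ compatible (sym kind-next) (cong (λ w → kind (z , w)) (sym (rot-fixed 3 zy zx l)))) (compatible-spin (rot-adj z y zy)))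
        where
        compatible-sym : ∀ a b → compatible a b ≡ true → compatible b a ≡ true
        compatible-sym tri   other _ = refl
        compatible-sym pent  pent  _ = refl
        compatible-sym pent  other _ = refl
        compatible-sym other tri   _ = refl
        compatible-sym other pent  _ = refl
        compatible-sym other other _ = refl

      pent-bound : kind e ≡ pent → ¬ Tri (rev (z , y)) → ¬ Tri (rev e) →
                   pentValue (isPent (kind (rev e))) (isPent (kind (rev (z , y)))) ≤ A (z , y)
      pent-bound pent-e ¬t ¬t′ with class-cases (z , y)
      ... | inj₁ (l , c) = ℕₚ.≤-trans (low-bound (kind (rev (z , y))) (kind (rev e)) refl refl)
              (ℕₚ.≤-reflexive (sym (trans (value-low l) (cong (λ k → lowValue k (kind (rev (z , y))) (kind (rev e))) pent-e))))
        where
        low-bound : ∀ a b → kind (rev (z , y)) ≡ a → kind (rev e) ≡ b → pentValue (isPent b) (isPent a) ≤ lowValue pent a b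
        low-bound pent pent h h′ = ⊥-elim (no-three-pent zy l
          (subst Pent φe (φ-closed 5 1 (kind-pent⁻ (cong isPent pent-e))))
          (kind-pent⁻ (cong isPent (trans kind-next h)))
          (subst (λ w → Pent (z , w)) (sym (rot-fixed 3 zy zx l)) (kind-pent⁻ (cong isPent h′))))
        low-bound tri   _     h _ = ⊥-elim (¬t (kind-tri⁻ (cong isTri h)))
        low-bound pent  tri   _ h = ⊥-elim (¬t′ (kind-tri⁻ (cong isTri h)))
        low-bound pent  other _ _ = ℕₚ.≤-refl
        low-bound other tri   _ _ = ℕₚ.≤-refl
        low-bound other pent  _ _ = ℕₚ.≤-refl
        low-bound other other _ _ = ℕₚ.≤-refl
      ... | inj₂ (inj₂ (_ , _ , c)) rewrite c | trans (cong kind (sym φe)) (trans (kind-φ e) pent-e) =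
              pentValue≤12 (isPent (kind (rev e))) _
        where
        pentValue≤12 : ∀ a b → pentValue a b ≤ 12
        pentValue≤12 true  true  = ℕₚ.≤-refl
        pentValue≤12 true  false = ℕₚ.m≤m+n 9 3
        pentValue≤12 false true  = ℕₚ.m≤m+n 9 3
        pentValue≤12 false false = ℕₚ.≤-refl
      ... | inj₂ (inj₁ (_ , f , c)) rewrite c | trans (cong kind (sym φe)) (trans (kind-φ e) pent-e) | kind-next
              | cong (λ w → kind (z , w)) (rot-fixed 4 zy zx f) =
              four-bound (kind (rev (z , y))) (kind (spin (spin (z , y)))) (kind (rev e)) refl refl
        where
        four-bound : ∀ a b c → kind (rev (z , y)) ≡ a → kind (rev e) ≡ c → pentValue (isPent c) (isPent a) ≤ fourValue pent a b c
        four-bound tri   _ _     h _ = ⊥-elim (¬t (kind-tri⁻ (cong isTri h)))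
        four-bound _     _ tri   _ h = ⊥-elim (¬t′ (kind-tri⁻ (cong isTri h)))
        four-bound pent  tri   pent  _ _ = ℕₚ.≤-refl
        four-bound pent  pent  pent  _ _ = ℕₚ.≤-refl
        four-bound pent  other pent  _ _ = ℕₚ.≤-refl
        four-bound pent  tri   other _ _ = ℕₚ.m≤m+n 9 3
        four-bound pent  pent  other _ _ = ℕₚ.m≤m+n 9 3
        four-bound pent  other other _ _ = ℕₚ.m≤m+n 9 3
        four-bound other tri   pent  _ _ = ℕₚ.m≤m+n 9 3
        four-bound other pent  pent  _ _ = ℕₚ.m≤m+n 9 3
        four-bound other other pent  _ _ = ℕₚ.m≤m+n 9 3
        four-bound other tri   other _ _ = ℕₚ.≤-refl
        four-bound other pent  other _ _ = ℕₚ.≤-refl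
        four-bound other other other _ _ = ℕₚ.≤-refl

    module Around {d : D} (dd : Arc d) where
      e : ℕ → D
      e i = pow φ̂ i d

      arcs : ∀ i → Arc (e i)
      arcs i = pow-isDart i dd

      after : D → D
      after (x , z) = z , rot z x

      step₁ : ∀ i → e (suc i) ≡ after (e i)
      step₁ i = φ̂-dart (arcs i)

      step₂ : ∀ i → e (2 + i) ≡ after (after (e i))
      step₂ i = trans (step₁ (suc i)) (cong after (step₁ i))

      step₃ : ∀ i → e (3 + i) ≡ after (after (after (e i)))
      step₃ i = trans (step₁ (2 + i)) (cong after (step₂ i))

      loss : ℕ → ℕ
      loss i = receipt (rev (e i))

      loss-cases : ∀ i → loss i ≡ 0 ⊎ (Receives (rev (e i)) × loss i ≡ 2)
      loss-cases i with Receives? (rev (e i))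
      ... | yes r = inj₂ (r , refl)
      ... | no _  = inj₁ refl

      module _ (i : ℕ) (r : Receives (rev (e (suc i)))) where
        private module P = Payment (arcs i) (subst (Receives ∘ rev) (step₁ i) r)

        paid-tri : Tri (rev (e i))
        paid-tri = P.tri-zx

        paid-¬low : ¬ Low (e i)
        paid-¬low = P.¬low-x

        paid-low₁ : Low (e (suc i))
        paid-low₁ = subst Low (sym (step₁ i)) P.low-zy

        paid-other : kind (rev (e (suc i))) ≡ other
        paid-other = kind-other (subst (¬_ ∘ Tri ∘ rev) (sym (step₁ i)) P.¬tri-s) (proj₁ (proj₂ (proj₁ r)))

        paid-low₂ : Low (e (2 + i))
        paid-low₂ = subst Low (sym (step₂ i)) P.low-yx′

        paid-tri₂ : Tri (rev (e (2 + i)))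
        paid-tri₂ = subst (Tri ∘ rev) (sym (step₂ i)) P.tri-x′y

        paid-¬low₃ : ¬ Low (e (3 + i))
        paid-¬low₃ = subst (¬_ ∘ Low) (sym (step₃ i)) P.¬low-x′

      Balanced : ℕ → Set
      Balanced ℓ = 48 + sumTo ℓ loss ≤ sumTo ℓ (λ i → A (e i) + receipt (e i))

      private
        module Closed (ℓ : ℕ) (closed : e ℓ ≡ d) where
          e-periodic : ∀ i → e (ℓ + i) ≡ e i
          e-periodic i = trans (pow-+ φ̂ ℓ i d) (φ-closed ℓ i closed)

          cyclic : (f : D → ℕ) → sumTo ℓ (λ i → f (e (suc i))) ≡ sumTo ℓ (λ i → f (e i))
          cyclic f = sumTo-shift ℓ (λ i → f (e i)) (cong f closed)

          cyclic₂ : (f : D → ℕ) → sumTo ℓ (λ i → f (e (2 + i))) ≡ sumTo ℓ (λ i → f (e i))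
          cyclic₂ f = trans (sumTo-shift ℓ (λ i → f (e (suc i))) (cong (f ∘ φ̂) closed)) (cyclic f)

          -- The loss across the edge `e (2 + i)` is charged to the vertex where the preceding edge
          -- `e (suc i)` starts. If there is a loss, that vertex has degree at least 4.
          by-corners : (c : ℕ → ℕ) → (∀ i → c i + loss (2 + i) ≤ A (e (suc i))) → 48 ≤ sumTo ℓ c → Balanced ℓ
          by-corners c h 48≤ = begin
            48 + sumTo ℓ loss                             ≤⟨ ℕₚ.+-mono-≤ 48≤ (ℕₚ.≤-reflexive (sym (cyclic₂ (receipt ∘ rev)))) ⟩
            sumTo ℓ c + sumTo ℓ (λ i → loss (2 + i))      ≡⟨ sumTo-+ ℓ c (λ i → loss (2 + i)) ⟨
            sumTo ℓ (λ i → c i + loss (2 + i))            ≤⟨ sumTo-mono ℓ h ⟩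
            sumTo ℓ (λ i → A (e (suc i)))                 ≡⟨ cyclic A ⟩
            sumTo ℓ (λ i → A (e i))                       ≤⟨ sumTo-mono ℓ (λ i → ℕₚ.m≤m+n (A (e i)) (receipt (e i))) ⟩
            sumTo ℓ (λ i → A (e i) + receipt (e i))       ∎
            where open ℕₚ.≤-Reasoning

          -- A face pays only across an edge whose two neighbouring edges lie on triangles.
          lossless : (∀ i → ¬ Tri (rev (e i))) → (c : ℕ → ℕ) → (∀ i → c i ≤ A (e (suc i))) → 48 ≤ sumTo ℓ c → Balanced ℓ
          lossless ¬t c h = by-corners c λ i → case loss-cases (2 + i) of λ
            { (inj₁ z) → ℕₚ.≤-trans (ℕₚ.≤-reflexive (trans (cong (c i +_) z) (ℕₚ.+-identityʳ (c i)))) (h i)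
            ; (inj₂ (r , _)) → ⊥-elim (¬t (suc i) (paid-tri (suc i) r)) }

          constant : ∀ c → 48 ≤ ℓ * c → 48 ≤ sumTo ℓ (λ _ → c)
          constant c h = ℕₚ.≤-trans h (ℕₚ.≤-reflexive (sym (sumTo-const ℓ c)))

        A-tri : ∀ f → kind f ≡ tri → 16 ≤ A f
        A-tri f h rewrite h with class f
        ... | low  = ℕₚ.≤-refl
        ... | four = ℕₚ.≤-refl
        ... | high = ℕₚ.≤-refl

        U : ℕ → Letter
        U i = class (e i) , kind (rev (e i))

        corner : kind d ≡ other → ∀ i → cornerBound (proj₂ (U i)) (U (suc i)) ≤ A (e (suc i))
        corner k i = subst (λ f → cornerBound (proj₂ (U i)) (class f , kind (rev f)) ≤ A f) (sym (step₁ i))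
                       (Corner.value-bound (arcs i) (trans (kind-pow i d) k))

        legal-U : kind d ≡ other → ∀ i → legal (proj₂ (U i)) (U (suc i)) ≡ true
        legal-U k i = subst (λ f → legal (proj₂ (U i)) (class f , kind (rev f)) ≡ true) (sym (step₁ i))
                        (Corner.legal-corner (arcs i) (trans (kind-pow i d) k))

        not-tri : ∀ {f} → ¬ Tri f → isTri (kind f) ≡ false
        not-tri ¬t = ¬T⇒≡false λ t → ¬t (kind-tri⁻ (T⇒≡ t))

        bound₆ : ∀ k′ l → (not (isTri k′) ∧ not (isTri (proj₂ l))) ≡ true → 6 ≤ cornerBound k′ l
        bound₆ k′ l h = ≤ᵇ⁻ {6} {cornerBound k′ l} (⇒ᵇ⁻ (every {λ l → (not (isTri k′) ∧ not (isTri (proj₂ l))) ⇒ᵇ (6 ≤ᵇ cornerBound k′ l)}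
          (everyKind⁻ {λ k′ → all (λ l → (not (isTri k′) ∧ not (isTri (proj₂ l))) ⇒ᵇ (6 ≤ᵇ cornerBound k′ l)) letters} refl k′) l) h)

        bound₈ : ∀ l → (not (isTri (proj₂ l)) ∧ not (isPent (proj₂ l))) ≡ true → 8 ≤ cornerBound other l
        bound₈ l h = ≤ᵇ⁻ {8} {cornerBound other l} (⇒ᵇ⁻ (every {λ l → (not (isTri (proj₂ l)) ∧ not (isPent (proj₂ l))) ⇒ᵇ (8 ≤ᵇ cornerBound other l)} refl l) h)

        -- For faces of length at least 12: 4 per corner already makes 48, and a corner that bears a
        -- loss is not low, so it has 2 to spare.
        bound₄ : ∀ k′ l → legal k′ l ≡ true → 4 + (if not (isLow (proj₁ l)) then 2 else 0) ≤ cornerBound k′ l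
        bound₄ k′ l h = ≤ᵇ⁻ {4 + (if not (isLow (proj₁ l)) then 2 else 0)} {cornerBound k′ l} (⇒ᵇ⁻ (every {claim k′}
          (everyKind⁻ {λ k′ → all (claim k′) letters} refl k′) l) h)
          where
          claim : Kind → Letter → Bool
          claim k′ l = legal k′ l ⇒ᵇ (4 + (if not (isLow (proj₁ l)) then 2 else 0) ≤ᵇ cornerBound k′ l)

        reduced+2 : ∀ k′ l → (not (isLow (proj₁ l)) ∧ isTri (proj₂ l)) ≡ true → reducedBound k′ l + 2 ≤ cornerBound k′ l
        reduced+2 k′ l h = ≤ᵇ⁻ {reducedBound k′ l + 2} {cornerBound k′ l} (⇒ᵇ⁻ (every {claim k′}
          (everyKind⁻ {λ k′ → all (claim k′) letters} refl k′) l) h)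
          where
          claim : Kind → Letter → Bool
          claim k′ l = (not (isLow (proj₁ l)) ∧ isTri (proj₂ l)) ⇒ᵇ (reducedBound k′ l + 2 ≤ᵇ cornerBound k′ l)

        reduced≤ : ∀ k′ l → reducedBound k′ l ≤ cornerBound k′ l
        reduced≤ k′ (c , k) = ℕₚ.m∸n≤m (cornerBound k′ (c , k)) (if not (isLow c) ∧ isTri k then 2 else 0)

        matches⁻ : ∀ ps {X : ℕ → Letter} → matches ps X ≡ true → ∀ i → List.lookup ps i (X (toℕ i)) ≡ true
        matches⁻ (p ∷ ps) h zero = proj₁ (∧-≡ h)
        matches⁻ (p ∷ ps) {X} h (suc i) = matches⁻ ps (proj₂ (∧-≡ {p (X 0)} h)) i

        module Word (r : ℕ) (closed : e (suc r) ≡ d) (k : kind d ≡ other) where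
          ℓ = suc r
          open Closed ℓ closed

          U-periodic : ∀ i → U (ℓ + i) ≡ U i
          U-periodic i = cong (λ f → class f , kind (rev f)) (e-periodic i)

          crossing-⊥ : ∀ j → Receives (rev (e (suc j))) → (ℓ ≡ᵇ 10) ∧ matches crossingPattern (from j U) ≡ true → ⊥
          crossing-⊥ j pay h with ∧-≡ {ℓ ≡ᵇ 10} h
          ... | ten , m with ≡ᵇ⇒≡ {ℓ} {10} ten
          ...   | refl = no-crossing (e j) (arcs j) (φ-closed 10 j closed)
                  (λ { _ (inj₁ refl) → tri-at (# 0) (proj₂ (∧-≡ {isFour (proj₁ (from j U 0))} (at (# 0))))
                     ; _ (inj₂ (inj₁ refl)) → tri-at (# 2) (proj₂ (∧-≡ {isLow (proj₁ (from j U 2))} (at (# 2))))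
                     ; _ (inj₂ (inj₂ (inj₁ refl))) → tri-at (# 3) (proj₂ (∧-≡ {isFour (proj₁ (from j U 3))} (at (# 3))))
                     ; _ (inj₂ (inj₂ (inj₂ (inj₁ refl)))) → tri-at (# 5) (proj₂ (∧-≡ {isLow (proj₁ (from j U 5))} (at (# 5))))
                     ; _ (inj₂ (inj₂ (inj₂ (inj₂ refl)))) → tri-at (# 9) (proj₂ (∧-≡ {isLow (proj₁ (from j U 9))} (at (# 9)))) })
                  (λ { _ (inj₁ refl) → low-at (# 4) (proj₁ (∧-≡ (at (# 4))))
                     ; _ (inj₂ (inj₁ refl)) → low-at (# 5) (proj₁ (∧-≡ (at (# 5))))
                     ; _ (inj₂ (inj₂ (inj₁ refl))) → low-at (# 6) (proj₁ (∧-≡ (at (# 6))))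
                     ; _ (inj₂ (inj₂ (inj₂ refl))) → low-at (# 9) (proj₁ (∧-≡ (at (# 9)))) })
                  (λ { _ (inj₁ refl) → four-at (# 0) (proj₁ (∧-≡ (at (# 0))))
                     ; _ (inj₂ refl) → four-at (# 3) (proj₁ (∧-≡ (at (# 3)))) })
                  (proj₁ (proj₁ pay)) (special-low (proj₁ pay))
            where
            at : (i : Fin 10) → List.lookup crossingPattern i (from j U (toℕ i)) ≡ true
            at = matches⁻ crossingPattern {from j U} m
            tri-at : (i : Fin 10) → isTri (proj₂ (from j U (toℕ i))) ≡ true → Tri (rev (pow φ̂ (toℕ i) (e j)))
            tri-at i h = subst (Tri ∘ rev) (pow-+ φ̂ (toℕ i) j d) (kind-tri⁻ h)
            low-at : (i : Fin 10) → isLow (proj₁ (from j U (toℕ i))) ≡ true → Low (pow φ̂ (toℕ i) (e j))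
            low-at i h = subst Low (pow-+ φ̂ (toℕ i) j d) (class-low⁻ h)
            four-at : (i : Fin 10) → isFour (proj₁ (from j U (toℕ i))) ≡ true → Four (pow φ̂ (toℕ i) (e j))
            four-at i h = subst Four (pow-+ φ̂ (toℕ i) j d) (class-four⁻ h)

          loses-true : ∀ j → Receives (rev (e (suc j))) → loses ℓ (from j U) ≡ true
          loses-true j pay = cong₂ _∧_
            (cong₂ _∧_ (cong₂ _∧_ (cong not (class-notLow (paid-¬low j pay))) (cong isTri (kind-tri (paid-tri j pay))))
              (cong₂ _∧_ (cong₂ _∧_ (cong isLow (class-low (paid-low₁ j pay))) (cong (λ k → not (isTri k) ∧ not (isPent k)) (paid-other j pay)))
                (cong₂ _∧_ (cong₂ _∧_ (cong isLow (class-low (paid-low₂ j pay))) (cong isTri (kind-tri (paid-tri₂ j pay))))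
                  (cong₂ _∧_ (cong not (class-notLow (paid-¬low₃ j pay))) refl))))
            (cong not (¬T⇒≡false λ t → crossing-⊥ j pay (T⇒≡ t)))

          loss≤ : ∀ j → loss (suc j) ≤ when (loses ℓ (from j U)) 1 + when (loses ℓ (from j U)) 1
          loss≤ j with loss-cases (suc j)
          ... | inj₁ z = ℕₚ.≤-trans (ℕₚ.≤-reflexive z) z≤n
          ... | inj₂ (pay , z) rewrite z | loses-true j pay = ℕₚ.≤-refl

          allLow⁻ : ∀ n {X : ℕ → Letter} → allLow n X ≡ true → ∀ {i} → i < n → isLow (proj₁ (X i)) ≡ true
          allLow⁻ (suc n) h {zero} _ = proj₁ (∧-≡ h)
          allLow⁻ (suc n) {X} h {suc i} (s≤s i<n) = allLow⁻ n (proj₂ (∧-≡ {isLow (proj₁ (X 0))} h)) i<n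

          receives : ℓ ≡ 10 → allLow 10 U ≡ true → ∀ j → matches gainPattern (from j U) ≡ true → Receives (e (suc j))
          receives refl lows j m =
            (φ-closed 10 (suc j) closed , (λ p → true-false (cong isOther (trans (kind-pow (suc j) d) k)) (pent-not-other p))
              , λ i → subst Low (pow-+ φ̂ (toℕ i) (suc j) d) (low-e (toℕ i + suc j)))
            , subst Tri back (kind-tri⁻ (matches⁻ gainPattern {from j U} m (# 0)))
            , subst Tri (φ-rev (arcs (2 + j))) (φ-closed 3 1 (kind-tri⁻ (matches⁻ gainPattern {from j U} m (# 2))))
            where
            isOther : Kind → Bool
            isOther k = not (isTri k) ∧ not (isPent k)
            pent-not-other : Pent (e (suc j)) → isOther (kind (e (suc j))) ≡ false
            pent-not-other p with kind-cases (e (suc j))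
            ... | inj₁ (_ , q) rewrite q = refl
            ... | inj₂ (inj₁ (_ , _ , q)) rewrite q = refl
            ... | inj₂ (inj₂ (_ , ¬p , _)) = ⊥-elim (¬p p)
            low-e : ∀ i → Low (e i)
            low-e i = subst Low (sym (pow-mod closed i)) (class-low⁻ (allLow⁻ 10 {U} lows (m%n<n i 10)))
            x = proj₁ (e j)
            z = proj₂ (e j)
            back : rev (e j) ≡ spin (spin (e (suc j)))
            back = sym (trans (cong (spin ∘ spin) (step₁ j)) (cong (z ,_)
              (rot-fixed 3 (rot-adj z x (adj-sym (arcs j))) (adj-sym (arcs j)) (subst Low (step₁ j) (low-e (suc j))))))

          gains≤ : gains ℓ U ≤ sumTo ℓ (λ j → receipt (e (suc j)))
          gains≤ with (ℓ ≡ᵇ 10) ∧ allLow ℓ U in eq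
          ... | false = z≤n
          ... | true with ∧-≡ {ℓ ≡ᵇ 10} eq
          ...   | ten , lows = ℕₚ.≤-trans (ℕₚ.≤-reflexive (double ℓ (λ j → when (matches gainPattern (from j U)) 1)))
                    (sumTo-mono ℓ each)
            where
            ℓ≡10 : ℓ ≡ 10
            ℓ≡10 = ≡ᵇ⇒≡ {ℓ} {10} ten
            double : ∀ n f → 2 * sumTo n f ≡ sumTo n (λ j → f j + f j)
            double n f = trans (cong (sumTo n f +_) (ℕₚ.+-identityʳ _)) (sym (sumTo-+ n f f))
            each : ∀ j → when (matches gainPattern (from j U)) 1 + when (matches gainPattern (from j U)) 1 ≤ receipt (e (suc j))
            each j with matches gainPattern (from j U) in m
            ... | false = z≤n
            ... | true rewrite true-dec (Receives? (e (suc j))) (receives ℓ≡10 (subst (λ n → allLow n U ≡ true) ℓ≡10 lows) j m) = ℕₚ.≤-refl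

          by-word : all (λ l → search ℓ r (l ∷ []) l 4) letters ≡ true → Balanced ℓ
          by-word checked with balanced-word ℓ U (legal-U k) U-periodic r refl checked
          ... | inj₁ big = by-corners (λ i → reducedBound (proj₂ (U i)) (U (suc i))) each big
            where
            each : ∀ i → reducedBound (proj₂ (U i)) (U (suc i)) + loss (2 + i) ≤ A (e (suc i))
            each i with loss-cases (2 + i)
            ... | inj₁ z = ℕₚ.≤-trans (ℕₚ.≤-reflexive (trans (cong (reducedBound (proj₂ (U i)) (U (suc i)) +_) z) (ℕₚ.+-identityʳ _)))
                             (ℕₚ.≤-trans (reduced≤ (proj₂ (U i)) (U (suc i))) (corner k i))
            ... | inj₂ (pay , z) = ℕₚ.≤-trans (ℕₚ.≤-reflexive (cong (reducedBound (proj₂ (U i)) (U (suc i)) +_) z))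
                             (ℕₚ.≤-trans (reduced+2 (proj₂ (U i)) (U (suc i)) (cong₂ _∧_ (cong not (class-notLow (paid-¬low (suc i) pay)))
                               (cong isTri (kind-tri (paid-tri (suc i) pay))))) (corner k i))
          ... | inj₂ enough = begin
            48 + sumTo ℓ loss
              ≡⟨ cong (48 +_) (cyclic (receipt ∘ rev)) ⟨
            48 + sumTo ℓ (λ j → loss (suc j))
              ≤⟨ ℕₚ.+-monoʳ-≤ 48 (sumTo-mono ℓ loss≤) ⟩
            48 + sumTo ℓ (λ j → w j + w j)
              ≡⟨ cong (48 +_) (trans (sumTo-+ ℓ w w) (cong (sumTo ℓ w +_) (sym (ℕₚ.+-identityʳ _)))) ⟩
            required ℓ U
              ≤⟨ enough ⟩
            provided ℓ U
              ≤⟨ ℕₚ.+-mono-≤ (sumTo-mono ℓ (corner k)) gains≤ ⟩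
            sumTo ℓ (λ j → A (e (suc j))) + sumTo ℓ (λ j → receipt (e (suc j)))
              ≡⟨ cong₂ _+_ (cyclic A) (cyclic receipt) ⟩
            sumTo ℓ (λ j → A (e j)) + sumTo ℓ (λ j → receipt (e j))
              ≡⟨ sumTo-+ ℓ (λ j → A (e j)) (λ j → receipt (e j)) ⟨
            sumTo ℓ (λ j → A (e j) + receipt (e j)) ∎
            where
            open ℕₚ.≤-Reasoning
            w : ℕ → ℕ
            w j = when (loses ℓ (from j U)) 1

      -- `Tri` and `Pent` only say that a power of `φ̂` closes up; minimality of `ℓ` ensures that a
      -- face of length at least 6 has kind `other`.
      face-charge : ∀ ℓ → 0 < ℓ → e ℓ ≡ d → (∀ j → 0 < j → j < ℓ → e j ≢ d) → Balanced ℓ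
      face-charge 1 _ h _ = ⊥-elim (adj≢ dd (sym (cong proj₁ (trans (sym (φ̂-dart dd)) h))))
      face-charge 2 _ h _ = ⊥-elim (ClosedWalk.turn (closedWalk {2} dd h) 0 (cong proj₁ (sym h)))
      face-charge 3 _ h _ = lossless (λ i t → no-two-tri (arcs i) (φ-closed 3 i h) t) (λ _ → 16)
          (λ i → A-tri (e (suc i)) (kind-tri (φ-closed 3 (suc i) h))) ℕₚ.≤-refl
        where open Closed 3 h
      face-charge 4 _ h _ = ⊥-elim (no-walk4 (closedWalk {4} dd h))
      face-charge 5 _ h least = lossless ¬tri (λ i → pentValue (P i) (P (suc i))) bound
          (ℕₚ.≤-trans (pentSum≥48 (P 0) (P 1) (P 2) (P 3) (P 4))
            (ℕₚ.≤-reflexive (cong (λ b → pentValue (P 0) (P 1) + (pentValue (P 1) (P 2) + (pentValue (P 2) (P 3) + (pentValue (P 3) (P 4) + (pentValue (P 4) b + 0)))))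
              (cong (λ f → isPent (kind (rev f))) (sym h)))))
        where
        open Closed 5 h
        P : ℕ → Bool
        P i = isPent (kind (rev (e i)))
        ¬tri : ∀ i → ¬ Tri (rev (e i))
        ¬tri i t = tri-not-5 (arcs i) t (φ-closed 5 i h)
        pent-d : kind d ≡ pent
        pent-d with kind-cases d
        ... | inj₁ (t , _) = ⊥-elim (least 3 (s≤s z≤n) (s≤s (s≤s (s≤s (s≤s z≤n)))) t)
        ... | inj₂ (inj₁ (_ , _ , q)) = q
        ... | inj₂ (inj₂ (_ , ¬p , _)) = ⊥-elim (¬p h)
        bound : ∀ i → pentValue (P i) (P (suc i)) ≤ A (e (suc i))
        bound i = subst (λ f → pentValue (P i) (isPent (kind (rev f))) ≤ A f) (sym (step₁ i))
          (Corner.pent-bound (arcs i) (trans (kind-pow i d) pent-d)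
            (subst (λ f → ¬ Tri (rev f)) (step₁ i) (¬tri (suc i))) (¬tri i))
      -- Neither a triangle nor a pentagon lies across an edge, so every corner keeps 8.
      face-charge 6 _ h least = lossless ¬tri (λ _ → 8)
          (λ i → ℕₚ.≤-trans (subst (λ k → 8 ≤ cornerBound k (U (suc i))) (sym (rev-other i))
            (bound₈ (U (suc i)) (cong (λ k → not (isTri k) ∧ not (isPent k)) (rev-other (suc i))))) (corner other-d i)) ℕₚ.≤-refl
        where
        open Closed 6 h
        ¬tri : ∀ i → ¬ Tri (rev (e i))
        ¬tri i t = tri-not-6 (arcs i) t (φ-closed 6 i h)
        rev-other : ∀ i → kind (rev (e i)) ≡ other
        rev-other i = kind-other (¬tri i) λ p → pent-not-6 (arcs i) p (φ-closed 6 i h)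
        other-d : kind d ≡ other
        other-d = kind-other (least 3 (s≤s z≤n) (ℕₚ.m≤m+n 4 2)) (least 5 (s≤s z≤n) ℕₚ.≤-refl)
      face-charge 7 _ h _ = ⊥-elim (no-walk7 (closedWalk {7} dd h))
      -- Without triangles across, pentagons can lower a corner to 6 at most, and 8 · 6 = 48.
      face-charge 8 _ h least = lossless ¬tri (λ _ → 6)
          (λ i → ℕₚ.≤-trans (bound₆ (proj₂ (U i)) (U (suc i)) (cong₂ (λ a b → not a ∧ not b) (not-tri (¬tri i)) (not-tri (¬tri (suc i))))) (corner other-d i)) ℕₚ.≤-refl
        where
        open Closed 8 h
        ¬tri : ∀ i → ¬ Tri (rev (e i))
        ¬tri i t = tri-not-8 (arcs i) t (φ-closed 8 i h)
        other-d : kind d ≡ other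
        other-d = kind-other (least 3 (s≤s z≤n) (ℕₚ.m≤m+n 4 4)) (least 5 (s≤s z≤n) (ℕₚ.m≤m+n 6 2))
      face-charge 9 _ h least = lossless ¬tri (λ _ → 6)
          (λ i → ℕₚ.≤-trans (bound₆ (proj₂ (U i)) (U (suc i)) (cong₂ (λ a b → not a ∧ not b) (not-tri (¬tri i)) (not-tri (¬tri (suc i))))) (corner other-d i)) (ℕₚ.m≤m+n 48 6)
        where
        open Closed 9 h
        ¬tri : ∀ i → ¬ Tri (rev (e i))
        ¬tri i t = tri-not-9 (arcs i) t (φ-closed 9 i h)
        other-d : kind d ≡ other
        other-d = kind-other (least 3 (s≤s z≤n) (ℕₚ.m≤m+n 4 5)) (least 5 (s≤s z≤n) (ℕₚ.m≤m+n 6 3))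
      face-charge 10 _ h least = Word.by-word 9 h
        (kind-other (least 3 (s≤s z≤n) (ℕₚ.m≤m+n 4 6)) (least 5 (s≤s z≤n) (ℕₚ.m≤m+n 6 4))) search10
      face-charge 11 _ h least = Word.by-word 10 h
        (kind-other (least 3 (s≤s z≤n) (ℕₚ.m≤m+n 4 7)) (least 5 (s≤s z≤n) (ℕₚ.m≤m+n 6 5))) search11
      face-charge ℓ@(suc (suc (suc (suc (suc (suc (suc (suc (suc (suc (suc (suc r)))))))))))) _ h least =
        by-corners (λ _ → 4) each (constant 4 (ℕₚ.*-monoˡ-≤ 4 (ℕₚ.m≤m+n 12 r)))
        where
        open Closed ℓ h
        other-d : kind d ≡ other
        other-d = kind-other (least 3 (s≤s z≤n) (ℕₚ.m≤m+n 4 (8 + r))) (least 5 (s≤s z≤n) (ℕₚ.m≤m+n 6 (6 + r)))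
        each : ∀ i → 4 + loss (2 + i) ≤ A (e (suc i))
        each i with loss-cases (2 + i) | bound₄ (proj₂ (U i)) (U (suc i)) (legal-U other-d i)
        ... | inj₁ z | b = ℕₚ.≤-trans (ℕₚ.≤-reflexive (cong (4 +_) z)) (ℕₚ.≤-trans (ℕₚ.≤-trans (ℕₚ.m≤m+n 4 _) b) (corner other-d i))
        ... | inj₂ (pay , z) | b = ℕₚ.≤-trans (ℕₚ.≤-reflexive (cong (4 +_) z)) (ℕₚ.≤-trans
                (subst (λ x → 4 + (if not x then 2 else 0) ≤ cornerBound (proj₂ (U i)) (U (suc i))) (class-notLow (paid-¬low (suc i) pay)) b)
                (corner other-d i))

-- Total charge against Euler's inequality

module Total (G : Graph) (R : RotationSystem G) (S : Sparse G)
             (deg≥3 : MinDegree≥3 G R) where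
  open Graph G hiding (sym)
  open Embedding G R
  open Enum E
  open Darts G R S deg≥3
  open Discharging G R S deg≥3
  open FaceCharges G R S deg≥3

  arcSum : (D → ℕ) → ℕ
  arcSum f = Σ∙ (λ d → when (isDart d) (f d))

  arcSum-+ : ∀ f g → arcSum (λ d → f d + g d) ≡ arcSum f + arcSum g
  arcSum-+ f g = trans (Σ-cong λ d → divide (f d) (g d) (isDart d)) (Σ-+ (λ d → when (isDart d) (f d)) (λ d → when (isDart d) (g d)))
    where
    divide : ∀ x y b → when b (x + y) ≡ when b x + when b y
    divide x y true  = refl
    divide x y false = refl

  arcSum-rev : ∀ f → arcSum (f ∘ rev) ≡ arcSum f
  arcSum-rev f = begin
    arcSum (f ∘ rev)                                     ≡⟨ Σ-pairs (λ d → when (isDart d) (f (rev d))) ⟩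
    ∑ (λ u → ∑ (λ v → when (adj u v) (f (v , u))))       ≡⟨ ∑-comm (λ u v → when (adj u v) (f (v , u))) ⟩
    ∑ (λ v → ∑ (λ u → when (adj u v) (f (v , u))))       ≡⟨ sum-cong-≗ (λ v → sum-cong-≗ λ u → cong (λ b → when b (f (v , u))) (Graph.sym G u v)) ⟩
    ∑ (λ v → ∑ (λ u → when (adj v u) (f (v , u))))       ≡⟨ Σ-pairs (λ d → when (isDart d) (f d)) ⟨
    arcSum f                                             ∎
    where open ≡-Reasoning

  -- Summed over vertices, the budgets `24 d - 48` would be negative at isolated ones; the term
  -- `48 * isolated G` makes up for that.
  vertex-total : arcSum A + 48 * n ≤ 24 * tally E isDart + 48 * isolated G
  vertex-total = begin
    arcSum A + 48 * n
      ≡⟨ cong₂ _+_ (Σ-pairs (λ d → when (isDart d) (A d))) (trans (ℕₚ.*-comm 48 n) (sym (∑-const n 48))) ⟩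
    ∑ (λ v → ∑ (λ w → when (adj v w) (A (v , w)))) + ∑ {n} (λ _ → 48)
      ≡⟨ ∑-distrib-+ (λ v → ∑ (λ w → when (adj v w) (A (v , w)))) (λ _ → 48) ⟨
    ∑ (λ v → ∑ (λ w → when (adj v w) (A (v , w))) + 48)
      ≤⟨ ∑-mono at-vertex ⟩
    ∑ (λ v → 24 * ∑ (λ w → when (adj v w) 1) + 48 * when (isolated? v) 1)
      ≡⟨ ∑-distrib-+ (λ v → 24 * ∑ (λ w → when (adj v w) 1)) (λ v → 48 * when (isolated? v) 1) ⟩
    ∑ (λ v → 24 * ∑ (λ w → when (adj v w) 1)) + ∑ (λ v → 48 * when (isolated? v) 1)
      ≡⟨ cong₂ _+_ (Enum.Σ-*ˡ (finEnum n) 24 (λ v → ∑ (λ w → when (adj v w) 1))) (Enum.Σ-*ˡ (finEnum n) 48 (λ v → when (isolated? v) 1)) ⟩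
    24 * ∑ (λ v → ∑ (λ w → when (adj v w) 1)) + 48 * tally (finEnum n) isolated?
      ≡⟨ cong₂ (λ x y → 24 * x + 48 * y) (sym (Σ-pairs (λ d → when (isDart d) 1))) (sym isolated≡) ⟩
    24 * tally E isDart + 48 * isolated G ∎
    where
    open ℕₚ.≤-Reasoning
    at-vertex : ∀ v → ∑ (λ w → when (adj v w) (A (v , w))) + 48 ≤ 24 * ∑ (λ w → when (adj v w) 1) + 48 * when (isolated? v) 1
    at-vertex v with Finₚ.any? (λ w → Boolₚ.T? (adj v w))
    ... | yes (u , vu) = ℕₚ.≤-trans (vertex-charge vu) (ℕₚ.m≤m+n _ _)
    ... | no none rewrite isolated?⁺ {v} (λ w vw → none (w , vw)) =
      ℕₚ.+-mono-≤ (ℕₚ.≤-trans (ℕₚ.≤-reflexive (trans (sum-cong-≗ empty) (∑-zero n))) z≤n) ℕₚ.≤-refl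
      where
      empty : ∀ w → when (adj v w) (A (v , w)) ≡ 0
      empty w rewrite ¬T⇒≡false (λ vw → none (w , vw)) = refl

  darts≡2edges : tally E isDart ≡ 2 * edges G
  darts≡2edges = begin
    tally E isDart                                              ≡⟨ Σ-cong divide ⟩
    Σ∙ (λ d → when (up d) 1 + when (up (rev d)) 1)              ≡⟨ Σ-+ (λ d → when (up d) 1) (λ d → when (up (rev d)) 1) ⟩
    tally E up + Σ∙ (λ d → when (up (rev d)) 1)                 ≡⟨ cong (tally E up +_) flip ⟩
    tally E up + tally E up                                     ≡⟨ cong (λ x → x + x) (sym (edges≡ G)) ⟩
    edges G + edges G                                           ≡⟨ cong (edges G +_) (sym (ℕₚ.+-identityʳ _)) ⟩
    2 * edges G                                                 ∎
    where
    open ≡-Reasoning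
    up : D → Bool
    up (u , v) = adj u v ∧ (toℕ u <ᵇ toℕ v)
    flip : Σ∙ (λ d → when (up (rev d)) 1) ≡ tally E up
    flip = trans (Σ-pairs (λ d → when (up (rev d)) 1)) (trans (∑-comm (λ u v → when (up (v , u)) 1)) (sym (Σ-pairs (λ d → when (up d) 1))))
    <ᵇ-true : ∀ {i j} → i < j → (i <ᵇ j) ≡ true
    <ᵇ-true h = T⇒≡ (ℕₚ.<⇒<ᵇ h)
    <ᵇ-false : ∀ {i j} → ¬ i < j → (i <ᵇ j) ≡ false
    <ᵇ-false h = ¬T⇒≡false λ t → h (ℕₚ.<ᵇ⇒< _ _ t)
    divide : ∀ d → when (isDart d) 1 ≡ when (up d) 1 + when (up (rev d)) 1
    divide (u , v) with adj u v in eq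
    ... | false rewrite trans (Graph.sym G v u) eq = refl
    ... | true rewrite trans (Graph.sym G v u) eq with ℕₚ.<-cmp (toℕ u) (toℕ v)
    ...   | tri< lt _ gt rewrite <ᵇ-true lt | <ᵇ-false gt = refl
    ...   | tri≈ _ e _ = ⊥-elim (adj≢ (≡⇒T eq) (Finₚ.toℕ-injective e))
    ...   | tri> lt _ gt rewrite <ᵇ-false lt | <ᵇ-true gt = refl

  module _ (no-low-apex : NoLowApex) (no-crossing : NoCrossing) where
    open Unavoidable no-low-apex no-crossing

    -- What a face pays is the receipt of a reversed dart, so reindexing by `rev` makes total
    -- payments equal total receipts. They stay on both sides until cancelled, which avoids
    -- subtraction.
    face-total : 48 * faces G R + arcSum receipt ≤ arcSum A + arcSum receipt
    face-total = begin
      48 * faces G R + arcSum receipt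
        ≡⟨ cong₂ _+_ (trans (cong (48 *_) faces≡) (sym (Σ-*ˡ 48 (λ r → when (isFace r) 1)))) (trans (sym (arcSum-rev receipt)) (Σ-by-orbits paid)) ⟩
      Σ∙ (λ r → 48 * when (isFace r) 1) + Σ∙ (λ r → when (does (isMin? r)) (orbitSum paid r))
        ≡⟨ Σ-+ (λ r → 48 * when (isFace r) 1) (λ r → when (does (isMin? r)) (orbitSum paid r)) ⟨
      Σ∙ (λ r → 48 * when (isFace r) 1 + when (does (isMin? r)) (orbitSum paid r))
        ≤⟨ Σ-mono at-face ⟩
      Σ∙ (λ r → when (does (isMin? r)) (orbitSum got r))
        ≡⟨ Σ-by-orbits got ⟨
      arcSum (λ d → A d + receipt d)
        ≡⟨ arcSum-+ A receipt ⟩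
      arcSum A + arcSum receipt ∎
      where
      open ℕₚ.≤-Reasoning
      got paid : D → ℕ
      got d = when (isDart d) (A d + receipt d)
      paid d = when (isDart d) (receipt (rev d))
      orbit-arcs : ∀ {r} → Arc r → ∀ f → orbitSum (λ d → when (isDart d) (f d)) r ≡ sumTo (period r) (λ i → f (pow φ̂ i r))
      orbit-arcs {r} rr f = trans (∑≡sumTo (period r) (λ i → when (isDart (pow φ̂ i r)) (f (pow φ̂ i r))))
        (sumTo-cong (period r) λ i → cong (λ b → when b (f (pow φ̂ i r))) (T⇒≡ (pow-isDart i rr)))
      at-face : ∀ r → 48 * when (isFace r) 1 + when (does (isMin? r)) (orbitSum paid r) ≤ when (does (isMin? r)) (orbitSum got r)
      at-face r with isDart r in eq | does (isMin? r)
      ... | true  | false = z≤n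
      ... | false | false = z≤n
      ... | false | true = ℕₚ.≤-trans (ℕₚ.≤-reflexive empty) z≤n
        where
        empty : orbitSum paid r ≡ 0
        empty = trans (sum-cong-≗ {period r} (λ i → cong (λ b → when b (receipt (rev (pow φ̂ (toℕ i) r))))
          (¬T⇒≡false λ t → ≡false⇒¬T eq (pow-isDart⁻ (toℕ i) t)))) (∑-zero (period r))
      ... | true  | true = subst₂ (λ a b → 48 + a ≤ b) (sym (orbit-arcs rr (receipt ∘ rev))) (sym (orbit-arcs rr (λ d → A d + receipt d)))
              (Around.face-charge rr (period r) (period>0 r) (pow-period r) (λ j 0<j j<p → period-least r 0<j j<p))
        where
        rr : Arc r
        rr = ≡⇒T eq

    -- The charges bound vertices plus faces by edges plus isolated vertices. With Euler's
    -- inequality there are at most as many components as isolated vertices, although an edge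
    -- exists.
    euler-contradiction : Genus≤0 G R → ∀ {a b} → Adj G a b → ⊥
    euler-contradiction genus ab = ℕₚ.<⇒≱ (isolated<components ab) (ℕₚ.*-cancelˡ-≤ 2 (ℕₚ.+-cancelʳ-≤ (edges G) _ _ (begin
      2 * components G + edges G                ≤⟨ genus ⟩
      n + faces G R + isolated G                ≤⟨ ℕₚ.+-monoˡ-≤ (isolated G) few-faces ⟩
      edges G + isolated G + isolated G         ≡⟨ arrange (edges G) (isolated G) ⟩
      2 * isolated G + edges G                  ∎)))
      where
      open ℕₚ.≤-Reasoning
      arrange : ∀ e i → e + i + i ≡ 2 * i + e
      arrange = solve-∀
      few-faces : n + faces G R ≤ edges G + isolated G
      few-faces = ℕₚ.*-cancelˡ-≤ 48 (begin
        48 * (n + faces G R)                    ≡⟨ expand n (faces G R) ⟩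
        48 * faces G R + 48 * n                 ≤⟨ ℕₚ.+-monoˡ-≤ (48 * n) (ℕₚ.+-cancelʳ-≤ (arcSum receipt) _ _ face-total) ⟩
        arcSum A + 48 * n                       ≤⟨ vertex-total ⟩
        24 * tally E isDart + 48 * isolated G   ≡⟨ cong (λ x → 24 * x + 48 * isolated G) darts≡2edges ⟩
        24 * (2 * edges G) + 48 * isolated G    ≡⟨ collect (edges G) (isolated G) ⟩
        48 * (edges G + isolated G)             ∎)
        where
        expand : ∀ n f → 48 * (n + f) ≡ 48 * f + 48 * n
        expand = solve-∀
        collect : ∀ e i → 24 * (2 * e) + 48 * i ≡ 48 * (e + i)
        collect = solve-∀

-- Graphs whose edge deletions are all partitionable

module Critical (G : Graph) (R : RotationSystem G) (S : Sparse G) (genus : Genus≤0 G R)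
                (deleted : ∀ a b (ab : Adj G a b) → IFPartitionable (EdgeDeletion.G′ G R a b ab))
                {a₀ b₀ : Fin (Graph.n G)} (a₀b₀ : Adj G a₀ b₀) where
  open Graph G hiding (sym)
  open RotationSystem R
  open Embedding G R
  open Enum E using (_≟_) renaming (any? to anyDart?)

  module HighDegree (deg≥3 : MinDegree≥3 G R) where
    open Darts G R S deg≥3
    open Discharging G R S deg≥3 using (Tri?; Low?; Four?)
    open Reductions G R S deg≥3 deleted

    -- The configurations with ten positions in place of all natural numbers, so that a search over
    -- darts decides whether they occur.
    LowTriangle Cross : D → Set
    LowTriangle b = Arc b × pow φ̂ 10 b ≡ b × (∀ (i : Fin 10) → Low (pow φ̂ (toℕ i) b)) × Tri (rev b) × Low (pow φ̂ 2 (rev b))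
    Cross g = Arc g × pow φ̂ 10 g ≡ g
      × (Tri (rev (pow φ̂ 0 g)) × Tri (rev (pow φ̂ 2 g)) × Tri (rev (pow φ̂ 3 g)) × Tri (rev (pow φ̂ 5 g)) × Tri (rev (pow φ̂ 9 g)))
      × (Low (pow φ̂ 4 g) × Low (pow φ̂ 5 g) × Low (pow φ̂ 6 g) × Low (pow φ̂ 9 g))
      × (Four (pow φ̂ 0 g) × Four (pow φ̂ 3 g))
      × pow φ̂ 10 (rev (pow φ̂ 1 g)) ≡ rev (pow φ̂ 1 g)
      × (∀ (i : Fin 10) → Low (pow φ̂ (toℕ i) (rev (pow φ̂ 1 g))))

    allLow? : ∀ d → Dec (∀ (i : Fin 10) → Low (pow φ̂ (toℕ i) d))
    allLow? d = Finₚ.all? λ i → Low? (pow φ̂ (toℕ i) d)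

    LowTriangle? : ∀ b → Dec (LowTriangle b)
    LowTriangle? b = Boolₚ.T? (isDart b) ×-dec (pow φ̂ 10 b ≟ b) ×-dec allLow? b ×-dec Tri? (rev b) ×-dec Low? (pow φ̂ 2 (rev b))

    Cross? : ∀ g → Dec (Cross g)
    Cross? g = Boolₚ.T? (isDart g) ×-dec (pow φ̂ 10 g ≟ g)
      ×-dec (T? 0 ×-dec T? 2 ×-dec T? 3 ×-dec T? 5 ×-dec T? 9) ×-dec (L? 4 ×-dec L? 5 ×-dec L? 6 ×-dec L? 9)
      ×-dec (F? 0 ×-dec F? 3) ×-dec (pow φ̂ 10 (rev (pow φ̂ 1 g)) ≟ rev (pow φ̂ 1 g)) ×-dec allLow? (rev (pow φ̂ 1 g))
      where
      T? : ∀ i → Dec (Tri (rev (pow φ̂ i g)))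
      T? i = Tri? (rev (pow φ̂ i g))
      L? : ∀ i → Dec (Low (pow φ̂ i g))
      L? i = Low? (pow φ̂ i g)
      F? : ∀ i → Dec (Four (pow φ̂ i g))
      F? i = Four? (pow φ̂ i g)

    everywhere-low : ∀ {d} → pow φ̂ 10 d ≡ d → (∀ (i : Fin 10) → Low (pow φ̂ (toℕ i) d)) → ∀ i → Low (pow φ̂ i d)
    everywhere-low {d} closed l i = subst Low (sym (trans (pow-mod closed i)
      (cong (λ m → pow φ̂ m d) (sym (Finₚ.toℕ-fromℕ< (m%n<n i 10)))))) (l (fromℕ< (m%n<n i 10)))

    colour : IFPartitionable G
    colour with anyDart? LowTriangle? | anyDart? Cross?
    ... | yes (b , arc , closed , l , t , l′) | _ = LowFace.low-apex b arc closed (everywhere-low closed l) t l′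
    ... | no _ | yes (g , arc , closed , (t₀ , t₂ , t₃ , t₅ , t₉) , (l₄ , l₅ , l₆ , l₉) , (f₀ , f₃) , closed′ , l) =
      Crossing.reducible g arc closed
        (λ { _ (inj₁ refl) → t₀ ; _ (inj₂ (inj₁ refl)) → t₂ ; _ (inj₂ (inj₂ (inj₁ refl))) → t₃
           ; _ (inj₂ (inj₂ (inj₂ (inj₁ refl)))) → t₅ ; _ (inj₂ (inj₂ (inj₂ (inj₂ refl)))) → t₉ })
        (λ { _ (inj₁ refl) → l₄ ; _ (inj₂ (inj₁ refl)) → l₅ ; _ (inj₂ (inj₂ (inj₁ refl))) → l₆ ; _ (inj₂ (inj₂ (inj₂ refl))) → l₉ })
        (λ { _ (inj₁ refl) → f₀ ; _ (inj₂ refl) → f₃ })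
        closed′ (everywhere-low closed′ l)
    ... | no no-triangle | no no-cross = ⊥-elim (Total.euler-contradiction G R S deg≥3
        (λ b arc closed l t l′ → no-triangle (b , arc , closed , (λ i → l (toℕ i)) , t , l′))
        (λ g arc closed t l f closed′ l′ → no-cross (g , arc , closed
          , (t 0 (inj₁ refl) , t 2 (inj₂ (inj₁ refl)) , t 3 (inj₂ (inj₂ (inj₁ refl))) , t 5 (inj₂ (inj₂ (inj₂ (inj₁ refl)))) , t 9 (inj₂ (inj₂ (inj₂ (inj₂ refl)))))
          , (l 4 (inj₁ refl) , l 5 (inj₂ (inj₁ refl)) , l 6 (inj₂ (inj₂ (inj₁ refl))) , l 9 (inj₂ (inj₂ (inj₂ refl))))
          , (f 0 (inj₁ refl) , f 3 (inj₂ refl)) , closed′ , (λ i → l′ (toℕ i))))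
        genus a₀b₀)

  colour : IFPartitionable G
  colour with anyDart? (λ (u , v) → Boolₚ.T? (adj u v) ×-dec (rot u (rot u v) Finₚ.≟ v ⊎-dec rot u v Finₚ.≟ v))
  ... | no none = HighDegree.colour λ u v uv → (λ e → none ((u , v) , uv , inj₂ e)) , (λ e → none ((u , v) , uv , inj₁ e))
  ... | yes ((u , v) , uv , small) = low-degree G R uv (deleted u v uv) v (rot u v) λ w uw →
          let k , e = rot-pow uv uw in subst (λ w → w ≡ v ⊎ w ≡ rot u v) e (among k)
    where
    rot² : rot u (rot u v) ≡ v
    rot² = [ id , (λ e → trans (cong (rot u) e) e) ]′ small
    among : ∀ k → pow (rot u) k v ≡ v ⊎ pow (rot u) k v ≡ rot u v
    among zero = inj₁ refl
    among (suc k) with among k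
    ... | inj₁ e = inj₂ (cong (rot u) e)
    ... | inj₂ e = inj₁ (trans (cong (rot u) e) rot²)

-- Induction on the number of edges

module _ (G : Graph) (R : RotationSystem G) (a b : Fin (Graph.n G)) (ab : Adj G a b) where
  open EdgeDeletion G R a b ab

  liftCycle : ∀ {k} → HasCycleOfLength G′ k → HasCycleOfLength G k
  liftCycle C = record { len≥3 = Cycle.len≥3 C ; vert = Cycle.vert C ; inj = Cycle.inj C ; edge = λ i → proj₁ (adj′⁻ (Cycle.edge C i)) }

  sparse′ : Sparse G → Sparse G′
  sparse′ S = record
    { no4 = no4 ∘ liftCycle
    ; no7 = no7 ∘ liftCycle
    ; no9 = no9 ∘ liftCycle
    ; no53 = λ C D na → no53 (liftCycle C) (liftCycle D) na
    }
    where open Sparse S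

-- The induction hypothesis is passed on for all edges at once, since the edge to delete depends on
-- the configuration that is found.
sparse-genus≤0⇒partitionable : ∀ k G R → edges G ≤ k → Genus≤0 G R → Sparse G → IFPartitionable G
sparse-genus≤0⇒partitionable k G R e≤k genus S
  with Enum.any? (pairEnum (Graph.n G)) (λ (u , v) → Boolₚ.T? (Graph.adj G u v))
... | no none = (λ _ → true) , (λ u v uv _ _ → none ((u , v) , uv)) , λ j C → proj₂ (Cycle.vert C (nonempty C))
  where
  nonempty : ∀ {W : Set} {f : W → W → Bool} {j} → Cycle W f j → Fin j
  nonempty C = fromℕ< (ℕₚ.≤-trans (s≤s z≤n) (Cycle.len≥3 C))
sparse-genus≤0⇒partitionable zero G R e≤0 genus S | yes ((a , b) , ab) =
  ⊥-elim (ℕₚ.<⇒≱ (ℕₚ.≤-trans (s≤s z≤n) (EdgeDeletion.fewer-edges G R a b ab)) e≤0)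
sparse-genus≤0⇒partitionable (suc k) G R e≤k genus S | yes ((a , b) , ab) =
  Critical.colour G R S genus (λ u v uv → sparse-genus≤0⇒partitionable k _ (EdgeDeletion.R′ G R u v uv)
    (ℕₚ.≤-pred (ℕₚ.≤-trans (EdgeDeletion.fewer-edges G R u v uv) e≤k))
    (EdgeDeletion.genus≤0 G R u v uv genus) (sparse′ G R u v uv S)) ab

theorem1p1 : (G : Graph) → Planar G
    → ¬ HasCycleOfLength G 4
    → ¬ HasCycleOfLength G 7
    → ¬ HasCycleOfLength G 9
    → (∀ (C : HasCycleOfLength G 5) (D : HasCycleOfLength G 3) → ¬ NormallyAdjacent C D)
    → IFPartitionable G
theorem1p1 G (R , euler) no4 no7 no9 no53 = sparse-genus≤0⇒partitionable (edges G) G R ℕₚ.≤-refl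
  (ℕₚ.≤-reflexive (sym euler)) record { no4 = no4 ; no7 = no7 ; no9 = no9 ; no53 = no53 }
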